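{- For every integer $n\geq 13$, $t(K(n,4))=\frac{n}{4}-1$. Moreover, if $S$ is a vertex cut of $K(n,4)$ such that $\frac{|S|}{c(K(n,4)\setminus S)} = \frac{n}{4}-1$, then $S$ is the complement of a maximum independent set of $K(n,4)$.
   Context: The Kneser graph $K(n,k)$ has as vertices the $k$-element subsets of $[n]=\{1,\dots,n\}$, two vertices adjacent iff the subsets are disjoint. A vertex cut is a set $S$ of vertices whose removal disconnects the graph; $c(G\setminus S)$ is the number of connected components after deleting $S$; the toughness is $t(G)=\min_S |S|/c(G\setminus S)$ over all vertex cuts $S$. -}

module Defs where

open import Data.Nat using (ℕ; zero; suc; _+_; _*_; _∸_; _≤_)
open import Data.Bool using (Bool; true; false; not; if_then_else_)
open import Data.Fin using (Fin)
open import Data.Fin.Subset using (Subset; ∣_∣; _∩_; ⊥)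
open import Data.Vec using (Vec; []; _∷_)
open import Data.List using (List; []; _∷_; _++_; map; concatMap)
open import Data.Nat.ListAction using (sum)
open import Data.Product using (Σ; ∃; _×_; _,_; proj₁)
open import Data.Nat using (_≟_)
open import Relation.Nullary using (¬_; yes; no)
open import Relation.Binary.PropositionalEquality using (_≡_)
open import Function.Bundles using (_⇔_)

allSubsets : (n : ℕ) → List (Subset n)
allSubsets zero = [] ∷ []
allSubsets (suc n) = map (true ∷_) (allSubsets n) ++ map (false ∷_) (allSubsets n)

Vertex : ℕ → ℕ → Set
Vertex n k = Σ (Subset n) (λ s → ∣ s ∣ ≡ k)

vertices : (n k : ℕ) → List (Vertex n k)
vertices n k = concatMap pick (allSubsets n)
  where
  pick : Subset n → List (Vertex n k)
  pick s with ∣ s ∣ ≟ k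
  ... | yes p = (s , p) ∷ []
  ... | no _ = []

Adj : ∀ {n k} → Vertex n k → Vertex n k → Set
Adj u v = proj₁ u ∩ proj₁ v ≡ ⊥

VSet : ℕ → ℕ → Set
VSet n k = Vertex n k → Bool

size : ∀ {n k} → VSet n k → ℕ
size {n} {k} S = sum (map (λ v → if S v then 1 else 0) (vertices n k))

data Reach {n k : ℕ} (S : VSet n k) (u : Vertex n k) : Vertex n k → Set where
  here : S u ≡ false → Reach S u u
  step : ∀ {v w} → Reach S u v → Adj v w → S w ≡ false → Reach S u w

-- K(n,k) \ S has exactly c connected components: there is a labelling of
-- the remaining vertices by Fin c, onto, with equal labels iff connected
Components : ∀ {n k} → VSet n k → ℕ → Set
Components {n} {k} S c =
  Σ (Vertex n k → Fin c) λ f →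
    (∀ i → ∃ λ v → S v ≡ false × f v ≡ i) ×
    (∀ u v → S u ≡ false → S v ≡ false → (f u ≡ f v ⇔ Reach S u v))

CutWith : ∀ {n k} → VSet n k → ℕ → Set
CutWith S c = 2 ≤ c × Components S c

Independent : ∀ {n k} → VSet n k → Set
Independent I = ∀ u v → I u ≡ true → I v ≡ true → ¬ Adj u v

MaxIndependent : ∀ {n k} → VSet n k → Set
MaxIndependent {n} {k} I = Independent I × (∀ (J : VSet n k) → Independent J → size J ≤ size I)

{-# OPTIONS --safe #-}

-- Katona's cycle method. Arrange the n points on a circle and look at the n arcs of four
-- consecutive points, read through a permutation σ as vertices; every vertex is an arc of equally
-- many σ. Give each vertex outside the cut weight 4 + (n - 4)/s, where s is the size of its
-- component, so that the total weight is 4 (N - |S|) + (n - 4) c with N the number of vertices.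
-- Arcs in different components must overlap, so a cycle which meets two components meets the
-- complement of S only within a short window, and its weight is at most 4n: this gives
-- (n - 4) c ≤ 4 |S|, and strictness when some s ≥ 2. Two configurations exceed 4n.
--
-- (i) Two arcs of one component of size 2 or 3 at distance 4, with arcs of three other components
-- in between: the excess is repaid by the arrangements in which the same two vertices are arcs at
-- distance 5, and these are equally frequent.
--
-- (ii) Nearly all arcs lie in one component C. A vertex outside C meets every arc of C, hence C has
-- at most 16 arcs in the cycle and n ≤ 20, and few 4-sets are left for the other components. The
-- finitely many values of n are settled by evaluation, and the bound then holds directly.

module Submission where

open import Defs
open import Data.Bool using (Bool; true; false; not; if_then_else_; _∧_; T)
open import Data.Bool.ListAction using (all)
import Data.Bool.Properties as Bool
open import Data.Empty as Empty using (⊥-elim)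
open import Data.Fin using (Fin; zero; suc; toℕ; fromℕ<)
open import Data.Fin.Permutation.Components using (transpose; transpose-inverse)
import Data.Fin.Properties as Fin
open import Data.Fin.Subset using (Subset; ∣_∣; _∩_; ⊥)
import Data.Fin.Subset.Properties as Subset
open import Data.List as List
  using (List; []; _∷_; _++_; map; concatMap; length; upTo; applyUpTo; allFin; filterᵇ; cartesianProductWith)
import Data.List.Properties as List
open import Data.List.Membership.Propositional using (_∈_)
open import Data.List.Membership.Propositional.Properties
import Data.List.Relation.Binary.Permutation.Propositional.Properties as ↭
open import Data.List.Relation.Unary.All as All using (All; []; _∷_)
open import Data.List.Relation.Unary.AllPairs using (AllPairs; []; _∷_)
open import Data.List.Relation.Unary.Any as Any using (Any; here; there; any?)
import Data.List.Relation.Unary.Any.Properties as Any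
open import Data.List.Relation.Unary.Unique.DecPropositional using (unique?)
open import Data.List.Relation.Unary.Unique.Propositional using (Unique)
import Data.List.Relation.Unary.Unique.Propositional.Properties as Unique
open import Data.Maybe using (Maybe; just; nothing)
open import Data.Maybe.Properties using (just-injective)
open import Data.Nat
open import Data.Nat.DivMod
open import Data.Nat.Divisibility using (_∣_; ∣-trans; m∣m*n; m≤n⇒m!∣n!)
open import Data.Nat.ListAction using (sum)
open import Data.Nat.ListAction.Properties using (sum-↭)
open import Data.Nat.Properties
open import Data.Nat.Tactic.RingSolver using (solve-∀)
open import Data.Product using (Σ; ∃; _×_; _,_; proj₁; proj₂)
open import Data.Sum using (_⊎_; inj₁; inj₂)
open import Data.Vec as Vec using (Vec; []; _∷_; lookup; tabulate; toList)
import Data.Vec.Properties as Vec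
open import Function using (_∘_; id; mk⇔)
open import Function.Bundles using (Equivalence)
open import Relation.Binary.Definitions using (tri<; tri≈; tri>)
open import Relation.Binary.PropositionalEquality hiding ([_])
open import Relation.Nullary using (¬_; Dec; yes; no; contradiction; does)
open import Relation.Nullary.Decidable using (True; toWitness; fromWitness; map′; does-⇔; dec-true)

-- Finite sums

-- An isolated vertex weighs n, so four consecutive arcs of isolated vertices already reach 4n. Five
-- arcs whose ends form a component of size 2 can reach 2 (4 + (n - 4)/2) + 3n = 4n + 4. If the ends
-- are at distance 5 and the size is at most 3, the weight is at most 12 + (n - 4) + 2n = 3n + 8,
-- which leaves n - 8. This has to exceed 4 for a strict inequality, and that is the condition n ≥
-- 13.
--
-- On a cycle with a single component, m arcs weigh at most 4m + n - 4, which exceeds 4n only for m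
-- > (3n + 4)/4. If moreover some arc is missing and s > (n - 1)(n - 4)/4, the share (n - 4)/s is
-- too small to matter. These are the thresholds in `Good`.
--
-- The maximality of the extremal set rests on the bound itself: deleting the complement of an
-- independent set J leaves |J| isolated vertices, so the bound for this cut says n |J| ≤ 4N, the
-- Erdős-Ko-Rado inequality.

∑ : {X : Set} → List X → (X → ℕ) → ℕ
∑ xs f = sum (map f xs)

χ : Bool → ℕ
χ b = if b then 1 else 0

private variable
  X Y : Set

∑-mono : (xs : List X) {f g : X → ℕ} → (∀ {x} → x ∈ xs → f x ≤ g x) → ∑ xs f ≤ ∑ xs g
∑-mono []       f≤g = z≤n
∑-mono (x ∷ xs) f≤g = +-mono-≤ (f≤g (here refl)) (∑-mono xs (f≤g ∘ there))

∑-cong : (xs : List X) {f g : X → ℕ} → (∀ {x} → x ∈ xs → f x ≡ g x) → ∑ xs f ≡ ∑ xs g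
∑-cong xs f≡g = ≤-antisym (∑-mono xs (≤-reflexive ∘ f≡g)) (∑-mono xs (≤-reflexive ∘ sym ∘ f≡g))

∑-+ : (xs : List X) (f g : X → ℕ) → ∑ xs (λ x → f x + g x) ≡ ∑ xs f + ∑ xs g
∑-+ []       f g = refl
∑-+ (x ∷ xs) f g rewrite ∑-+ xs f g = interchange (f x) (g x) (∑ xs f) (∑ xs g)
  where
  interchange : ∀ a b c d → a + b + (c + d) ≡ a + c + (b + d)
  interchange a b c d = begin
    a + b + (c + d)   ≡⟨ +-assoc a b (c + d) ⟩
    a + (b + (c + d)) ≡⟨ cong (a +_) (+-assoc b c d) ⟨
    a + (b + c + d)   ≡⟨ cong (λ z → a + (z + d)) (+-comm b c) ⟩
    a + (c + b + d)   ≡⟨ cong (a +_) (+-assoc c b d) ⟩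
    a + (c + (b + d)) ≡⟨ +-assoc a c (b + d) ⟨
    a + c + (b + d)   ∎
    where open ≡-Reasoning

∑-*ˡ : (c : ℕ) (xs : List X) (f : X → ℕ) → ∑ xs (λ x → c * f x) ≡ c * ∑ xs f
∑-*ˡ c []       f = sym (*-zeroʳ c)
∑-*ˡ c (x ∷ xs) f rewrite ∑-*ˡ c xs f = sym (*-distribˡ-+ c (f x) (∑ xs f))

∑-const : (xs : List X) (c : ℕ) → ∑ xs (λ _ → c) ≡ length xs * c
∑-const []       c = refl
∑-const (x ∷ xs) c = cong (c +_) (∑-const xs c)

∑-zero : (xs : List X) {f : X → ℕ} → (∀ {x} → x ∈ xs → f x ≡ 0) → ∑ xs f ≡ 0
∑-zero xs f≡0 = trans (∑-cong xs f≡0) (trans (∑-const xs 0) (*-zeroʳ (length xs)))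

∑-swap : (xs : List X) (ys : List Y) (f : X → Y → ℕ) →
         ∑ xs (λ x → ∑ ys (f x)) ≡ ∑ ys (λ y → ∑ xs (λ x → f x y))
∑-swap []       ys f = sym (∑-zero ys (λ _ → refl))
∑-swap (x ∷ xs) ys f rewrite ∑-swap xs ys f = sym (∑-+ ys (f x) (λ y → ∑ xs (λ x → f x y)))

f≤∑ : {xs : List X} {x : X} (f : X → ℕ) → x ∈ xs → f x ≤ ∑ xs f
f≤∑ {xs = x ∷ xs} f (here refl) = m≤m+n (f x) (∑ xs f)
f≤∑ {xs = y ∷ xs} f (there p)   = ≤-trans (f≤∑ f p) (m≤n+m (∑ xs f) (f y))

∑-inject : {xs : List X} {ys : List Y} → Unique xs → (φ : X → Y) →
  (∀ {x y} → x ∈ xs → y ∈ xs → φ x ≡ φ y → x ≡ y) → (∀ {x} → x ∈ xs → φ x ∈ ys) →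
  {f : X → ℕ} {g : Y → ℕ} → (∀ {x} → x ∈ xs → f x ≤ g (φ x)) → ∑ xs f ≤ ∑ ys g
∑-inject {xs = []} _ φ inj sub f≤g = z≤n
∑-inject {xs = x ∷ xs} {ys} (x∉ ∷ u) φ inj sub {f} {g} f≤g
  with ∈-∃++ (sub (here refl))
... | as , bs , refl = begin
  f x + ∑ xs f              ≤⟨ +-mono-≤ (f≤g (here refl)) (∑-inject u φ (λ p q → inj (there p) (there q)) sub′ (f≤g ∘ there)) ⟩
  g (φ x) + ∑ (as ++ bs) g  ≡⟨ sum-↭ (↭.map⁺ g (↭.shift (φ x) as bs)) ⟨
  ∑ ys g                    ∎
  where
  open ≤-Reasoning
  sub′ : ∀ {y} → y ∈ xs → φ y ∈ as ++ bs
  sub′ {y} y∈ with ↭.∈-resp-↭ (↭.shift (φ x) as bs) (sub (there y∈))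
  ... | here eq = contradiction (sym (inj (there y∈) (here refl) eq)) (All.lookup x∉ y∈)
  ... | there p = p

squeeze : ∀ {a b c d} → a ≤ c → b ≤ d → a + b ≡ c + d → a ≡ c
squeeze {a} {b} {c} {d} a≤c b≤d eq = ≤-antisym a≤c (+-cancelʳ-≤ b c a (begin
  c + b ≤⟨ +-monoʳ-≤ c b≤d ⟩
  c + d ≡⟨ eq ⟨
  a + b ∎))
  where open ≤-Reasoning

-- Surjectivity of `φ` is never constructed: `∑-inject` is applied both to `f` and to its complement
-- `∑ xs f ∸ f x`. The two together have the same sum before and after `φ`, so both inequalities are
-- equalities.
∑-endo : {xs : List X} → Unique xs → (φ : X → X) →
  (∀ {x y} → x ∈ xs → y ∈ xs → φ x ≡ φ y → x ≡ y) → (∀ {x} → x ∈ xs → φ x ∈ xs) →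
  (f : X → ℕ) → ∑ xs (f ∘ φ) ≡ ∑ xs f
∑-endo {xs = xs} u φ inj sub f = squeeze
  (∑-inject u φ inj sub (λ _ → ≤-refl)) (∑-inject u φ inj sub {g = co} (λ _ → ≤-refl))
  (begin
    ∑ xs (f ∘ φ) + ∑ xs (co ∘ φ)          ≡⟨ ∑-+ xs (f ∘ φ) (co ∘ φ) ⟨
    ∑ xs (λ x → f (φ x) + co (φ x))       ≡⟨ ∑-cong xs (λ p → m+[n∸m]≡n (f≤∑ f (sub p))) ⟩
    ∑ xs (λ _ → ∑ xs f)                   ≡⟨ ∑-cong xs (λ p → m+[n∸m]≡n (f≤∑ f p)) ⟨
    ∑ xs (λ x → f x + co x)               ≡⟨ ∑-+ xs f co ⟩
    ∑ xs f + ∑ xs co                      ∎)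
  where
  open ≡-Reasoning
  co = λ x → ∑ xs f ∸ f x

∑-δ : (_≟A_ : (x y : X) → Dec (x ≡ y)) {xs : List X} → Unique xs → {a : X} → a ∈ xs →
      (f : X → ℕ) → ∑ xs (λ x → χ (does (a ≟A x)) * f x) ≡ f a
∑-δ _≟A_ {x ∷ xs} (x∉ ∷ u) {a} (here refl) f with a ≟A a
... | no a≢a = contradiction refl a≢a
... | yes _ = trans (cong₂ _+_ (*-identityˡ (f a)) (∑-zero xs rest)) (+-identityʳ (f a))
  where
  rest : ∀ {y} → y ∈ xs → χ (does (a ≟A y)) * f y ≡ 0
  rest {y} y∈ with a ≟A y
  ... | yes a≡y = contradiction a≡y (All.lookup x∉ y∈)
  ... | no _ = refl
∑-δ _≟A_ {x ∷ xs} (x∉ ∷ u) {a} (there p) f with a ≟A x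
... | yes a≡x = contradiction (sym a≡x) (All.lookup x∉ p)
... | no _ = ∑-δ _≟A_ u p f

∑-allFin-lookup : ∀ {n} (v : Subset n) → ∑ (allFin n) (λ x → χ (lookup v x)) ≡ ∣ v ∣
∑-allFin-lookup v = lem v id (lookup v) (λ _ → refl)
  where
  lem : ∀ {m} {A : Set} (v : Subset m) (e : Fin m → A) (f : A → Bool) → (∀ i → f (e i) ≡ lookup v i) →
        ∑ (List.tabulate e) (χ ∘ f) ≡ ∣ v ∣
  lem [] e f eq = refl
  lem (b ∷ v) e f eq rewrite eq zero with b
  ... | true = cong suc (lem v (e ∘ suc) f (eq ∘ suc))
  ... | false = lem v (e ∘ suc) f (eq ∘ suc)

-- Opaque, so that sums over range (13 + k) are not unfolded during type checking.
abstract

  range : ℕ → List ℕ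
  range = upTo

  range≡upTo : ∀ m → range m ≡ upTo m
  range≡upTo m = refl

  ∈-range⁺ : ∀ {m i} → i < m → i ∈ range m
  ∈-range⁺ = ∈-upTo⁺

  ∈-range⁻ : ∀ {m i} → i ∈ range m → i < m
  ∈-range⁻ = ∈-upTo⁻

  range-unique : ∀ m → Unique (range m)
  range-unique = Unique.upTo⁺

  length-range : ∀ m → length (range m) ≡ m
  length-range = List.length-upTo

-- Vertices and arrangements

allSubsets-complete : ∀ {n} (s : Subset n) → s ∈ allSubsets n
allSubsets-complete []          = here refl
allSubsets-complete (true ∷ s)  = ∈-++⁺ˡ (∈-map⁺ (true ∷_) (allSubsets-complete s))
allSubsets-complete (false ∷ s) = ∈-++⁺ʳ (map (true ∷_) (allSubsets _)) (∈-map⁺ (false ∷_) (allSubsets-complete s))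

allSubsets-unique : ∀ n → Unique (allSubsets n)
allSubsets-unique zero    = [] ∷ []
allSubsets-unique (suc n) = Unique.++⁺ (Unique.map⁺ (λ { refl → refl }) (allSubsets-unique n))
                                       (Unique.map⁺ (λ { refl → refl }) (allSubsets-unique n)) disj
  where
  disj : ∀ {s} → ¬ (s ∈ map (true ∷_) (allSubsets n) × s ∈ map (false ∷_) (allSubsets n))
  disj (p , q) with ∈-map⁻ (true ∷_) p | ∈-map⁻ (false ∷_) q
  ... | _ , _ , refl | _ , _ , ()

-- Shared by vertices (subsets of a given size) and arrangements (vectors without repetition).
module Subtype {A : Set} {P : A → Set} (irr : ∀ {x} (p q : P x) → p ≡ q) where

  restrict : {x : A} → Dec (P x) → List (Σ A P)
  restrict {x} (yes p) = (x , p) ∷ []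
  restrict     (no _)  = []

  Σ-≡ : {u v : Σ A P} → proj₁ u ≡ proj₁ v → u ≡ v
  Σ-≡ {x , p} {x , q} refl = cong (x ,_) (irr p q)

  ∈-restrict⁻ : {x : A} (d : Dec (P x)) {v : Σ A P} → v ∈ restrict d → proj₁ v ≡ x
  ∈-restrict⁻ (yes p) (here refl) = refl

  module _ (P? : ∀ x → Dec (P x)) where

    sub : List A → List (Σ A P)
    sub = concatMap (restrict ∘ P?)

    ∈-restrict : (v : Σ A P) → v ∈ restrict (P? (proj₁ v))
    ∈-restrict (x , p) with P? x
    ... | yes q = here (Σ-≡ refl)
    ... | no ¬p = contradiction p ¬p

    sub-complete : {xs : List A} (v : Σ A P) → proj₁ v ∈ xs → v ∈ sub xs
    sub-complete {xs} v v∈ = ∈-concatMap⁺ _ {xs = xs} (Any.map (λ { refl → ∈-restrict v }) v∈)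

    sub-sound : (xs : List A) {v : Σ A P} → v ∈ sub xs → proj₁ v ∈ xs
    sub-sound xs v∈ = Any.map (λ {x} → ∈-restrict⁻ (P? x)) (∈-concatMap⁻ _ {xs = xs} v∈)

    sub-unique : {xs : List A} → Unique xs → Unique (sub xs)
    sub-unique {[]} _ = []
    sub-unique {x ∷ xs} (x∉ ∷ u) = go (P? x)
      where
      go : (d : Dec (P x)) → Unique (restrict d ++ sub xs)
      go (yes p) = All.tabulate (λ { v∈ refl → All.lookup x∉ (sub-sound xs v∈) refl }) ∷ sub-unique u
      go (no _)  = sub-unique u

module _ {n k : ℕ} where

  open Subtype {Subset n} {λ s → ∣ s ∣ ≡ k} ≡-irrelevant

  -- The local function of vertices, which has no name here, recovered by unification.
  pick : Σ (Subset n → List (Vertex n k)) (λ p → vertices n k ≡ concatMap p (allSubsets n))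
  pick = _ , refl

  vertices≡sub : vertices n k ≡ sub (λ s → ∣ s ∣ ≟ k) (allSubsets n)
  vertices≡sub = List.concatMap-cong pick≗ (allSubsets n)
    where
    pick≗ : ∀ s → proj₁ pick s ≡ restrict {s} (∣ s ∣ ≟ k)
    pick≗ s with ∣ s ∣ ≟ k
    ... | yes _ = refl
    ... | no _  = refl

  abstract

    verts : List (Vertex n k)
    verts = vertices n k

    verts≡vertices : verts ≡ vertices n k
    verts≡vertices = refl

  verts-complete : (v : Vertex n k) → v ∈ verts
  verts-complete v rewrite verts≡vertices | vertices≡sub =
    sub-complete (λ s → ∣ s ∣ ≟ k) v (allSubsets-complete (proj₁ v))

  verts-unique : Unique verts
  verts-unique rewrite verts≡vertices | vertices≡sub = sub-unique (λ s → ∣ s ∣ ≟ k) (allSubsets-unique n)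

  Vertex-≡ : {u v : Vertex n k} → proj₁ u ≡ proj₁ v → u ≡ v
  Vertex-≡ = Σ-≡

  _≟ⱽ_ : (u v : Vertex n k) → Dec (u ≡ v)
  u ≟ⱽ v = map′ Vertex-≡ (cong proj₁) (Vec.≡-dec Bool._≟_ (proj₁ u) (proj₁ v))

  #vertices : ℕ
  #vertices = length verts

  size≡∑verts : (J : VSet n k) → size J ≡ ∑ verts (χ ∘ J)
  size≡∑verts J = cong (λ xs → ∑ xs (χ ∘ J)) (sym verts≡vertices)

-- Arrangements as vectors without repetition

vecs : ∀ n m → List (Vec (Fin n) m)
vecs n zero    = [] ∷ []
vecs n (suc m) = cartesianProductWith _∷_ (allFin n) (vecs n m)

vecs-complete : ∀ {n m} (v : Vec (Fin n) m) → v ∈ vecs n m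
vecs-complete []      = here refl
vecs-complete (x ∷ v) = ∈-cartesianProductWith⁺ _∷_ (∈-allFin x) (vecs-complete v)

vecs-unique : ∀ n m → Unique (vecs n m)
vecs-unique n zero    = [] ∷ []
vecs-unique n (suc m) = Unique.cartesianProductWith⁺ _∷_ (λ { refl → refl , refl }) (Unique.allFin⁺ n) (vecs-unique n m)

-- `True` of the decision instead of `Unique` itself, so that proofs are irrelevant and an
-- arrangement is determined by its vector.
Distinct : ∀ {n m} → Vec (Fin n) m → Set
Distinct v = True (unique? Fin._≟_ (toList v))

Perm : ℕ → Set
Perm n = Σ (Vec (Fin n) n) Distinct

module _ {n : ℕ} where

  open Subtype {Vec (Fin n) n} {Distinct} Bool.T-irrelevant

  distinct? : (v : Vec (Fin n) n) → Dec (Distinct v)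
  distinct? v = Bool.T? _

  abstract
    perms : List (Perm n)
    perms = sub distinct? (vecs n n)

    perms-complete : (σ : Perm n) → σ ∈ perms
    perms-complete σ = sub-complete distinct? σ (vecs-complete (proj₁ σ))

    perms-unique : Unique perms
    perms-unique = sub-unique distinct? (vecs-unique n n)

  Perm-≡ : {σ τ : Perm n} → proj₁ σ ≡ proj₁ τ → σ ≡ τ
  Perm-≡ = Σ-≡

∑-perms : ∀ {n} (φ : Perm n → Perm n) → (∀ {σ τ} → φ σ ≡ φ τ → σ ≡ τ) → (F : Perm n → ℕ) →
          ∑ perms (F ∘ φ) ≡ ∑ perms F
∑-perms φ inj F = ∑-endo perms-unique φ (λ _ _ → inj) (λ _ → perms-complete _) F

distinct : ∀ {n m} {v : Vec (Fin n) m} → Unique (toList v) → Distinct v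
distinct u = fromWitness u

distinct⁻ : ∀ {n m} {v : Vec (Fin n) m} → Distinct v → Unique (toList v)
distinct⁻ d = toWitness d

∈-toList⁺ : ∀ {A : Set} {m} (v : Vec A m) i → lookup v i ∈ toList v
∈-toList⁺ (x ∷ v) zero    = here refl
∈-toList⁺ (x ∷ v) (suc i) = there (∈-toList⁺ v i)

∈-toList⁻ : ∀ {A : Set} {m} (v : Vec A m) {x} → x ∈ toList v → ∃ λ i → lookup v i ≡ x
∈-toList⁻ (x ∷ v) (here refl) = zero , refl
∈-toList⁻ (x ∷ v) (there p) with ∈-toList⁻ v p
... | i , eq = suc i , eq

unique⇒injective : ∀ {A : Set} {m} (v : Vec A m) → Unique (toList v) → ∀ {i j} → lookup v i ≡ lookup v j → i ≡ j
unique⇒injective (x ∷ v) (x∉ ∷ u) {zero}  {zero}  eq = refl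
unique⇒injective (x ∷ v) (x∉ ∷ u) {zero}  {suc j} eq = contradiction eq (All.lookup x∉ (∈-toList⁺ v j))
unique⇒injective (x ∷ v) (x∉ ∷ u) {suc i} {zero}  eq = contradiction (sym eq) (All.lookup x∉ (∈-toList⁺ v i))
unique⇒injective (x ∷ v) (x∉ ∷ u) {suc i} {suc j} eq = cong suc (unique⇒injective v u eq)

module _ {n : ℕ} (σ : Perm n) where

  injective : ∀ {i j} → lookup (proj₁ σ) i ≡ lookup (proj₁ σ) j → i ≡ j
  injective = unique⇒injective (proj₁ σ) (distinct⁻ {v = proj₁ σ} (proj₂ σ))

  abstract

    -- Pigeonhole: a value that is never taken could be put in front of the vector, giving n + 1
    -- distinct elements of `Fin n`.
    surjective : ∀ y → ∃ λ i → lookup (proj₁ σ) i ≡ y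
    surjective y with any? (y Fin.≟_) (toList (proj₁ σ))
    ... | yes p = ∈-toList⁻ (proj₁ σ) p
    ... | no ¬p = contradiction too-long (<⇒≱ (n<1+n n))
      where
      long : Unique (y ∷ toList (proj₁ σ))
      long = All.tabulate (λ x∈ y≡x → ¬p (subst (_∈ toList (proj₁ σ)) (sym y≡x) x∈)) ∷ distinct⁻ {v = proj₁ σ} (proj₂ σ)
      too-long : suc n ≤ n
      too-long = begin
        suc n                                    ≡⟨ cong suc (Vec.length-toList (proj₁ σ)) ⟨
        length (y ∷ toList (proj₁ σ))            ≡⟨ *-identityʳ _ ⟨
        length (y ∷ toList (proj₁ σ)) * 1        ≡⟨ ∑-const (y ∷ toList (proj₁ σ)) 1 ⟨
        ∑ (y ∷ toList (proj₁ σ)) (λ _ → 1)       ≤⟨ ∑-inject long id (λ _ _ → id) (λ _ → ∈-allFin _) {g = λ _ → 1} (λ _ → ≤-refl) ⟩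
        ∑ (allFin n) (λ _ → 1)                   ≡⟨ ∑-const (allFin n) 1 ⟩
        length (allFin n) * 1                    ≡⟨ *-identityʳ _ ⟩
        length (allFin n)                        ≡⟨ List.length-tabulate id ⟩
        n                                        ∎
        where open ≤-Reasoning

  -- `σ` sends each point to its place on the circle, and `P` is a set of places; the result is the
  -- set of points put there, a preimage under `σ`. Accordingly `mapᴾ` below moves places and
  -- `swapᴾ` moves points.
  image : Subset n → Subset n
  image P = Vec.map (lookup P) (proj₁ σ)

  lookup-image : ∀ P i → lookup (image P) i ≡ lookup P (lookup (proj₁ σ) i)
  lookup-image P i = Vec.lookup-map i (lookup P) (proj₁ σ)

  ∣image∣ : ∀ P → ∣ image P ∣ ≡ ∣ P ∣
  ∣image∣ P = begin
    ∣ image P ∣                                                   ≡⟨ ∑-allFin-lookup (image P) ⟨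
    ∑ (allFin n) (λ x → χ (lookup (image P) x))                   ≡⟨ ∑-cong (allFin n) (λ {x} _ → cong χ (lookup-image P x)) ⟩
    ∑ (allFin n) (λ x → χ (lookup P (lookup (proj₁ σ) x)))        ≡⟨ ∑-endo (Unique.allFin⁺ n) (lookup (proj₁ σ)) (λ _ _ → injective) (λ _ → ∈-allFin _) (χ ∘ lookup P) ⟩
    ∑ (allFin n) (λ x → χ (lookup P x))                           ≡⟨ ∑-allFin-lookup P ⟩
    ∣ P ∣                                                         ∎
    where open ≡-Reasoning

module _ {n : ℕ} where

  mapᴾ : (τ : Fin n → Fin n) → (∀ {i j} → τ i ≡ τ j → i ≡ j) → Perm n → Perm n
  mapᴾ τ inj (v , d) = Vec.map τ v , distinct (subst Unique (sym (Vec.toList-map τ v)) (Unique.map⁺ inj (distinct⁻ {v = v} d)))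

  mapᴾ-injective : ∀ τ (inj : ∀ {i j} → τ i ≡ τ j → i ≡ j) {σ ρ} → mapᴾ τ inj σ ≡ mapᴾ τ inj ρ → σ ≡ ρ
  mapᴾ-injective τ inj eq = Perm-≡ (go _ _ (cong proj₁ eq))
    where
    go : ∀ {m} (u v : Vec (Fin n) m) → Vec.map τ u ≡ Vec.map τ v → u ≡ v
    go []      []      _  = refl
    go (x ∷ u) (y ∷ v) eq = cong₂ _∷_ (inj (Vec.∷-injectiveˡ eq)) (go u v (Vec.∷-injectiveʳ eq))

  image-mapᴾ : ∀ τ (inj : ∀ {i j} → τ i ≡ τ j → i ≡ j) σ (P Q : Subset n) →
               (∀ x → lookup P (τ x) ≡ lookup Q x) → image (mapᴾ τ inj σ) P ≡ image σ Q
  image-mapᴾ τ inj (v , _) P Q eq = trans (sym (Vec.map-∘ (lookup P) τ v)) (Vec.map-cong eq v)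

idᴾ : ∀ {n} → Perm n
idᴾ {n} = Vec.allFin n , distinct (subst Unique (go id) (Unique.allFin⁺ n))
  where
  go : ∀ {m} {A : Set} (f : Fin m → A) → List.tabulate f ≡ toList (tabulate f)
  go {zero}  f = refl
  go {suc m} f = cong (f zero ∷_) (go (f ∘ suc))

-- Adjacent transpositions and functions of subsets determined by size

swapAt : ∀ {A : Set} {m} → ℕ → Vec A m → Vec A m
swapAt zero    (x ∷ y ∷ v) = y ∷ x ∷ v
swapAt (suc j) (x ∷ v)     = x ∷ swapAt j v
swapAt _       v           = v

module _ {A : Set} where

  swapAt-involutive : ∀ {m} j (v : Vec A m) → swapAt j (swapAt j v) ≡ v
  swapAt-involutive zero    []          = refl
  swapAt-involutive zero    (x ∷ [])    = refl
  swapAt-involutive zero    (x ∷ y ∷ v) = refl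
  swapAt-involutive (suc j) []          = refl
  swapAt-involutive (suc j) (x ∷ v)     = cong (x ∷_) (swapAt-involutive j v)

  swapAt-injective : ∀ {m} j {u v : Vec A m} → swapAt j u ≡ swapAt j v → u ≡ v
  swapAt-injective j {u} {v} eq = trans (sym (swapAt-involutive j u)) (trans (cong (swapAt j) eq) (swapAt-involutive j v))

  swapAt-map : ∀ {B : Set} (f : A → B) {m} j (v : Vec A m) → Vec.map f (swapAt j v) ≡ swapAt j (Vec.map f v)
  swapAt-map f zero    []          = refl
  swapAt-map f zero    (x ∷ [])    = refl
  swapAt-map f zero    (x ∷ y ∷ v) = refl
  swapAt-map f (suc j) []          = refl
  swapAt-map f (suc j) (x ∷ v)     = cong (f x ∷_) (swapAt-map f j v)

  swapAt-All : ∀ {P : A → Set} {m} j (v : Vec A m) → All P (toList v) → All P (toList (swapAt j v))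
  swapAt-All zero    []          ps             = ps
  swapAt-All zero    (x ∷ [])    ps             = ps
  swapAt-All zero    (x ∷ y ∷ v) (px ∷ py ∷ ps) = py ∷ px ∷ ps
  swapAt-All (suc j) []          ps             = ps
  swapAt-All (suc j) (x ∷ v)     (px ∷ ps)      = px ∷ swapAt-All j v ps

  swapAt-unique : ∀ {m} j (v : Vec A m) → Unique (toList v) → Unique (toList (swapAt j v))
  swapAt-unique zero    []          u                            = u
  swapAt-unique zero    (x ∷ [])    u                            = u
  swapAt-unique zero    (x ∷ y ∷ v) ((x≢y ∷ x∉) ∷ (y∉ ∷ u))      = ((x≢y ∘ sym) ∷ y∉) ∷ (x∉ ∷ u)
  swapAt-unique (suc j) []          u                            = u
  swapAt-unique (suc j) (x ∷ v)     (x∉ ∷ u)                     = swapAt-All j v x∉ ∷ swapAt-unique j v u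

swapᴾ : ∀ {n} → ℕ → Perm n → Perm n
swapᴾ j (v , d) = swapAt j v , distinct (swapAt-unique j v (distinct⁻ {v = v} d))

module _ {A : Set} where

  -- Transitivity of the adjacent transpositions on subsets of a fixed size, expressed through
  -- invariant functions so that the induction can pass to `g ∘ (b ∷_)`.
  SizeDetermined : ℕ → Set
  SizeDetermined n = (g : Subset n → A) → (∀ j s → g (swapAt j s) ≡ g s) → ∀ u v → ∣ u ∣ ≡ ∣ v ∣ → g u ≡ g v

  private
    drop-one : ∀ {m l} (v : Subset (suc m)) → ∣ v ∣ ≡ suc l → ∃ λ (v′ : Subset m) → ∣ v′ ∣ ≡ l
    drop-one (true ∷ v) eq = v , suc-injective eq
    drop-one {suc m} (false ∷ v) eq with drop-one v eq
    ... | v′ , eq′ = false ∷ v′ , eq′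
    drop-one {zero} (false ∷ []) ()

    module Step {n : ℕ} (ih : SizeDetermined n) (g : Subset (suc n) → A) (inv : ∀ j s → g (swapAt j s) ≡ g s) where

      same : ∀ b u v → ∣ u ∣ ≡ ∣ v ∣ → g (b ∷ u) ≡ g (b ∷ v)
      same b = ih (g ∘ (b ∷_)) (λ j s → inv (suc j) (b ∷ s))

    -- When the heads differ, the tails are first replaced by `false ∷ v′` and `true ∷ v′` with a
    -- common `v′`; a single swap of the first two entries then connects the sets.
    mixed : ∀ {n} (ih : SizeDetermined n) (g : Subset (suc n) → A) (inv : ∀ j s → g (swapAt j s) ≡ g s) →
            ∀ u v → suc ∣ u ∣ ≡ ∣ v ∣ → g (true ∷ u) ≡ g (false ∷ v)
    mixed {zero}  ih g inv [] [] ()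
    mixed {suc n} ih g inv u v eq with drop-one v (sym eq)
    ... | v′ , eq′ = begin
      g (true ∷ u)          ≡⟨ same true u (false ∷ v′) (sym eq′) ⟩
      g (true ∷ false ∷ v′) ≡⟨ inv 0 (true ∷ false ∷ v′) ⟨
      g (false ∷ true ∷ v′) ≡⟨ same false (true ∷ v′) v (trans (cong suc eq′) eq) ⟩
      g (false ∷ v)         ∎
      where
      open ≡-Reasoning
      open Step ih g inv

  swap-invariant⇒size-determined : ∀ n → SizeDetermined n
  swap-invariant⇒size-determined zero    g inv [] [] eq = refl
  swap-invariant⇒size-determined (suc n) g inv (true ∷ u)  (true ∷ v)  eq =
    Step.same (swap-invariant⇒size-determined n) g inv true u v (suc-injective eq)
  swap-invariant⇒size-determined (suc n) g inv (false ∷ u) (false ∷ v) eq =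
    Step.same (swap-invariant⇒size-determined n) g inv false u v eq
  swap-invariant⇒size-determined (suc n) g inv (true ∷ u)  (false ∷ v) eq =
    mixed (swap-invariant⇒size-determined n) g inv u v eq
  swap-invariant⇒size-determined (suc n) g inv (false ∷ u) (true ∷ v)  eq =
    sym (mixed (swap-invariant⇒size-determined n) g inv v u (sym eq))

∩≡⊥⁺ : ∀ {n} (u v : Subset n) → (∀ x → lookup u x ≡ true → lookup v x ≡ true → Empty.⊥) → u ∩ v ≡ ⊥
∩≡⊥⁺ [] [] f = refl
∩≡⊥⁺ (true ∷ u)  (true ∷ v)  f = ⊥-elim (f zero refl refl)
∩≡⊥⁺ (true ∷ u)  (false ∷ v) f = cong (false ∷_) (∩≡⊥⁺ u v (f ∘ suc))
∩≡⊥⁺ (false ∷ u) (y ∷ v)     f = cong (false ∷_) (∩≡⊥⁺ u v (f ∘ suc))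

∩≡⊥⁻ : ∀ {n} (u v : Subset n) → u ∩ v ≡ ⊥ → ∀ x → lookup u x ≡ true → lookup v x ≡ true → Empty.⊥
∩≡⊥⁻ (true ∷ u) (true ∷ v) () zero refl refl
∩≡⊥⁻ (a ∷ u) (b ∷ v) eq (suc x) p q = ∩≡⊥⁻ u v (Vec.∷-injectiveʳ eq) x p q

image-disjoint : ∀ {n} (σ : Perm n) {P Q} → P ∩ Q ≡ ⊥ → image σ P ∩ image σ Q ≡ ⊥
image-disjoint σ {P} {Q} eq = ∩≡⊥⁺ (image σ P) (image σ Q) (λ x p q → ∩≡⊥⁻ P Q eq (lookup (proj₁ σ) x)
  (trans (sym (lookup-image σ P x)) p) (trans (sym (lookup-image σ Q x)) q))

-- Cyclic arcs

module Arcs (p : ℕ) (12≤p : 12 ≤ p) where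

  n : ℕ
  n = suc p

  %-absorbˡ : ∀ a b → (a % n + b) % n ≡ (a + b) % n
  %-absorbˡ a b = begin
    (a % n + b) % n             ≡⟨ %-distribˡ-+ (a % n) b n ⟩
    (a % n % n + b % n) % n     ≡⟨ cong (λ z → (z + b % n) % n) (m%n%n≡m%n a n) ⟩
    (a % n + b % n) % n         ≡⟨ %-distribˡ-+ a b n ⟨
    (a + b) % n                 ∎
    where open ≡-Reasoning

  shift-injective : ∀ a {x y} → x < n → y < n → (x + a) % n ≡ (y + a) % n → x ≡ y
  shift-injective a {x} {y} x<n y<n eq = begin
    x                                 ≡⟨ undo x x<n ⟨
    ((x + a) % n + a * p) % n  ≡⟨ cong (λ z → (z + a * p) % n) eq ⟩
    ((y + a) % n + a * p) % n  ≡⟨ undo y y<n ⟩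
    y                                 ∎
    where
    open ≡-Reasoning
    undo : ∀ x → x < n → ((x + a) % n + a * p) % n ≡ x
    undo x x<n = begin
      ((x + a) % n + a * p) % n  ≡⟨ %-absorbˡ (x + a) _ ⟩
      (x + a + a * p) % n        ≡⟨ cong (_% n) (+-assoc x a _) ⟩
      (x + (a + a * p)) % n      ≡⟨ cong (λ z → (x + z) % n) (*-suc a p) ⟨
      (x + a * n) % n                   ≡⟨ [m+kn]%n≡m%n x a n ⟩
      x % n                             ≡⟨ m<n⇒m%n≡m x<n ⟩
      x                                 ∎

  abstract

    -- Subtraction x - t modulo n, with p = n - 1 in the role of -1: the number of steps forward
    -- from place t to place x. Hence `A t` below is the arc t, t + 1, t + 2, t + 3.
    pos : ℕ → ℕ → ℕ
    pos t x = (x + t * p) % n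

    pos<n : ∀ t x → pos t x < n
    pos<n t x = m%n<n (x + t * p) n

    pos-+ : ∀ s t x → pos t (pos s x) ≡ pos (s + t) x
    pos-+ s t x = begin
      ((x + s * p) % n + t * p) % n ≡⟨ %-absorbˡ (x + s * p) _ ⟩
      (x + s * p + t * p) % n       ≡⟨ cong (_% n) (+-assoc x (s * p) _) ⟩
      (x + (s * p + t * p)) % n     ≡⟨ cong (λ z → (x + z) % n) (*-distribʳ-+ p s t) ⟨
      (x + (s + t) * p) % n                ∎
      where open ≡-Reasoning

    pos-period : ∀ t x → pos (t + n) x ≡ pos t x
    pos-period t x = begin
      (x + (t + n) * p) % n                ≡⟨ cong (λ z → (x + z) % n) (*-distribʳ-+ p t n) ⟩
      (x + (t * p + n * p)) % n     ≡⟨ cong (_% n) (+-assoc x _ _) ⟨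
      (x + t * p + n * p) % n       ≡⟨ cong (λ z → (x + t * p + z) % n) (*-comm n p) ⟩
      (x + t * p + p * n) % n       ≡⟨ [m+kn]%n≡m%n (x + t * p) p n ⟩
      pos t x                                     ∎
      where open ≡-Reasoning

    pos+ : ∀ t x → (pos t x + t) % n ≡ x % n
    pos+ t x = begin
      ((x + t * p) % n + t) % n  ≡⟨ %-absorbˡ (x + t * p) t ⟩
      (x + t * p + t) % n        ≡⟨ cong (_% n) (+-assoc x _ t) ⟩
      (x + (t * p + t)) % n      ≡⟨ cong (λ z → (x + z) % n) (trans (+-comm _ t) (sym (*-suc t p))) ⟩
      (x + t * n) % n                   ≡⟨ [m+kn]%n≡m%n x t n ⟩
      x % n                             ∎
      where open ≡-Reasoning

    pos-injectiveʳ : ∀ t {x y} → x < n → y < n → pos t x ≡ pos t y → x ≡ y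
    pos-injectiveʳ t = shift-injective (t * p)

    pos-injectiveˡ : ∀ x {s t} → s < n → t < n → pos s x ≡ pos t x → s ≡ t
    pos-injectiveˡ x {s} {t} s<n t<n eq = shift-injective (pos s x) s<n t<n (begin
      (s + pos s x) % n ≡⟨ cong (_% n) (+-comm s _) ⟩
      (pos s x + s) % n ≡⟨ pos+ s x ⟩
      x % n             ≡⟨ pos+ t x ⟨
      (pos t x + t) % n ≡⟨ cong (_% n) (+-comm _ t) ⟩
      (t + pos t x) % n ≡⟨ cong (λ z → (t + z) % n) eq ⟨
      (t + pos s x) % n ∎)
      where open ≡-Reasoning

  rot : ℕ → Fin n → Fin n
  rot t x = fromℕ< (pos<n t (toℕ x))

  toℕ-rot : ∀ t x → toℕ (rot t x) ≡ pos t (toℕ x)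
  toℕ-rot t x = Fin.toℕ-fromℕ< (pos<n t (toℕ x))

  rot-injective : ∀ t {x y} → rot t x ≡ rot t y → x ≡ y
  rot-injective t {x} {y} eq = Fin.toℕ-injective (pos-injectiveʳ t (Fin.toℕ<n x) (Fin.toℕ<n y)
    (trans (sym (toℕ-rot t x)) (trans (cong toℕ eq) (toℕ-rot t y))))

  abstract

    A : ℕ → Subset n
    A t = tabulate (λ x → pos t (toℕ x) <ᵇ 4)

    lookup-A : ∀ t x → lookup (A t) x ≡ (pos t (toℕ x) <ᵇ 4)
    lookup-A t = Vec.lookup∘tabulate (λ x → pos t (toℕ x) <ᵇ 4)

    A≡ : ∀ t → A t ≡ tabulate (λ x → (toℕ x + t * p) % n <ᵇ 4)
    A≡ t = refl

    A-period : ∀ t → A (t + n) ≡ A t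
    A-period t = Vec.tabulate-cong (λ x → cong (_<ᵇ 4) (pos-period t (toℕ x)))

  A-rot : ∀ s t x → lookup (A t) (rot s x) ≡ lookup (A (s + t)) x
  A-rot s t x = begin
    lookup (A t) (rot s x)          ≡⟨ lookup-A t (rot s x) ⟩
    (pos t (toℕ (rot s x)) <ᵇ 4)    ≡⟨ cong (λ z → pos t z <ᵇ 4) (toℕ-rot s x) ⟩
    (pos t (pos s (toℕ x)) <ᵇ 4)    ≡⟨ cong (_<ᵇ 4) (pos-+ s t (toℕ x)) ⟩
    (pos (s + t) (toℕ x) <ᵇ 4)      ≡⟨ lookup-A (s + t) x ⟨
    lookup (A (s + t)) x            ∎
    where open ≡-Reasoning

  4≤n : 4 ≤ n
  4≤n = ≤-trans (m≤m+n 4 8) (≤-trans 12≤p (n≤1+n p))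

  ∣A∣ : ∀ t → ∣ A t ∣ ≡ 4
  ∣A∣ t = begin
    ∣ A t ∣                                            ≡⟨ ∑-allFin-lookup (A t) ⟨
    ∑ (allFin n) (λ x → χ (lookup (A t) x))            ≡⟨ ∑-cong (allFin n) (λ {x} _ → cong χ (trans (lookup-A t x) (cong (_<ᵇ 4) (sym (toℕ-rot t x))))) ⟩
    ∑ (allFin n) (λ x → χ (toℕ (rot t x) <ᵇ 4))        ≡⟨ ∑-endo (Unique.allFin⁺ n) (rot t) (λ _ _ → rot-injective t) (λ _ → ∈-allFin _) (λ x → χ (toℕ x <ᵇ 4)) ⟩
    ∑ (allFin n) (λ x → χ (toℕ x <ᵇ 4))                ≡⟨ ∑-cong (allFin n) (λ {x} _ → cong χ (Vec.lookup∘tabulate (λ x → toℕ x <ᵇ 4) x)) ⟨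
    ∑ (allFin n) (λ x → χ (lookup (tabulate (λ x → toℕ x <ᵇ 4)) x)) ≡⟨ ∑-allFin-lookup (tabulate (λ (x : Fin n) → toℕ x <ᵇ 4)) ⟩
    ∣ tabulate {n = n} (λ x → toℕ x <ᵇ 4) ∣            ≡⟨ first-four n 4≤n ⟩
    4                                                  ∎
    where
    open ≡-Reasoning
    none : ∀ m → ∣ tabulate {n = m} (λ _ → false) ∣ ≡ 0
    none zero    = refl
    none (suc m) = none m
    first-four : ∀ m → 4 ≤ m → ∣ tabulate {n = m} (λ x → toℕ x <ᵇ 4) ∣ ≡ 4
    first-four (suc (suc (suc (suc m)))) (s≤s (s≤s (s≤s (s≤s _)))) = cong (4 +_) (none m)

  private
    <ᵇ-true : ∀ {a b} → (a <ᵇ b) ≡ true → a < b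
    <ᵇ-true {a} {b} eq = <ᵇ⇒< a b (subst T (sym eq) _)

  A-disjoint : ∀ i d → 4 ≤ d → d + 4 ≤ n → A i ∩ A (i + d) ≡ ⊥
  A-disjoint i d 4≤d d+4≤n = ∩≡⊥⁺ _ _ λ x p q → impossible (toℕ x)
    (<ᵇ-true (trans (sym (lookup-A i x)) p)) (<ᵇ-true (trans (sym (lookup-A (i + d) x)) q))
    where
    impossible : ∀ x → pos i x < 4 → pos (i + d) x < 4 → Empty.⊥
    impossible x p q = <⇒≱ (<-≤-trans p 4≤d) (begin
      d                             ≤⟨ m≤n+m d _ ⟩
      pos (i + d) x + d             ≡⟨ m<n⇒m%n≡m lt ⟨
      (pos (i + d) x + d) % n       ≡⟨ cong (λ z → (z + d) % n) (pos-+ i d x) ⟨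
      (pos d (pos i x) + d) % n     ≡⟨ pos+ d (pos i x) ⟩
      pos i x % n                   ≡⟨ m<n⇒m%n≡m (pos<n i x) ⟩
      pos i x                       ∎)
      where
      open ≤-Reasoning
      lt : pos (i + d) x + d < n
      lt = <-≤-trans (+-monoˡ-< d q) (≤-trans (≤-reflexive (+-comm 4 d)) d+4≤n)

  ∑-arcs-through : ∀ x → ∑ (range n) (λ i → χ (lookup (A i) x)) ≡ 4
  ∑-arcs-through x = begin
    ∑ (range n) (λ i → χ (lookup (A i) x))       ≡⟨ ∑-cong (range n) (λ {i} _ → cong χ (lookup-A i x)) ⟩
    ∑ (range n) (λ i → χ (pos i (toℕ x) <ᵇ 4))   ≡⟨ ∑-endo (range-unique n) (λ i → pos i (toℕ x))
                                                     (λ p q → pos-injectiveˡ (toℕ x) (∈-range⁻ p) (∈-range⁻ q))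
                                                     (λ {i} _ → ∈-range⁺ (pos<n i (toℕ x))) (λ i → χ (i <ᵇ 4)) ⟩
    ∑ (range n) (λ i → χ (i <ᵇ 4))               ≡⟨ trans (cong (λ xs → ∑ xs (λ i → χ (i <ᵇ 4))) (range≡upTo n)) (first-four n 4≤n) ⟩
    4                                           ∎
    where
    open ≡-Reasoning
    first-four : ∀ m → 4 ≤ m → ∑ (upTo m) (λ i → χ (i <ᵇ 4)) ≡ 4
    first-four (suc (suc (suc (suc m)))) (s≤s (s≤s (s≤s (s≤s _)))) =
      cong (4 +_) (∑-zero (List.applyUpTo (4 +_) m) (λ i∈ → late (∈-applyUpTo⁻ (4 +_) i∈)))
      where
      late : ∀ {i} → ∃ (λ j → j < m × i ≡ 4 + j) → χ (i <ᵇ 4) ≡ 0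
      late (_ , _ , refl) = refl

  abstract

    ∣arc∣ : ∀ σ t → ∣ image σ (A t) ∣ ≡ 4
    ∣arc∣ σ t = trans (∣image∣ σ (A t)) (∣A∣ t)

  arc : Perm n → ℕ → Vertex n 4
  arc σ t = image σ (A t) , ∣arc∣ σ t

  arc-period : ∀ σ t → arc σ (t + n) ≡ arc σ t
  arc-period σ t = Vertex-≡ (cong (image σ) (A-period t))

  arc-adjacent : ∀ σ i d → 4 ≤ d → d + 4 ≤ n → Adj (arc σ i) (arc σ (i + d))
  arc-adjacent σ i d p q = image-disjoint σ (A-disjoint i d p q)

  rotᴾ : ℕ → Perm n → Perm n
  rotᴾ t = mapᴾ (rot t) (rot-injective t)

  arc-rotᴾ : ∀ s σ t → arc (rotᴾ s σ) t ≡ arc σ (s + t)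
  arc-rotᴾ s σ t = Vertex-≡ (image-mapᴾ (rot s) (rot-injective s) σ (A t) (A (s + t)) (A-rot s t))

  image-injective : ∀ (σ : Perm n) {P Q} → image σ P ≡ image σ Q → P ≡ Q
  image-injective σ {P} {Q} eq = begin
    P                   ≡⟨ Vec.tabulate∘lookup P ⟨
    tabulate (lookup P) ≡⟨ Vec.tabulate-cong (λ y → go y (surjective σ y)) ⟩
    tabulate (lookup Q) ≡⟨ Vec.tabulate∘lookup Q ⟩
    Q                   ∎
    where
    open ≡-Reasoning
    go : ∀ y → (∃ λ i → lookup (proj₁ σ) i ≡ y) → lookup P y ≡ lookup Q y
    go y (i , refl) = trans (sym (lookup-image σ P i)) (trans (cong (λ v → lookup v i) eq) (lookup-image σ Q i))

  pos-unique : ∀ t {x y} → y < n → (y + t) % n ≡ x % n → pos t x ≡ y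
  pos-unique t {x} y<n eq = shift-injective t (pos<n t x) y<n (trans (pos+ t x) (sym eq))

  -- If the arcs agree, each of i and j lies less than 4 steps after the other. The two step counts
  -- add up to 0 modulo n and to less than n, so both vanish.
  A-injective : ∀ {i j} → i < n → j < n → A i ≡ A j → i ≡ j
  A-injective {i} {j} i<n j<n eq = shift-injective 0 i<n j<n (begin
    (i + 0) % n                   ≡⟨ cong (_% n) (+-identityʳ i) ⟩
    i % n                         ≡⟨ pos+ j i ⟨
    (pos j i + j) % n             ≡⟨ cong (λ z → (z + j) % n) both-zero ⟩
    j % n                         ≡⟨ cong (_% n) (+-identityʳ j) ⟨
    (j + 0) % n                   ∎)
    where
    open ≡-Reasoning
    close : ∀ {i j} → i < n → A i ≡ A j → pos j i < 4
    close {i} {j} i<n eq = <ᵇ-true (begin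
      (pos j i <ᵇ 4)                          ≡⟨ cong (λ z → pos j z <ᵇ 4) (Fin.toℕ-fromℕ< i<n) ⟨
      (pos j (toℕ (fromℕ< i<n)) <ᵇ 4)         ≡⟨ lookup-A j (fromℕ< i<n) ⟨
      lookup (A j) (fromℕ< i<n)               ≡⟨ cong (λ v → lookup v (fromℕ< i<n)) eq ⟨
      lookup (A i) (fromℕ< i<n)               ≡⟨ lookup-A i (fromℕ< i<n) ⟩
      (pos i (toℕ (fromℕ< i<n)) <ᵇ 4)         ≡⟨ cong (_<ᵇ 4) (pos-unique i {y = 0} (s≤s z≤n) (cong (_% n) (sym (Fin.toℕ-fromℕ< i<n)))) ⟩
      true                                    ∎)
    sum-zero : pos j i + pos i j ≡ 0
    sum-zero = shift-injective j
      (<-≤-trans (+-mono-< (close i<n eq) (close j<n (sym eq))) (≤-trans (m≤m+n 8 4) (≤-trans 12≤p (n≤1+n p)))) (s≤s z≤n) (begin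
      (pos j i + pos i j + j) % n     ≡⟨ cong (λ z → (z + j) % n) (+-comm (pos j i) _) ⟩
      (pos i j + pos j i + j) % n     ≡⟨ cong (_% n) (trans (+-assoc (pos i j) _ j) (+-comm (pos i j) _)) ⟩
      (pos j i + j + pos i j) % n     ≡⟨ %-absorbˡ (pos j i + j) _ ⟨
      ((pos j i + j) % n + pos i j) % n ≡⟨ cong (λ z → (z + pos i j) % n) (pos+ j i) ⟩
      (i % n + pos i j) % n           ≡⟨ %-absorbˡ i _ ⟩
      (i + pos i j) % n               ≡⟨ cong (_% n) (+-comm i _) ⟩
      (pos i j + i) % n               ≡⟨ pos+ i j ⟩
      j % n                           ∎)
    both-zero : pos j i ≡ 0
    both-zero = m+n≡0⇒m≡0 (pos j i) sum-zero

  arc-injective : ∀ σ {i j} → i < n → j < n → arc σ i ≡ arc σ j → i ≡ j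
  arc-injective σ i<n j<n eq = A-injective i<n j<n (image-injective σ (cong proj₁ eq))

  A-below : ∀ t r x → t + (4 + r) ≡ n → toℕ x < t → lookup (A t) x ≡ false
  A-below t r x eq x<t = trans (lookup-A t x) (trans (cong (_<ᵇ 4) (pos-unique t {y = 4 + r + toℕ x} lt (begin
    (4 + r + toℕ x + t) % n   ≡⟨ cong (_% n) (trans (+-assoc (4 + r) (toℕ x) t) (cong (4 + r +_) (+-comm (toℕ x) t))) ⟩
    (4 + r + (t + toℕ x)) % n ≡⟨ cong (_% n) (trans (sym (+-assoc (4 + r) t (toℕ x))) (cong (_+ toℕ x) (trans (+-comm (4 + r) t) eq))) ⟩
    (n + toℕ x) % n           ≡⟨ cong (_% n) (+-comm n (toℕ x)) ⟩
    (toℕ x + n) % n           ≡⟨ [m+n]%n≡m%n (toℕ x) n ⟩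
    toℕ x % n                 ∎))) refl)
    where
    open ≡-Reasoning
    lt : 4 + r + toℕ x < n
    lt = subst (4 + r + toℕ x <_) (trans (+-comm (4 + r) t) eq) (+-monoʳ-< (4 + r) x<t)

  A-above : ∀ t y x → toℕ x ≡ y + t → lookup (A t) x ≡ (y <ᵇ 4)
  A-above t y x eq = trans (lookup-A t x) (cong (_<ᵇ 4) (pos-unique t y<n (cong (_% n) (sym eq))))
    where
    y<n : y < n
    y<n = ≤-<-trans (≤-trans (m≤m+n y t) (≤-reflexive (sym eq))) (Fin.toℕ<n x)

  A₄ : ∀ x → lookup (A 4) x ≡ (4 ≤ᵇ toℕ x) ∧ (toℕ x <ᵇ 8)
  A₄ x with toℕ x <? 4
  ... | yes x<4 = trans (A-below 4 (p ∸ 7) x (cong suc (m+[n∸m]≡n (≤-trans (m≤m+n 7 5) 12≤p))) x<4) (sym (small (toℕ x) x<4))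
    where
    small : ∀ m → m < 4 → (4 ≤ᵇ m) ∧ (m <ᵇ 8) ≡ false
    small 0 _ = refl
    small 1 _ = refl
    small 2 _ = refl
    small 3 _ = refl
    small (suc (suc (suc (suc m)))) (s≤s (s≤s (s≤s (s≤s ()))))
  ... | no x≮4 = trans (A-above 4 (toℕ x ∸ 4) x (sym (m∸n+n≡m (≮⇒≥ x≮4)))) (large (toℕ x) (≮⇒≥ x≮4))
    where
    large : ∀ m → 4 ≤ m → (m ∸ 4 <ᵇ 4) ≡ (4 ≤ᵇ m) ∧ (m <ᵇ 8)
    large (suc (suc (suc (suc m)))) (s≤s (s≤s (s≤s (s≤s _)))) = refl

  A₅ : ∀ x → lookup (A 5) x ≡ (5 ≤ᵇ toℕ x) ∧ (toℕ x <ᵇ 9)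
  A₅ x with toℕ x <? 5
  ... | yes x<5 = trans (A-below 5 (p ∸ 8) x (cong suc (m+[n∸m]≡n (≤-trans (m≤m+n 8 4) 12≤p))) x<5) (sym (small (toℕ x) x<5))
    where
    small : ∀ m → m < 5 → (5 ≤ᵇ m) ∧ (m <ᵇ 9) ≡ false
    small 0 _ = refl
    small 1 _ = refl
    small 2 _ = refl
    small 3 _ = refl
    small 4 _ = refl
    small (suc (suc (suc (suc (suc m))))) (s≤s (s≤s (s≤s (s≤s (s≤s ())))))
  ... | no x≮5 = trans (A-above 5 (toℕ x ∸ 5) x (sym (m∸n+n≡m (≮⇒≥ x≮5)))) (large (toℕ x) (≮⇒≥ x≮5))
    where
    large : ∀ m → 5 ≤ m → (m ∸ 5 <ᵇ 4) ≡ (5 ≤ᵇ m) ∧ (m <ᵇ 9)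
    large (suc (suc (suc (suc (suc m))))) (s≤s (s≤s (s≤s (s≤s (s≤s _))))) = refl

  A₀ : ∀ x → lookup (A 0) x ≡ (toℕ x <ᵇ 4)
  A₀ x = A-above 0 (toℕ x) x (sym (+-identityʳ _))

  4<n : 4 < n
  4<n = s≤s (≤-trans (m≤m+n 4 8) 12≤p)

  8<n : 8 < n
  8<n = s≤s (≤-trans (m≤m+n 8 4) 12≤p)

  -- Exchanging the places 4 and 8 carries {5, 6, 7, 8} to {4, 5, 6, 7} and fixes {0, 1, 2, 3}. This
  -- is why two given vertices are arcs at distance 4 as often as at distance 5.
  e₄ e₈ : Fin n
  e₄ = fromℕ< 4<n
  e₈ = fromℕ< 8<n

  τ : Fin n → Fin n
  τ = transpose e₄ e₈

  τ-injective : ∀ {x y} → τ x ≡ τ y → x ≡ y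
  τ-injective {x} {y} eq = trans (sym (transpose-inverse e₈ e₄)) (trans (cong (transpose e₈ e₄) eq) (transpose-inverse e₈ e₄))

  toℕ-τ : ∀ x → (toℕ x ≡ 4 × toℕ (τ x) ≡ 8) ⊎ (toℕ x ≡ 8 × toℕ (τ x) ≡ 4) ⊎ (toℕ x ≢ 4 × toℕ x ≢ 8 × toℕ (τ x) ≡ toℕ x)
  toℕ-τ x with x Fin.≟ e₄
  ... | yes refl = inj₁ (Fin.toℕ-fromℕ< 4<n , Fin.toℕ-fromℕ< 8<n)
  ... | no x≢e₄ with x Fin.≟ e₈
  ...   | yes refl = inj₂ (inj₁ (Fin.toℕ-fromℕ< 8<n , Fin.toℕ-fromℕ< 4<n))
  ...   | no x≢e₈ = inj₂ (inj₂ ( (λ eq → x≢e₄ (Fin.toℕ-injective (trans eq (sym (Fin.toℕ-fromℕ< 4<n)))))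
                               , (λ eq → x≢e₈ (Fin.toℕ-injective (trans eq (sym (Fin.toℕ-fromℕ< 8<n))))) , refl))

  A₀-τ : ∀ x → lookup (A 0) (τ x) ≡ lookup (A 0) x
  A₀-τ x = trans (A₀ (τ x)) (trans (go (toℕ-τ x)) (sym (A₀ x)))
    where
    go : _ → (toℕ (τ x) <ᵇ 4) ≡ (toℕ x <ᵇ 4)
    go (inj₁ (p , q))                  rewrite p | q = refl
    go (inj₂ (inj₁ (p , q)))           rewrite p | q = refl
    go (inj₂ (inj₂ (_ , _ , q)))       rewrite q = refl

  A₄-τ : ∀ x → lookup (A 4) (τ x) ≡ lookup (A 5) x
  A₄-τ x = trans (A₄ (τ x)) (trans (go (toℕ-τ x)) (sym (A₅ x)))
    where
    other : ∀ m → m ≢ 4 → m ≢ 8 → ((4 ≤ᵇ m) ∧ (m <ᵇ 8)) ≡ ((5 ≤ᵇ m) ∧ (m <ᵇ 9))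
    other 0 _ _ = refl
    other 1 _ _ = refl
    other 2 _ _ = refl
    other 3 _ _ = refl
    other 4 ≢4 _ = contradiction refl ≢4
    other 5 _ _ = refl
    other 6 _ _ = refl
    other 7 _ _ = refl
    other 8 _ ≢8 = contradiction refl ≢8
    other (suc (suc (suc (suc (suc (suc (suc (suc (suc m))))))))) _ _ = refl
    go : _ → ((4 ≤ᵇ toℕ (τ x)) ∧ (toℕ (τ x) <ᵇ 8)) ≡ ((5 ≤ᵇ toℕ x) ∧ (toℕ x <ᵇ 9))
    go (inj₁ (p , q))                  rewrite p | q = refl
    go (inj₂ (inj₁ (p , q)))           rewrite p | q = refl
    go (inj₂ (inj₂ (≢4 , ≢8 , q)))     rewrite q = other (toℕ x) ≢4 ≢8

  -- Double counting of arcs over all arrangements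

  ∑-rotate : (F : Perm n → ℕ) (t : ℕ) → ∑ perms (F ∘ rotᴾ t) ≡ ∑ perms F
  ∑-rotate F t = ∑-perms (rotᴾ t) (mapᴾ-injective (rot t) (rot-injective t)) F

  ∑-arc : (F : Vertex n 4 → ℕ) (t : ℕ) → ∑ perms (λ σ → F (arc σ t)) ≡ ∑ perms (λ σ → F (arc σ 0))
  ∑-arc F t = begin
    ∑ perms (λ σ → F (arc σ t))            ≡⟨ ∑-cong perms (λ {σ} _ → cong F (trans (arc-rotᴾ t σ 0) (cong (arc σ) (+-identityʳ t)))) ⟨
    ∑ perms (λ σ → F (arc (rotᴾ t σ) 0))   ≡⟨ ∑-rotate (λ σ → F (arc σ 0)) t ⟩
    ∑ perms (λ σ → F (arc σ 0))            ∎
    where open ≡-Reasoning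

  ∑-arcs-4≡5 : (G : Vertex n 4 → Vertex n 4 → ℕ) (t : ℕ) →
    ∑ perms (λ σ → G (arc σ t) (arc σ (t + 4))) ≡ ∑ perms (λ σ → G (arc σ t) (arc σ (t + 5)))
  ∑-arcs-4≡5 G t = begin
    ∑ perms (λ σ → G (arc σ t) (arc σ (t + 4))) ≡⟨ rotate 4 ⟩
    ∑ perms (λ σ → G (arc σ 0) (arc σ 4))       ≡⟨ ∑-perms (mapᴾ τ τ-injective) (mapᴾ-injective τ τ-injective) _ ⟨
    ∑ perms (λ σ → G (arc (mapᴾ τ τ-injective σ) 0) (arc (mapᴾ τ τ-injective σ) 4))
      ≡⟨ ∑-cong perms (λ {σ} _ → cong₂ G (Vertex-≡ (image-mapᴾ τ τ-injective σ (A 0) (A 0) A₀-τ)) (Vertex-≡ (image-mapᴾ τ τ-injective σ (A 4) (A 5) A₄-τ))) ⟩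
    ∑ perms (λ σ → G (arc σ 0) (arc σ 5))       ≡⟨ rotate 5 ⟨
    ∑ perms (λ σ → G (arc σ t) (arc σ (t + 5))) ∎
    where
    open ≡-Reasoning
    rotate : ∀ d → ∑ perms (λ σ → G (arc σ t) (arc σ (t + d))) ≡ ∑ perms (λ σ → G (arc σ 0) (arc σ d))
    rotate d = trans
      (sym (∑-cong perms (λ {σ} _ → cong₂ G (trans (arc-rotᴾ t σ 0) (cong (arc σ) (+-identityʳ t))) (arc-rotᴾ t σ d))))
      (∑-rotate (λ σ → G (arc σ 0) (arc σ d)) t)

  multiplicity : Subset n → ℕ
  multiplicity s = ∑ perms (λ σ → χ (does (Vec.≡-dec Bool._≟_ (proj₁ (arc σ 0)) s)))

  K : ℕ
  K = multiplicity (A 0)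

  -- Swapping two entries of an arrangement swaps the same two entries of its arc, so `multiplicity`
  -- is invariant under adjacent swaps and depends on the size alone.
  multiplicity≡K : (v : Vertex n 4) → multiplicity (proj₁ v) ≡ K
  multiplicity≡K (s , eq) = swap-invariant⇒size-determined n multiplicity invariant s (A 0) (trans eq (sym (∣A∣ 0)))
    where
    open ≡-Reasoning
    invariant : ∀ j s → multiplicity (swapAt j s) ≡ multiplicity s
    invariant j s = begin
      multiplicity (swapAt j s)
        ≡⟨ ∑-perms (swapᴾ j) (λ eq → Perm-≡ (swapAt-injective j (cong proj₁ eq))) _ ⟨
      ∑ perms (λ σ → χ (does (Vec.≡-dec Bool._≟_ (image (swapᴾ j σ) (A 0)) (swapAt j s))))
        ≡⟨ ∑-cong perms (λ {σ} _ → cong χ (does-⇔ (mk⇔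
             (λ e → swapAt-injective j (trans (sym (swapAt-map (lookup (A 0)) j (proj₁ σ))) e))
             (λ e → trans (swapAt-map (lookup (A 0)) j (proj₁ σ)) (cong (swapAt j) e)))
             (Vec.≡-dec Bool._≟_ (image (swapᴾ j σ) (A 0)) (swapAt j s)) (Vec.≡-dec Bool._≟_ (image σ (A 0)) s))) ⟩
      multiplicity s ∎

  ∑-arc≡K*∑ : (F : Vertex n 4 → ℕ) (t : ℕ) → ∑ perms (λ σ → F (arc σ t)) ≡ K * ∑ verts F
  ∑-arc≡K*∑ F t = begin
    ∑ perms (λ σ → F (arc σ t))  ≡⟨ ∑-arc F t ⟩
    ∑ perms (λ σ → F (arc σ 0))
      ≡⟨ ∑-cong perms (λ {σ} _ → ∑-δ _≟ⱽ_ verts-unique (verts-complete (arc σ 0)) F) ⟨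
    ∑ perms (λ σ → ∑ verts (λ v → χ (does (arc σ 0 ≟ⱽ v)) * F v))
      ≡⟨ ∑-swap perms verts (λ σ v → χ (does (arc σ 0 ≟ⱽ v)) * F v) ⟩
    ∑ verts (λ v → ∑ perms (λ σ → χ (does (arc σ 0 ≟ⱽ v)) * F v))
      ≡⟨ ∑-cong verts (λ {v} _ → trans (∑-cong perms (λ _ → *-comm _ (F v)))
           (trans (∑-*ˡ (F v) perms (λ σ → χ (does (arc σ 0 ≟ⱽ v)))) (trans (*-comm (F v) _) (cong (_* F v) (multiplicity≡K v))))) ⟩
    ∑ verts (λ v → K * F v) ≡⟨ ∑-*ˡ K verts F ⟩
    K * ∑ verts F ∎
    where open ≡-Reasoning

  K>0 : 0 < K
  K>0 = begin
    1                                      ≡⟨ cong χ (dec-true (Vec.≡-dec Bool._≟_ (proj₁ (arc idᴾ 0)) _) refl) ⟨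
    χ (does (Vec.≡-dec Bool._≟_ (proj₁ (arc idᴾ 0)) (proj₁ (arc idᴾ 0)))) ≤⟨ f≤∑ _ (perms-complete idᴾ) ⟩
    multiplicity (proj₁ (arc idᴾ 0))       ≡⟨ multiplicity≡K (arc idᴾ 0) ⟩
    K                                      ∎
    where open ≤-Reasoning

-- The inequality on one cycle

∑-applyUpTo : ∀ (f g : ℕ → ℕ) m → ∑ (applyUpTo g m) f ≡ ∑ (upTo m) (f ∘ g)
∑-applyUpTo f g m = cong sum (trans (List.map-applyUpTo g f m) (sym (List.map-applyUpTo id (f ∘ g) m)))


∑-upTo-suc : ∀ (f : ℕ → ℕ) m → ∑ (upTo (suc m)) f ≡ f 0 + ∑ (upTo m) (f ∘ suc)
∑-upTo-suc f m = cong (f 0 +_) (∑-applyUpTo f suc m)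

∑-upTo-last : ∀ (f : ℕ → ℕ) m → ∑ (upTo (suc m)) f ≡ ∑ (upTo m) f + f m
∑-upTo-last f zero    = +-identityʳ (f 0)
∑-upTo-last f (suc m) = begin
  ∑ (upTo (2 + m)) f                      ≡⟨ ∑-upTo-suc f (suc m) ⟩
  f 0 + ∑ (upTo (suc m)) (f ∘ suc)        ≡⟨ cong (f 0 +_) (∑-upTo-last (f ∘ suc) m) ⟩
  f 0 + (∑ (upTo m) (f ∘ suc) + f (suc m)) ≡⟨ +-assoc (f 0) _ _ ⟨
  f 0 + ∑ (upTo m) (f ∘ suc) + f (suc m)  ≡⟨ cong (_+ f (suc m)) (∑-upTo-suc f m) ⟨
  ∑ (upTo (suc m)) f + f (suc m)          ∎
  where open ≡-Reasoning

∑-shift : ∀ m (f : ℕ → ℕ) → (∀ i → f (i + m) ≡ f i) → ∀ z → ∑ (range m) (λ i → f (z + i)) ≡ ∑ (range m) f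
∑-shift m f per zero    = refl
∑-shift m f per (suc z) rewrite range≡upTo m = trans (subst (λ xs → ∑ xs (λ i → f (suc (z + i))) ≡ ∑ xs (f ∘ suc)) (range≡upTo m) (∑-shift m (f ∘ suc) (per ∘ suc) z))
  (+-cancelˡ-≡ (f 0) _ _ (begin
    f 0 + ∑ (upTo m) (f ∘ suc)  ≡⟨ ∑-upTo-suc f m ⟨
    ∑ (upTo (suc m)) f          ≡⟨ ∑-upTo-last f m ⟩
    ∑ (upTo m) f + f m          ≡⟨ cong (∑ (upTo m) f +_) (per 0) ⟩
    ∑ (upTo m) f + f 0          ≡⟨ +-comm _ (f 0) ⟩
    f 0 + ∑ (upTo m) f          ∎))
  where open ≡-Reasoning

T⇒≡ : ∀ {b} → T b → b ≡ true
T⇒≡ {true} _ = refl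

slack : ∀ {a b} c → a + c ≡ b → a ≤ b
slack {a} c eq = ≤-trans (m≤m+n a c) (≤-reflexive eq)

is : ∀ {c} → Fin c → Maybe (Fin c) → ℕ
is C nothing  = 0
is C (just D) = χ (does (D Fin.≟ C))

is-self : ∀ {c} (C : Fin c) → is C (just C) ≡ 1
is-self C rewrite dec-true (C Fin.≟ C) refl = refl

is≤1 : ∀ {c} (C : Fin c) x → is C x ≤ 1
is≤1 C nothing = z≤n
is≤1 C (just D) with does (D Fin.≟ C)
... | true  = ≤-refl
... | false = z≤n

module Cycle (k c L : ℕ) (s h : Fin c → ℕ)
  (hs≡L : ∀ C → h C * s C ≡ L) (n≤h : ∀ C → 13 + k ≤ h C) (s≥1 : ∀ C → 1 ≤ s C) where

  n : ℕ
  n = 13 + k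

  -- In units of L the weights of the header are doubled and scaled: weight = 2 L (4 + (n - 4)/s),
  -- with h = L/s. The extra nontrivial term is absorbed because h ≥ n, and yields strictness.
  nontrivial : Fin c → ℕ
  nontrivial C = χ (1 <ᵇ s C)

  weight : Maybe (Fin c) → ℕ
  weight nothing  = 0
  weight (just C) = 8 * L + 2 * (9 + k) * h C + nontrivial C

  -- The pairs of exception (i). The excess there is 8 L, and the factor 9 L by which special pairs
  -- are weighed below leaves room for the nontrivial terms.
  special : Maybe (Fin c) → Maybe (Fin c) → ℕ
  special nothing  _        = 0
  special (just C) nothing  = 0
  special (just C) (just D) = χ (does (C Fin.≟ D) ∧ ((1 <ᵇ s C) ∧ (s C <ᵇ 4)))

  count : Fin c → (ℕ → Maybe (Fin c)) → ℕ
  count C st = ∑ (range n) (is C ∘ st)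

  -- The special pairs at distance 5 and at distance 4 have equal sums over all arrangements, so the
  -- two correction terms cancel on average; on a single cycle they let a distance 4 pair borrow
  -- what a distance 5 pair has to spare.
  LHS RHS : (ℕ → Maybe (Fin c)) → ℕ
  LHS st = ∑ (range n) (λ i → weight (st i) + 9 * L * special (st i) (st (i + 5)))
  RHS st = 8 * n * L + 9 * L * ∑ (range n) (λ i → special (st i) (st (i + 4)))

  -- The facts about a cycle that survive when each arc is replaced by its component, with `nothing`
  -- for an arc in the cut. `sep` reflects that arcs at least 4 apart in both directions are
  -- disjoint, hence adjacent.
  record Config (st : ℕ → Maybe (Fin c)) : Set where
    field
      period : ∀ i → st (i + n) ≡ st i
      sep    : ∀ {C D} i d → 4 ≤ d → d + 4 ≤ n → st i ≡ just C → st (i + d) ≡ just D → C ≡ D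
      small  : ∀ C → count C st ≤ s C
      good   : ∀ C → count C st < n × (4 * count C st < 43 + 3 * k ⊎ (12 + k) * (9 + k) < 4 * s C)

  nontrivial≤1 : ∀ C → nontrivial C ≤ 1
  nontrivial≤1 C with 1 <ᵇ s C
  ... | true  = ≤-refl
  ... | false = z≤n

  n≤L : Fin c → n ≤ L
  n≤L C = ≤-trans (n≤h C) (≤-trans (≤-reflexive (sym (*-identityʳ (h C)))) (≤-trans (*-monoʳ-≤ (h C) (s≥1 C)) (≤-reflexive (hs≡L C))))

  -- However many arcs of C occur, their shares (n - 4)/s add up to at most n - 4, because m ≤ s.
  -- The final L pays for the m nontrivial terms, since m ≤ n ≤ L.
  block : ∀ C m b → m ≤ s C → m ≤ b → m ≤ n → m * weight (just C) ≤ 8 * b * L + 2 * (9 + k) * L + L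
  block C m b m≤s m≤b m≤n = begin
    m * (8 * L + 2 * (9 + k) * h C + nontrivial C)            ≡⟨ expand m L (h C) (nontrivial C) k ⟩
    8 * m * L + 2 * (9 + k) * (h C * m) + m * nontrivial C    ≤⟨ +-mono-≤ (+-mono-≤ (*-monoˡ-≤ L (*-monoʳ-≤ 8 m≤b)) (*-monoʳ-≤ (2 * (9 + k)) (≤-trans (*-monoʳ-≤ (h C) m≤s) (≤-reflexive (hs≡L C))))) last ⟩
    8 * b * L + 2 * (9 + k) * L + L                           ∎
    where
    open ≤-Reasoning
    expand : ∀ m L h t k → m * (8 * L + 2 * (9 + k) * h + t) ≡ 8 * m * L + 2 * (9 + k) * (h * m) + m * t
    expand = solve-∀
    last : m * nontrivial C ≤ L
    last = ≤-trans (*-monoʳ-≤ m (nontrivial≤1 C)) (≤-trans (≤-reflexive (*-identityʳ m)) (≤-trans m≤n (n≤L C)))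

  -- An isolated vertex attains the bound. For s ≥ 2 the share is at most halved, which leaves (8 +
  -- k) L to spare even after the nontrivial term.
  weight≤ : ∀ x → weight x ≤ 2 * n * L
  weight≤ nothing = z≤n
  weight≤ (just C) = go (s C) refl
    where
    open ≤-Reasoning
    go : ∀ m → m ≡ s C → weight (just C) ≤ 2 * n * L
    go 0 eq = contradiction (subst (1 ≤_) (sym eq) (s≥1 C)) λ ()
    go 1 eq = ≤-reflexive (begin-equality
      8 * L + 2 * (9 + k) * h C + χ (1 <ᵇ s C) ≡⟨ cong₂ (λ a b → 8 * L + 2 * (9 + k) * a + χ (1 <ᵇ b)) h≡L (sym eq) ⟩
      8 * L + 2 * (9 + k) * L + 0              ≡⟨ id₁ L k ⟩
      2 * n * L                                ∎)
      where
      h≡L : h C ≡ L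
      h≡L = trans (sym (*-identityʳ (h C))) (trans (cong (h C *_) eq) (hs≡L C))
      id₁ : ∀ L k → 8 * L + 2 * (9 + k) * L + 0 ≡ 2 * (13 + k) * L
      id₁ = solve-∀
    go (suc (suc m)) eq = begin
      8 * L + 2 * (9 + k) * h C + nontrivial C  ≤⟨ +-monoʳ-≤ (8 * L + 2 * (9 + k) * h C) (≤-trans (nontrivial≤1 C) (≤-trans (s≤s z≤n) (n≤L C))) ⟩
      8 * L + 2 * (9 + k) * h C + L             ≡⟨ id₂ L (h C) k ⟩
      9 * L + (9 + k) * (h C * 2)               ≤⟨ +-monoʳ-≤ (9 * L) (*-monoʳ-≤ (9 + k) (≤-trans (*-monoʳ-≤ (h C) (subst (2 ≤_) eq (s≤s (s≤s z≤n)))) (≤-reflexive (hs≡L C)))) ⟩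
      9 * L + (9 + k) * L                       ≤⟨ slack ((8 + k) * L) (id₃ L k) ⟩
      2 * n * L                                 ∎
      where
      id₂ : ∀ L h k → 8 * L + 2 * (9 + k) * h + L ≡ 9 * L + (9 + k) * (h * 2)
      id₂ = solve-∀
      id₃ : ∀ L k → 9 * L + (9 + k) * L + (8 + k) * L ≡ 2 * (13 + k) * L
      id₃ = solve-∀

  special-nothing : ∀ x → special x nothing ≡ 0
  special-nothing nothing  = refl
  special-nothing (just _) = refl

  special≤1 : ∀ x y → special x y ≤ 1
  special≤1 nothing  y        = z≤n
  special≤1 (just C) nothing  = z≤n
  special≤1 (just C) (just D) with does (C Fin.≟ D) ∧ ((1 <ᵇ s C) ∧ (s C <ᵇ 4))
  ... | true  = ≤-refl
  ... | false = z≤n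

  special-large : ∀ C y → 4 ≤ s C → special (just C) y ≡ 0
  special-large C nothing  4≤s = refl
  special-large C (just D) 4≤s with does (C Fin.≟ D) | 1 <ᵇ s C | s C <ᵇ 4 in eq
  ... | true  | true  | true  = contradiction (<ᵇ⇒< (s C) 4 (subst T (sym eq) _)) (≤⇒≯ 4≤s)
  ... | true  | true  | false = refl
  ... | true  | false | _     = refl
  ... | false | _     | _     = refl

  special-small : ∀ C → 2 ≤ s C → s C < 4 → special (just C) (just C) ≡ 1
  special-small C 2≤s s<4 rewrite dec-true (C Fin.≟ C) refl | T⇒≡ (<⇒<ᵇ 2≤s) | T⇒≡ (<⇒<ᵇ s<4) = refl

  Mono : Fin c → Maybe (Fin c) → Set
  Mono C x = ∀ {D} → x ≡ just D → C ≡ D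

  weight-mono : ∀ C x → Mono C x → weight x ≡ is C x * weight (just C)
  weight-mono C nothing  mono = refl
  weight-mono C (just D) mono with mono refl
  ... | refl rewrite is-self C = sym (*-identityˡ (weight (just C)))

  -- A component of size below 4 has at most three arcs here, far too few to matter. A larger one
  -- has no special pairs, and `good` limits its arcs or forces its share to be tiny.
  one-label : ∀ st → Config st → ∀ C → (∀ i → i < n → Mono C (st i)) → LHS st ≤ RHS st
  one-label st cfg C mono = ≤-trans (≤-trans (≤-reflexive split) (go (s C <? 4))) (m≤m+n (8 * n * L) _)
    where
    open Config cfg
    open ≤-Reasoning
    m = count C st
    Σsp = ∑ (range n) (λ i → special (st i) (st (i + 5)))
    split : LHS st ≡ m * weight (just C) + 9 * L * Σsp
    split = begin-equality
      LHS st
        ≡⟨ ∑-+ (range n) (weight ∘ st) (λ i → 9 * L * special (st i) (st (i + 5))) ⟩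
      ∑ (range n) (weight ∘ st) + ∑ (range n) (λ i → 9 * L * special (st i) (st (i + 5)))
        ≡⟨ cong₂ _+_ (trans (∑-cong (range n) (λ {i} i∈ → trans (weight-mono C (st i) (mono i (∈-range⁻ i∈))) (*-comm (is C (st i)) (weight (just C))))) (trans (∑-*ˡ (weight (just C)) (range n) (is C ∘ st)) (*-comm (weight (just C)) m)))
                     (∑-*ˡ (9 * L) (range n) _) ⟩
      m * weight (just C) + 9 * L * Σsp ∎
    sp≤is : ∀ x y → Mono C x → special x y ≤ is C x
    sp≤is nothing  y mono = z≤n
    sp≤is (just D) y mono with mono refl
    ... | refl = ≤-trans (special≤1 (just C) y) (≤-reflexive (sym (is-self C)))
    go : Dec (s C < 4) → m * weight (just C) + 9 * L * Σsp ≤ 8 * n * L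
    go (yes s<4) = begin
      m * weight (just C) + 9 * L * Σsp
        ≤⟨ +-mono-≤ (block C m 3 (small C) m≤3 (≤-trans m≤3 (m≤m+n 3 (10 + k))))
                    (*-monoʳ-≤ (9 * L) (≤-trans (∑-mono (range n) (λ {i} i∈ → sp≤is (st i) (st (i + 5)) (mono i (∈-range⁻ i∈)))) m≤3)) ⟩
      8 * 3 * L + 2 * (9 + k) * L + L + 9 * L * 3 ≤⟨ slack ((34 + 6 * k) * L) (id₁ L k) ⟩
      8 * n * L ∎
      where
      m≤3 : m ≤ 3
      m≤3 = ≤-trans (small C) (≤-pred s<4)
      id₁ : ∀ L k → 8 * 3 * L + 2 * (9 + k) * L + L + 9 * L * 3 + (34 + 6 * k) * L ≡ 8 * (13 + k) * L
      id₁ = solve-∀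
    go (no s≮4) = ≤-trans (≤-reflexive (trans (cong (m * weight (just C) +_) (trans (cong (9 * L *_) sp≡0) (*-zeroʳ (9 * L)))) (+-identityʳ _))) (fits (proj₂ (good C)))
      where
      sp≡0 : Σsp ≡ 0
      sp≡0 = ∑-zero (range n) (λ {i} i∈ → vanish (st i) (st (i + 5)) (mono i (∈-range⁻ i∈)))
        where
        vanish : ∀ x y → Mono C x → special x y ≡ 0
        vanish nothing  y mono = refl
        vanish (just D) y mono with mono refl
        ... | refl = special-large C y (≮⇒≥ s≮4)
      fits : 4 * m < 43 + 3 * k ⊎ (12 + k) * (9 + k) < 4 * s C → m * weight (just C) ≤ 8 * n * L
      -- 4m ≤ 3n + 3 gives 8m + 2 (n - 4) + 1 ≤ 8n - 1.
      fits (inj₁ lt) = begin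
        m * weight (just C)                          ≤⟨ block C m m (small C) ≤-refl (<⇒≤ (proj₁ (good C))) ⟩
        8 * m * L + 2 * (9 + k) * L + L              ≡⟨ id₁ L m k ⟩
        (2 * (4 * m)) * L + (19 + 2 * k) * L         ≤⟨ +-monoˡ-≤ _ (*-monoˡ-≤ L (*-monoʳ-≤ 2 (≤-pred lt))) ⟩
        (2 * (42 + 3 * k)) * L + (19 + 2 * k) * L    ≤⟨ slack L (id₂ L k) ⟩
        8 * n * L                                    ∎
        where
        id₁ : ∀ L m k → 8 * m * L + 2 * (9 + k) * L + L ≡ (2 * (4 * m)) * L + (19 + 2 * k) * L
        id₁ = solve-∀
        id₂ : ∀ L k → (2 * (42 + 3 * k)) * L + (19 + 2 * k) * L + L ≡ 8 * (13 + k) * L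
        id₂ = solve-∀
      -- With at most n - 1 arcs, a reserve of 8L = 8 h s remains for the shares 2 h (n - 1)(n - 4).
      -- As `lt` is strict, another 2h is left over, enough for the n - 1 nontrivial terms.
      fits (inj₂ lt) = begin
        m * (8 * L + 2 * (9 + k) * h C + nontrivial C)
          ≤⟨ *-monoʳ-≤ m (+-monoʳ-≤ (8 * L + 2 * (9 + k) * h C) (nontrivial≤1 C)) ⟩
        m * (8 * L + 2 * (9 + k) * h C + 1)
          ≡⟨ cong (λ z → m * (8 * z + 2 * (9 + k) * h C + 1)) (hs≡L C) ⟨
        m * (8 * (h C * s C) + 2 * (9 + k) * h C + 1)
          ≤⟨ *-monoˡ-≤ (8 * (h C * s C) + 2 * (9 + k) * h C + 1) (≤-pred (proj₁ (good C))) ⟩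
        (12 + k) * (8 * (h C * s C) + 2 * (9 + k) * h C + 1)
          ≡⟨ id₁ (h C) (s C) k ⟩
        8 * (12 + k) * (h C * s C) + 2 * h C * ((12 + k) * (9 + k)) + (12 + k)
          ≤⟨ +-monoʳ-≤ (8 * (12 + k) * (h C * s C) + 2 * h C * ((12 + k) * (9 + k))) (≤-trans (n≤1+n (12 + k)) (≤-trans (n≤h C) (m≤m+n (h C) (h C)))) ⟩
        8 * (12 + k) * (h C * s C) + 2 * h C * ((12 + k) * (9 + k)) + (h C + h C)
          ≡⟨ id₂ (h C) (s C) k ⟩
        8 * (12 + k) * (h C * s C) + 2 * h C * suc ((12 + k) * (9 + k))
          ≤⟨ +-monoʳ-≤ (8 * (12 + k) * (h C * s C)) (*-monoʳ-≤ (2 * h C) lt) ⟩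
        8 * (12 + k) * (h C * s C) + 2 * h C * (4 * s C)
          ≡⟨ id₃ (h C) (s C) k ⟩
        8 * n * (h C * s C) ≡⟨ cong (8 * n *_) (hs≡L C) ⟩
        8 * n * L ∎
        where
        id₁ : ∀ h s k → (12 + k) * (8 * (h * s) + 2 * (9 + k) * h + 1) ≡ 8 * (12 + k) * (h * s) + 2 * h * ((12 + k) * (9 + k)) + (12 + k)
        id₁ = solve-∀
        id₂ : ∀ h s k → 8 * (12 + k) * (h * s) + 2 * h * ((12 + k) * (9 + k)) + (h + h) ≡ 8 * (12 + k) * (h * s) + 2 * h * suc ((12 + k) * (9 + k))
        id₂ = solve-∀
        id₃ : ∀ h s k → 8 * (12 + k) * (h * s) + 2 * h * (4 * s) ≡ 8 * (13 + k) * (h * s)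
        id₃ = solve-∀

  vanish : ∀ C x y → 4 ≤ s C → Mono C x → special x y ≡ 0
  vanish C nothing  y 4≤s mono = refl
  vanish C (just D) y 4≤s mono with mono refl
  ... | refl = special-large C y 4≤s

  just-mono : ∀ {C x} → x ≡ just C → Mono C x
  just-mono refl eq = just-injective eq

  -- u is the cycle read from a vertex outside the cut; u₀ is the first and u₄, u₅ or u₆ the last
  -- of a block containing every vertex outside the cut.
  module Window (u : ℕ → Maybe (Fin c)) (cfg-sep : ∀ {C D} i d → 4 ≤ d → d + 4 ≤ n → u i ≡ just C → u (i + d) ≡ just D → C ≡ D)
    (C : Fin c) (u₀ : u 0 ≡ just C) (cfg-small : count C u ≤ s C)
    (dead : ∀ j → 7 ≤ j → j < n → u j ≡ nothing) where

    open ≤-Reasoning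

    far : ∀ i d {D} → {4≤d : T (4 ≤ᵇ d)} → {d≤9 : T (d ≤ᵇ 9)} → u i ≡ just C → u (i + d) ≡ just D → C ≡ D
    far i d {_} {p} {q} = cfg-sep i d (≤ᵇ⇒≤ 4 d p) (≤-trans (+-monoˡ-≤ 4 (≤ᵇ⇒≤ d 9 q)) (m≤m+n 13 k))

    far′ : ∀ i d {D} → {4≤d : T (4 ≤ᵇ d)} → {d≤9 : T (d ≤ᵇ 9)} → u (i + d) ≡ just C → u i ≡ just D → C ≡ D
    far′ i d {_} {p} {q} e f = sym (cfg-sep i d (≤ᵇ⇒≤ 4 d p) (≤-trans (+-monoˡ-≤ 4 (≤ᵇ⇒≤ d 9 q)) (m≤m+n 13 k)) f e)

    w : ℕ → ℕ
    w i = weight (u i)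

    a : ℕ → ℕ
    a i = is C (u i)

    LHS≡ : LHS u ≡ (w 0 + (w 1 + (w 2 + (w 3 + (w 4 + (w 5 + w 6)))))) + 9 * L * (special (u 0) (u 5) + special (u 1) (u 6))
    LHS≡ = begin-equality
      LHS u ≡⟨ cong (λ xs → ∑ xs g) (range≡upTo n) ⟩
      g 0 + (g 1 + (g 2 + (g 3 + (g 4 + (g 5 + (g 6 + ∑ (applyUpTo (7 +_) (6 + k)) g))))))
        ≡⟨ cong (λ z → g 0 + (g 1 + z)) (cong₂ _+_ (g≡w 2 refl) (cong₂ _+_ (g≡w 3 refl) (cong₂ _+_ (g≡w 4 refl) (cong₂ _+_ (g≡w 5 refl) (cong₂ _+_ (g≡w 6 refl) tail≡0))))) ⟩
      g 0 + (g 1 + (w 2 + (w 3 + (w 4 + (w 5 + (w 6 + 0))))))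
        ≡⟨ regroup (w 0) (w 1) (w 2) (w 3) (w 4) (w 5) (w 6) L (special (u 0) (u 5)) (special (u 1) (u 6)) ⟩
      _ ∎
      where
      g : ℕ → ℕ
      g i = w i + 9 * L * special (u i) (u (i + 5))
      killed : ∀ x y z → y ≡ nothing → x + 9 * L * special z y ≡ x
      killed x y z refl rewrite special-nothing z | *-zeroʳ (9 * L) = +-identityʳ x
      g≡w : ∀ i → {p : T (7 ≤ᵇ i + 5)} → (i + 5 <ᵇ 13) ≡ true → g i ≡ w i
      g≡w i {p} e = killed (w i) _ (u i) (dead (i + 5) (≤ᵇ⇒≤ 7 (i + 5) p) (≤-trans (<ᵇ⇒< (i + 5) 13 (subst T (sym e) _)) (m≤m+n 13 k)))
      tail≡0 : ∑ (applyUpTo (7 +_) (6 + k)) g ≡ 0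
      tail≡0 = ∑-zero (applyUpTo (7 +_) (6 + k)) (λ i∈ → lemma (∈-applyUpTo⁻ (7 +_) i∈))
        where
        lemma : ∀ {i} → ∃ (λ j → j < 6 + k × i ≡ 7 + j) → g i ≡ 0
        lemma (j , j< , refl) rewrite dead (7 + j) (m≤m+n 7 j) (+-monoʳ-< 7 j<) = *-zeroʳ (9 * L)
      regroup : ∀ a b c d e f g L x y → a + 9 * L * x + (b + 9 * L * y + (c + (d + (e + (f + (g + 0)))))) ≡
                (a + (b + (c + (d + (e + (f + g)))))) + 9 * L * (x + y)
      regroup = solve-∀

    count≥ : a 0 + (a 1 + (a 2 + (a 3 + (a 4 + (a 5 + a 6))))) ≤ s C
    count≥ = ≤-trans (+-monoʳ-≤ (a 0) (+-monoʳ-≤ (a 1) (+-monoʳ-≤ (a 2) (+-monoʳ-≤ (a 3) (+-monoʳ-≤ (a 4) (+-monoʳ-≤ (a 5) (m≤m+n (a 6) (∑ (applyUpTo (7 +_) (6 + k)) a)))))))) (subst (λ xs → ∑ xs a ≤ s C) (range≡upTo n) cfg-small)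

    W : ℕ
    W = weight (just C)

    -- Place 3 alone is within distance 3 of both ends, so it is the only place that may carry
    -- another component.
    six : Mono C (u 1) → Mono C (u 2) → Mono C (u 4) → Mono C (u 5) → Mono C (u 6) → LHS u ≤ RHS u
    six m₁ m₂ m₄ m₅ m₆ = ≤-trans (≤-reflexive LHS≡) (≤-trans (go (s C <? 4)) (m≤m+n (8 * n * L) _))
      where
      m = a 0 + (a 1 + (a 2 + (a 4 + (a 5 + a 6))))
      m≤s : m ≤ s C
      m≤s = ≤-trans (+-monoʳ-≤ (a 0) (+-monoʳ-≤ (a 1) (+-monoʳ-≤ (a 2) (m≤n+m _ (a 3))))) count≥
      B = special (u 0) (u 5) + special (u 1) (u 6)
      sum≡ : w 0 + (w 1 + (w 2 + (w 3 + (w 4 + (w 5 + w 6))))) ≡ m * W + w 3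
      sum≡ = trans (cong₂ _+_ (weight-mono C (u 0) (just-mono u₀)) (cong₂ _+_ (weight-mono C (u 1) m₁) (cong₂ _+_ (weight-mono C (u 2) m₂) (cong (w 3 +_)
               (cong₂ _+_ (weight-mono C (u 4) m₄) (cong₂ _+_ (weight-mono C (u 5) m₅) (weight-mono C (u 6) m₆)))))))
               (regroup (a 0) (a 1) (a 2) (w 3) (a 4) (a 5) (a 6) W)
        where
        regroup : ∀ a b c d e f g W → a * W + (b * W + (c * W + (d + (e * W + (f * W + g * W))))) ≡ (a + (b + (c + (e + (f + g))))) * W + d
        regroup = solve-∀
      m≤6 : m ≤ 6
      m≤6 = +-mono-≤ (is≤1 C (u 0)) (+-mono-≤ (is≤1 C (u 1)) (+-mono-≤ (is≤1 C (u 2)) (+-mono-≤ (is≤1 C (u 4)) (+-mono-≤ (is≤1 C (u 5)) (is≤1 C (u 6))))))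
      m≤n : m ≤ n
      m≤n = ≤-trans m≤6 (m≤m+n 6 (7 + k))
      go : Dec (s C < 4) → (w 0 + (w 1 + (w 2 + (w 3 + (w 4 + (w 5 + w 6)))))) + 9 * L * B ≤ 8 * n * L
      go (yes s<4) = begin
        _ ≡⟨ cong (_+ 9 * L * B) sum≡ ⟩
        m * W + w 3 + 9 * L * B ≤⟨ +-mono-≤ (+-mono-≤ (block C m 3 m≤s (≤-trans m≤s (≤-pred s<4)) m≤n) (weight≤ (u 3)))
                                     (*-monoʳ-≤ (9 * L) (+-mono-≤ (special≤1 (u 0) (u 5)) (special≤1 (u 1) (u 6)))) ⟩
        8 * 3 * L + 2 * (9 + k) * L + L + 2 * n * L + 9 * L * 2 ≤⟨ slack ((17 + 4 * k) * L) (id₁ L k) ⟩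
        8 * n * L ∎
        where
        id₁ : ∀ L k → 8 * 3 * L + 2 * (9 + k) * L + L + 2 * (13 + k) * L + 9 * L * 2 + (17 + 4 * k) * L ≡ 8 * (13 + k) * L
        id₁ = solve-∀
      go (no s≮4) = begin
        _ ≡⟨ cong₂ _+_ sum≡ (cong (9 * L *_) (cong₂ _+_ (vanish C (u 0) (u 5) (≮⇒≥ s≮4) (just-mono u₀)) (vanish C (u 1) (u 6) (≮⇒≥ s≮4) m₁))) ⟩
        m * W + w 3 + 9 * L * 0 ≤⟨ +-monoˡ-≤ (9 * L * 0) (+-mono-≤ (block C m 6 m≤s m≤6 m≤n) (weight≤ (u 3))) ⟩
        8 * 6 * L + 2 * (9 + k) * L + L + 2 * n * L + 9 * L * 0 ≤⟨ slack ((11 + 4 * k) * L) (id₁ L k) ⟩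
        8 * n * L ∎
        where
        id₁ : ∀ L k → 8 * 6 * L + 2 * (9 + k) * L + L + 2 * (13 + k) * L + 9 * L * 0 + (11 + 4 * k) * L ≡ 8 * (13 + k) * L
        id₁ = solve-∀

    -- Only places 2 and 3 are free. For s < 4 the special pair at places 0 and 5 is charged here,
    -- and the slack is exactly 2 k L: nothing is left at n = 13.
    five : Mono C (u 1) → Mono C (u 4) → Mono C (u 5) → u 6 ≡ nothing → LHS u ≤ RHS u
    five m₁ m₄ m₅ u₆ = ≤-trans (≤-reflexive LHS≡) (≤-trans (go (s C <? 4)) (m≤m+n (8 * n * L) _))
      where
      m = a 0 + (a 1 + (a 4 + a 5))
      m≤s : m ≤ s C
      m≤s = ≤-trans (+-monoʳ-≤ (a 0) (+-monoʳ-≤ (a 1) (≤-trans (+-monoʳ-≤ (a 4) (m≤m+n (a 5) (a 6))) (≤-trans (m≤n+m _ (a 3)) (m≤n+m _ (a 2)))))) count≥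
      B = special (u 0) (u 5) + special (u 1) (u 6)
      sp16 : special (u 1) (u 6) ≡ 0
      sp16 = trans (cong (special (u 1)) u₆) (special-nothing (u 1))
      sum≡ : w 0 + (w 1 + (w 2 + (w 3 + (w 4 + (w 5 + w 6))))) ≡ m * W + (w 2 + w 3)
      sum≡ = trans (cong₂ _+_ (weight-mono C (u 0) (just-mono u₀)) (cong₂ _+_ (weight-mono C (u 1) m₁) (cong (w 2 +_) (cong (w 3 +_)
               (cong₂ _+_ (weight-mono C (u 4) m₄) (cong₂ _+_ (weight-mono C (u 5) m₅) (cong weight u₆)))))))
               (regroup (a 0) (a 1) (w 2) (w 3) (a 4) (a 5) W)
        where
        regroup : ∀ a b c d e f W → a * W + (b * W + (c + (d + (e * W + (f * W + 0))))) ≡ (a + (b + (e + f))) * W + (c + d)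
        regroup = solve-∀
      m≤4 : m ≤ 4
      m≤4 = +-mono-≤ (is≤1 C (u 0)) (+-mono-≤ (is≤1 C (u 1)) (+-mono-≤ (is≤1 C (u 4)) (is≤1 C (u 5))))
      m≤n : m ≤ n
      m≤n = ≤-trans m≤4 (m≤m+n 4 (9 + k))
      mids : w 2 + w 3 ≤ 2 * n * L + 2 * n * L
      mids = +-mono-≤ (weight≤ (u 2)) (weight≤ (u 3))
      go : Dec (s C < 4) → (w 0 + (w 1 + (w 2 + (w 3 + (w 4 + (w 5 + w 6)))))) + 9 * L * B ≤ 8 * n * L
      go (yes s<4) = begin
        _ ≡⟨ cong (_+ 9 * L * B) sum≡ ⟩
        m * W + (w 2 + w 3) + 9 * L * B ≤⟨ +-mono-≤ (+-mono-≤ (block C m 3 m≤s (≤-trans m≤s (≤-pred s<4)) m≤n) mids)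
                                     (*-monoʳ-≤ (9 * L) (+-mono-≤ (special≤1 (u 0) (u 5)) (≤-reflexive sp16))) ⟩
        8 * 3 * L + 2 * (9 + k) * L + L + (2 * n * L + 2 * n * L) + 9 * L * 1 ≤⟨ slack (2 * k * L) (id₁ L k) ⟩
        8 * n * L ∎
        where
        id₁ : ∀ L k → 8 * 3 * L + 2 * (9 + k) * L + L + (2 * (13 + k) * L + 2 * (13 + k) * L) + 9 * L * 1 + 2 * k * L ≡ 8 * (13 + k) * L
        id₁ = solve-∀
      go (no s≮4) = begin
        _ ≡⟨ cong₂ _+_ sum≡ (cong (9 * L *_) (cong₂ _+_ (vanish C (u 0) (u 5) (≮⇒≥ s≮4) (just-mono u₀)) sp16)) ⟩
        m * W + (w 2 + w 3) + 9 * L * 0 ≤⟨ +-monoˡ-≤ (9 * L * 0) (+-mono-≤ (block C m 4 m≤s m≤4 m≤n) mids) ⟩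
        8 * 4 * L + 2 * (9 + k) * L + L + (2 * n * L + 2 * n * L) + 9 * L * 0 ≤⟨ slack ((1 + 2 * k) * L) (id₁ L k) ⟩
        8 * n * L ∎
        where
        id₁ : ∀ L k → 8 * 4 * L + 2 * (9 + k) * L + L + (2 * (13 + k) * L + 2 * (13 + k) * L) + 9 * L * 0 + (1 + 2 * k) * L ≡ 8 * (13 + k) * L
        id₁ = solve-∀

    short : u 5 ≡ nothing → u 6 ≡ nothing →
            LHS u ≡ w 0 + (w 1 + (w 2 + (w 3 + w 4)))
    short u₅ u₆ = begin-equality
      LHS u ≡⟨ LHS≡ ⟩
      (w 0 + (w 1 + (w 2 + (w 3 + (w 4 + (w 5 + w 6)))))) + 9 * L * (special (u 0) (u 5) + special (u 1) (u 6))
        ≡⟨ cong₂ _+_ (cong (λ z → w 0 + (w 1 + (w 2 + (w 3 + z)))) (trans (cong (w 4 +_) (cong₂ _+_ (cong weight u₅) (cong weight u₆))) (+-identityʳ (w 4))))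
                     (trans (cong (9 * L *_) (cong₂ _+_ (silent (u 0) u₅) (silent (u 1) u₆))) (*-zeroʳ (9 * L))) ⟩
      (w 0 + (w 1 + (w 2 + (w 3 + w 4)))) + 0 ≡⟨ +-identityʳ _ ⟩
      w 0 + (w 1 + (w 2 + (w 3 + w 4))) ∎
      where
      silent : ∀ x {y} → y ≡ nothing → special x y ≡ 0
      silent x refl = special-nothing x

    -- Exception (i): places 1, 2 and 3 are free. For s < 4 the estimate exceeds 8nL by exactly 9L,
    -- which the special pair at places 0 and 4 supplies. For s ≥ 4 the two ends together weigh at
    -- most (n + 13) L, just enough at n = 13.
    four : u 4 ≡ just C → u 5 ≡ nothing → u 6 ≡ nothing → LHS u ≤ RHS u
    four u₄ u₅ u₆ = ≤-trans (≤-reflexive (short u₅ u₆)) (go (s C <? 4))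
      where
      2≤s : 2 ≤ s C
      2≤s = ≤-trans (≤-reflexive (sym (cong₂ (λ x y → is C x + is C y) u₀ u₄ ▸ cong₂ _+_ (is-self C) (is-self C))))
        (≤-trans (+-monoʳ-≤ (a 0) (≤-trans (m≤m+n (a 4) (a 5 + a 6)) (≤-trans (m≤n+m _ (a 3)) (≤-trans (m≤n+m _ (a 2)) (m≤n+m _ (a 1)))))) count≥)
        where
        _▸_ = trans
      mids : w 1 + (w 2 + w 3) ≤ 2 * n * L + (2 * n * L + 2 * n * L)
      mids = +-mono-≤ (weight≤ (u 1)) (+-mono-≤ (weight≤ (u 2)) (weight≤ (u 3)))
      sum≡ : w 0 + (w 1 + (w 2 + (w 3 + w 4))) ≡ 2 * W + (w 1 + (w 2 + w 3))
      sum≡ = trans (cong₂ (λ x y → x + (w 1 + (w 2 + (w 3 + y)))) (cong weight u₀) (cong weight u₄)) (regroup W (w 1) (w 2) (w 3))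
        where
        regroup : ∀ W b c d → W + (b + (c + (d + W))) ≡ 2 * W + (b + (c + d))
        regroup = solve-∀
      go : Dec (s C < 4) → w 0 + (w 1 + (w 2 + (w 3 + w 4))) ≤ RHS u
      go (yes s<4) = begin
        _ ≡⟨ sum≡ ⟩
        2 * W + (w 1 + (w 2 + w 3)) ≤⟨ +-mono-≤ (block C 2 2 2≤s ≤-refl (s≤s (s≤s z≤n))) mids ⟩
        8 * 2 * L + 2 * (9 + k) * L + L + (2 * n * L + (2 * n * L + 2 * n * L)) ≡⟨ id₁ L k ⟩
        8 * n * L + 9 * L * 1 ≤⟨ +-monoʳ-≤ (8 * n * L) (*-monoʳ-≤ (9 * L) (≤-trans (≤-reflexive (sym (trans (cong₂ special u₀ u₄) (special-small C 2≤s s<4)))) (f≤∑ {x = 0} (λ i → special (u i) (u (i + 4))) (∈-range⁺ {n} (s≤s z≤n))))) ⟩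
        RHS u ∎
        where
        id₁ : ∀ L k → 8 * 2 * L + 2 * (9 + k) * L + L + (2 * (13 + k) * L + (2 * (13 + k) * L + 2 * (13 + k) * L)) ≡ 8 * (13 + k) * L + 9 * L * 1
        id₁ = solve-∀
      go (no s≮4) = ≤-trans (begin
        _ ≡⟨ sum≡ ⟩
        2 * W + (w 1 + (w 2 + w 3)) ≤⟨ +-mono-≤ outer mids ⟩
        (26 + k) * L + (2 * n * L + (2 * n * L + 2 * n * L)) ≤⟨ slack (k * L) (id₁ L k) ⟩
        8 * n * L ∎) (m≤m+n (8 * n * L) _)
        where
        id₁ : ∀ L k → (26 + k) * L + (2 * (13 + k) * L + (2 * (13 + k) * L + 2 * (13 + k) * L)) + k * L ≡ 8 * (13 + k) * L
        id₁ = solve-∀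
        id₂ : ∀ L h k t → 2 * (8 * L + 2 * (9 + k) * h + t) ≡ 16 * L + (9 + k) * (h * 4) + 2 * t
        id₂ = solve-∀
        id₃ : ∀ L k → 16 * L + (9 + k) * L + L ≡ (26 + k) * L
        id₃ = solve-∀
        outer : 2 * W ≤ (26 + k) * L
        outer = begin
          2 * W ≡⟨ id₂ L (h C) k (nontrivial C) ⟩
          16 * L + (9 + k) * (h C * 4) + 2 * nontrivial C
            ≤⟨ +-mono-≤ (+-monoʳ-≤ (16 * L) (*-monoʳ-≤ (9 + k) (≤-trans (*-monoʳ-≤ (h C) (≮⇒≥ s≮4)) (≤-reflexive (hs≡L C)))))
                        (≤-trans (*-monoʳ-≤ 2 (nontrivial≤1 C)) (≤-trans (s≤s (s≤s z≤n)) (n≤L C))) ⟩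
          16 * L + (9 + k) * L + L ≡⟨ id₃ L k ⟩
          (26 + k) * L ∎

    three : u 4 ≡ nothing → u 5 ≡ nothing → u 6 ≡ nothing → LHS u ≤ RHS u
    three u₄ u₅ u₆ = ≤-trans (≤-reflexive (short u₅ u₆)) (≤-trans (begin
      w 0 + (w 1 + (w 2 + (w 3 + w 4)))
        ≤⟨ +-mono-≤ (weight≤ (u 0)) (+-mono-≤ (weight≤ (u 1)) (+-mono-≤ (weight≤ (u 2)) (+-mono-≤ (weight≤ (u 3)) (≤-reflexive (cong weight u₄))))) ⟩
      2 * n * L + (2 * n * L + (2 * n * L + (2 * n * L + 0))) ≡⟨ id₁ L k ⟩
      8 * n * L ∎) (m≤m+n (8 * n * L) _))
      where
      id₁ : ∀ L k → 2 * (13 + k) * L + (2 * (13 + k) * L + (2 * (13 + k) * L + (2 * (13 + k) * L + 0))) ≡ 8 * (13 + k) * L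
      id₁ = solve-∀

    windowed : LHS u ≤ RHS u
    windowed = last (u 4) (u 5) (u 6) refl refl refl
      where
      last : ∀ x₄ x₅ x₆ → u 4 ≡ x₄ → u 5 ≡ x₅ → u 6 ≡ x₆ → LHS u ≤ RHS u
      last _        _        (just E) u₄ u₅ u₆ = six (far′ 1 5 e) (far′ 2 4 e) (far 0 4 u₀) (far 0 5 u₀) (just-mono e)
        where e = subst (λ E → u 6 ≡ just E) (sym (far 0 6 u₀ u₆)) u₆
      last _        (just E) nothing  u₄ u₅ u₆ = five (far′ 1 4 e) (far 0 4 u₀) (just-mono e) u₆
        where e = subst (λ E → u 5 ≡ just E) (sym (far 0 5 u₀ u₅)) u₅
      last (just E) nothing  nothing  u₄ u₅ u₆ = four (subst (λ E → u 4 ≡ just E) (sym (far 0 4 u₀ u₄)) u₄) u₅ u₆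
      last nothing  nothing  nothing  u₄ u₅ u₆ = three u₄ u₅ u₆

  -- Rotating a cycle with two components into a window

  two-labels-from : ∀ u → Config u → ∀ {C D} → u 0 ≡ just C → ∀ p → p < 10 → u p ≡ just D → C ≢ D →
                    (∀ j → 10 ≤ j → j < n → u j ≡ nothing) → LHS u ≤ RHS u
  two-labels-from u cfg {C} {D} u₀ p p<10 uₚ C≢D dead = Window.windowed u sep C u₀ (small C) dead′
    where
    open Config cfg
    -- Otherwise places 0 and p would carry the same component. Places 7, 8 and 9 are then at least
    -- 4 away from both, so an arc outside the cut there would identify C with D.
    p<4 : p < 4
    p<4 with p <? 4
    ... | yes lt = lt
    ... | no p≮4 = contradiction (sep 0 p (≮⇒≥ p≮4) (≤-trans (+-monoˡ-≤ 4 (≤-pred p<10)) (m≤m+n 13 k)) u₀ uₚ) C≢D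
    dead′ : ∀ j → 7 ≤ j → j < n → u j ≡ nothing
    dead′ j 7≤j j<n with 10 ≤? j
    ... | yes 10≤j = dead j 10≤j j<n
    ... | no 10≰j with u j in uⱼ
    ...   | nothing = refl
    ...   | just E = contradiction (trans C≡E (sym D≡E)) C≢D
      where
      j≤9 : j ≤ 9
      j≤9 = ≤-pred (≰⇒> 10≰j)
      C≡E : C ≡ E
      C≡E = sep 0 j (≤-trans (m≤m+n 4 3) 7≤j) (≤-trans (+-monoˡ-≤ 4 j≤9) (m≤m+n 13 k)) u₀ uⱼ
      p≤j : p ≤ j
      p≤j = ≤-trans (<⇒≤ p<4) (≤-trans (m≤m+n 4 3) 7≤j)
      D≡E : D ≡ E
      D≡E = sep p (j ∸ p) (+-cancelʳ-≤ p 4 (j ∸ p) (≤-trans (≤-trans (+-monoʳ-≤ 4 (≤-pred p<4)) 7≤j) (≤-reflexive (sym (m∸n+n≡m p≤j)))))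
                  (≤-trans (+-monoˡ-≤ 4 (≤-trans (m∸n≤m j p) j≤9)) (m≤m+n 13 k)) uₚ (trans (cong u (m+[n∸m]≡n p≤j)) uⱼ)

  shift : ∀ {st} → Config st → ∀ z → Config (λ i → st (z + i))
  shift {st} cfg z = record
    { period = λ i → trans (cong st (sym (+-assoc z i n))) (period (z + i))
    ; sep    = λ i d p q e f → sep (z + i) d p q e (trans (cong st (+-assoc z i d)) f)
    ; small  = λ C → subst (_≤ s C) (sym (count≡ C)) (small C)
    ; good   = λ C → subst (λ m → m < n × (4 * m < 43 + 3 * k ⊎ (12 + k) * (9 + k) < 4 * s C)) (sym (count≡ C)) (good C)
    }
    where
    open Config cfg
    count≡ : ∀ C → count C (λ i → st (z + i)) ≡ count C st
    count≡ C = ∑-shift n (is C ∘ st) (λ i → cong (is C) (period i)) z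

  unshift : ∀ {st} → Config st → ∀ z → LHS (λ i → st (z + i)) ≤ RHS (λ i → st (z + i)) → LHS st ≤ RHS st
  unshift {st} cfg z = subst₂ _≤_ lhs≡ rhs≡
    where
    open Config cfg
    period+ : ∀ i d → st (i + n + d) ≡ st (i + d)
    period+ i d = trans (cong st (trans (+-assoc i n d) (trans (cong (i +_) (+-comm n d)) (sym (+-assoc i d n))))) (period (i + d))
    lhs≡ : LHS (λ i → st (z + i)) ≡ LHS st
    lhs≡ = trans (∑-cong (range n) (λ {i} _ → cong (λ y → weight (st (z + i)) + 9 * L * special (st (z + i)) (st y)) (sym (+-assoc z i 5))))
                 (∑-shift n (λ i → weight (st i) + 9 * L * special (st i) (st (i + 5)))
                   (λ i → cong₂ (λ x y → weight x + 9 * L * special x y) (period i) (period+ i 5)) z)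
    rhs≡ : RHS (λ i → st (z + i)) ≡ RHS st
    rhs≡ = cong (λ y → 8 * n * L + 9 * L * y)
             (trans (∑-cong (range n) (λ {i} _ → cong (λ y → special (st (z + i)) (st y)) (sym (+-assoc z i 4))))
                    (∑-shift n (λ i → special (st i) (st (i + 4))) (λ i → cong₂ special (period i) (period+ i 4)) z))

  -- An arc outside the cut must be within distance 3 of place 6 or of place 6 + d, hence in the
  -- range 3 to 12. Starting from 6 keeps this range clear of the wrap-around. Rotation by the first
  -- such place f leaves at most ten candidates, beginning at 0.
  two-labels-at-6 : ∀ t → Config t → ∀ d → 1 ≤ d → d ≤ 3 → ∀ {C D} → t 6 ≡ just C → t (6 + d) ≡ just D → C ≢ D → LHS t ≤ RHS t
  two-labels-at-6 t cfg d 1≤d d≤3 {C} {D} t₆ t₆₊ C≢D = search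
    where
    open Config cfg
    fit : ∀ {e} → e ≤ 9 → e + 4 ≤ n
    fit e≤9 = ≤-trans (+-monoˡ-≤ 4 e≤9) (m≤m+n 13 k)
    early : ∀ j → j < 3 → t j ≡ nothing
    early j j<3 with t j in tⱼ
    ... | nothing = refl
    ... | just E = contradiction (trans (sym E≡C) E≡D) C≢D
      where
      j≤6 : j ≤ 6
      j≤6 = ≤-trans (≤-pred j<3) (m≤m+n 2 4)
      gap : 6 ∸ j + j ≡ 6
      gap = m∸n+n≡m j≤6
      4≤gap : 4 ≤ 6 ∸ j
      4≤gap = +-cancelʳ-≤ j 4 (6 ∸ j) (≤-trans (+-monoʳ-≤ 4 (≤-pred j<3)) (≤-reflexive (sym gap)))
      E≡C : E ≡ C
      E≡C = sep j (6 ∸ j) 4≤gap (fit (≤-trans (m∸n≤m 6 j) (m≤m+n 6 3))) tⱼ (trans (cong t (trans (+-comm j _) gap)) t₆)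
      E≡D : E ≡ D
      E≡D = sep j (6 ∸ j + d) (≤-trans 4≤gap (m≤m+n _ d)) (fit (+-mono-≤ (m∸n≤m 6 j) d≤3)) tⱼ
              (trans (cong t (trans (sym (+-assoc j (6 ∸ j) d)) (cong (_+ d) (trans (+-comm j _) gap)))) t₆₊)
    late : ∀ j → 13 ≤ j → j < n → t j ≡ nothing
    late j 13≤j j<n with t j in tⱼ
    ... | nothing = refl
    ... | just E = contradiction (trans C≡E (sym D≡E)) C≢D
      where
      e = j ∸ 13
      j≡ : 13 + e ≡ j
      j≡ = m+[n∸m]≡n 13≤j
      e<k : e < k
      e<k = +-cancelˡ-< 13 e k (subst (_< n) (sym j≡) j<n)
      C≡E : C ≡ E
      C≡E = sep 6 (7 + e) (m≤m+n 4 (3 + e)) (≤-trans (≤-reflexive (+-comm (7 + e) 4)) (+-mono-≤ (m≤m+n 11 2) (<⇒≤ e<k))) t₆ (trans (cong t j≡) tⱼ)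
      7≡ : d + (7 ∸ d + e) ≡ 7 + e
      7≡ = trans (sym (+-assoc d (7 ∸ d) e)) (cong (_+ e) (m+[n∸m]≡n (≤-trans d≤3 (m≤m+n 3 4))))
      D≡E : D ≡ E
      D≡E = sep (6 + d) (7 ∸ d + e) (≤-trans (∸-monoʳ-≤ 7 d≤3) (m≤m+n (7 ∸ d) e))
              (≤-trans (≤-reflexive (+-comm (7 ∸ d + e) 4)) (≤-trans (+-monoʳ-≤ 4 (+-mono-≤ (m∸n≤m 7 d) (<⇒≤ e<k))) (+-monoˡ-≤ k (m≤m+n 11 2))))
              t₆₊ (trans (cong t (trans (+-assoc 6 d _) (trans (cong (6 +_) 7≡) j≡))) tⱼ)
    from : ∀ f → f ≤ 6 → 3 ≤ f → ∀ {E} → t f ≡ just E → (∀ j → 3 ≤ j → j < f → t j ≡ nothing) → LHS t ≤ RHS t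
    from f f≤6 3≤f {E} tf before = unshift cfg f (go (C Fin.≟ E))
      where
      dead : ∀ j → 10 ≤ j → j < n → t (f + j) ≡ nothing
      dead j 10≤j j<n with f + j <? n
      ... | yes lt = late (f + j) (+-mono-≤ 3≤f 10≤j) lt
      ... | no ≮ = trans (cong t (sym (trans (+-comm r n) (m+[n∸m]≡n (≮⇒≥ ≮))))) (trans (period r) r-dead)
        where
        r = f + j ∸ n
        r<f : r < f
        r<f = +-cancelˡ-< n r f (≤-trans (≤-reflexive (cong suc (m+[n∸m]≡n (≮⇒≥ ≮)))) (≤-trans (+-monoʳ-< f j<n) (≤-reflexive (+-comm f n))))
        r-dead : t r ≡ nothing
        r-dead with r <? 3
        ... | yes r<3 = early r r<3
        ... | no r≮3 = before r (≮⇒≥ r≮3) r<f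
      -- The component E at the first place differs from C or from D; whichever it is serves as the
      -- second label.
      go : Dec (C ≡ E) → LHS (λ i → t (f + i)) ≤ RHS (λ i → t (f + i))
      go (yes refl) = two-labels-from _ (shift cfg f) (trans (cong t (+-identityʳ f)) tf) (6 ∸ f + d)
        (s≤s (+-mono-≤ (m∸n≤m 6 f) d≤3))
        (trans (cong t (trans (sym (+-assoc f (6 ∸ f) d)) (cong (_+ d) (m+[n∸m]≡n f≤6)))) t₆₊) C≢D dead
      go (no C≢E) = two-labels-from _ (shift cfg f) (trans (cong t (+-identityʳ f)) tf) (6 ∸ f)
        (s≤s (≤-trans (m∸n≤m 6 f) (m≤m+n 6 3)))
        (trans (cong t (m+[n∸m]≡n f≤6)) t₆) (C≢E ∘ sym) dead
    search : LHS t ≤ RHS t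
    search = first (t 3) (t 4) (t 5) refl refl refl
      where
      first : ∀ x₃ x₄ x₅ → t 3 ≡ x₃ → t 4 ≡ x₄ → t 5 ≡ x₅ → LHS t ≤ RHS t
      first (just _) _        _        t₃ t₄ t₅ = from 3 (m≤m+n 3 3) ≤-refl t₃ λ j 3≤j j<3 → contradiction j<3 (≤⇒≯ 3≤j)
      first nothing  (just _) _        t₃ t₄ t₅ = from 4 (m≤m+n 4 2) (m≤m+n 3 1) t₄ λ j 3≤j j<4 → trans (cong t (≤-antisym (≤-pred j<4) 3≤j)) t₃
      first nothing  nothing  (just _) t₃ t₄ t₅ = from 5 (m≤m+n 5 1) (m≤m+n 3 2) t₅ before
        where
        before : ∀ j → 3 ≤ j → j < 5 → t j ≡ nothing
        before 3 _ _ = t₃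
        before 4 _ _ = t₄
        before 0 () _
        before 1 (s≤s ()) _
        before 2 (s≤s (s≤s ())) _
        before (suc (suc (suc (suc (suc _))))) _ (s≤s (s≤s (s≤s (s≤s (s≤s ())))))
      first nothing  nothing  nothing  t₃ t₄ t₅ = from 6 ≤-refl (m≤m+n 3 3) t₆ before
        where
        before : ∀ j → 3 ≤ j → j < 6 → t j ≡ nothing
        before 3 _ _ = t₃
        before 4 _ _ = t₄
        before 5 _ _ = t₅
        before 0 () _
        before 1 (s≤s ()) _
        before 2 (s≤s (s≤s ())) _
        before (suc (suc (suc (suc (suc (suc _)))))) _ (s≤s (s≤s (s≤s (s≤s (s≤s (s≤s ()))))))

  two-labels : ∀ st → Config st → ∀ x d → 1 ≤ d → d ≤ 3 → ∀ {C D} → st x ≡ just C → st (x + d) ≡ just D → C ≢ D → LHS st ≤ RHS st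
  -- x + (7 + k) is x - 6 modulo n, so place x becomes place 6.
  two-labels st cfg x d 1≤d d≤3 e f C≢D = unshift cfg (x + (7 + k))
    (two-labels-at-6 _ (shift cfg (x + (7 + k))) d 1≤d d≤3
      (trans (cong st (trans (+-assoc x (7 + k) 6) (cong (x +_) (+-comm (7 + k) 6)))) (trans (period x) e))
      (trans (cong st eq₂) (trans (period (x + d)) f)) C≢D)
    where
    open Config cfg
    eq₂ : x + (7 + k) + (6 + d) ≡ x + d + (13 + k)
    eq₂ = lemma x k d
      where
      lemma : ∀ x k d → x + (7 + k) + (6 + d) ≡ x + d + (13 + k)
      lemma = solve-∀

  -- Different components cannot be 4 or more apart in both directions, so one of d and n - d is at
  -- most 3; in the second case the roles of C and D are exchanged.
  close : ∀ {st} → Config st → ∀ {C D} x d → 1 ≤ d → d < n → st x ≡ just C → st (x + d) ≡ just D → C ≢ D → LHS st ≤ RHS st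
  close {st} cfg x d 1≤d d<n e f C≢D = go (d ≤? 3) (d + 4 ≤? n)
    where
    go : Dec (d ≤ 3) → Dec (d + 4 ≤ n) → LHS st ≤ RHS st
    go (yes d≤3) _       = two-labels st cfg x d 1≤d d≤3 e f C≢D
    go (no d≰3)  (yes q) = contradiction (Config.sep cfg x d (≰⇒> d≰3) q e f) C≢D
    go (no _)    (no q)  = two-labels st cfg (x + d) (n ∸ d) (m<n⇒0<n∸m d<n)
      (+-cancelʳ-≤ d (n ∸ d) 3 (≤-trans (≤-reflexive (m∸n+n≡m (<⇒≤ d<n))) (≤-pred (≤-trans (≰⇒> q) (≤-reflexive (+-comm d 4))))))
      f (trans (cong st (trans (+-assoc x d (n ∸ d)) (cong (x +_) (m+[n∸m]≡n (<⇒≤ d<n))))) (trans (Config.period cfg x) e)) (C≢D ∘ sym)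

  alive? : (x : Maybe (Fin c)) → Dec (∃ λ C → x ≡ just C)
  alive? nothing  = no λ ()
  alive? (just C) = yes (C , refl)

  other? : ∀ C (x : Maybe (Fin c)) → Dec (∃ λ D → x ≡ just D × C ≢ D)
  other? C nothing  = no λ ()
  other? C (just D) with C Fin.≟ D
  ... | yes refl = no λ { (_ , refl , C≢C) → C≢C refl }
  ... | no C≢D = yes (D , refl , C≢D)

  pointwise : ∀ st → Config st → LHS st ≤ RHS st
  pointwise st cfg = go (anyUpTo? (λ i → alive? (st i)) n)
    where
    dead : ∀ x {y} → (∀ C → x ≡ just C → Empty.⊥) → weight x + 9 * L * special x y ≡ 0
    dead nothing  _ = *-zeroʳ (9 * L)
    dead (just C) f = ⊥-elim (f C refl)
    go′ : ∀ {i C} → i < n → st i ≡ just C → Dec (∃ λ j → j < n × ∃ λ D → st j ≡ just D × C ≢ D) → LHS st ≤ RHS st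
    go′ {i} {C} i<n e (no none) = one-label st cfg C λ j j<n {D} → mono j j<n
      where
      mono : ∀ j → j < n → ∀ {D} → st j ≡ just D → C ≡ D
      mono j j<n {D} e with C Fin.≟ D
      ... | yes p = p
      ... | no C≢D = contradiction (j , j<n , D , e , C≢D) none
    go′ {i} {C} i<n e (yes (j , j<n , D , f , C≢D)) = order (<-cmp i j)
      where
      order : _ → LHS st ≤ RHS st
      order (tri< i<j _ _) = close cfg i (j ∸ i) (m<n⇒0<n∸m i<j) (≤-<-trans (m∸n≤m j i) j<n) e (trans (cong st (m+[n∸m]≡n (<⇒≤ i<j))) f) C≢D
      order (tri≈ _ i≡j _) = contradiction (just-injective (trans (sym e) (trans (cong st i≡j) f))) C≢D
      order (tri> _ _ j<i) = close cfg j (i ∸ j) (m<n⇒0<n∸m j<i) (≤-<-trans (m∸n≤m i j) i<n) f (trans (cong st (m+[n∸m]≡n (<⇒≤ j<i))) e) (C≢D ∘ sym)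
    go : Dec (∃ λ i → i < n × ∃ λ C → st i ≡ just C) → LHS st ≤ RHS st
    go (no none) = ≤-trans (≤-reflexive (∑-zero (range n) (λ {i} i∈ → dead (st i) (λ C e → none (i , ∈-range⁻ i∈ , C , e))))) z≤n
    go (yes (i , i<n , C , e)) = go′ i<n e (anyUpTo? (λ j → other? C (st j)) n)

-- Averaging over all cycles

module Labelled (k : ℕ) (S : VSet (13 + k) 4) (c : ℕ) (f : Vertex (13 + k) 4 → Fin c) where

  open Arcs (12 + k) (m≤m+n 12 k) public

  label : Vertex n 4 → Maybe (Fin c)
  label v = if S v then nothing else just (f v)

  class-size : Fin c → ℕ
  class-size C = ∑ verts (is C ∘ label)

  count-on : Perm n → Fin c → ℕ
  count-on σ C = ∑ (range n) (λ i → is C (label (arc σ i)))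

  -- No cycle is dominated by one component, i.e. exception (ii) does not occur; 43 + 3 k = 3 n + 4.
  Good : Set
  Good = ∀ σ C → count-on σ C < n × (4 * count-on σ C < 43 + 3 * k ⊎ (12 + k) * (9 + k) < 4 * class-size C)

  N : ℕ
  N = #vertices {n} {4}

  alive : Maybe (Fin c) → ℕ
  alive nothing  = 0
  alive (just _) = 1

  #alive : ℕ
  #alive = ∑ verts (alive ∘ label)

  #alive+size : #alive + size S ≡ N
  #alive+size = begin
    #alive + size S                          ≡⟨ cong (#alive +_) (size≡∑verts S) ⟩
    #alive + ∑ verts (χ ∘ S)                 ≡⟨ ∑-+ verts (alive ∘ label) (χ ∘ S) ⟨
    ∑ verts (λ v → alive (label v) + χ (S v)) ≡⟨ ∑-cong verts (λ {v} _ → one v) ⟩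
    ∑ (verts {n} {4}) (λ _ → 1)              ≡⟨ ∑-const verts 1 ⟩
    N * 1                                    ≡⟨ *-identityʳ N ⟩
    N                                        ∎
    where
    open ≡-Reasoning
    one : ∀ v → alive (label v) + χ (S v) ≡ 1
    one v with S v
    ... | true  = refl
    ... | false = refl

  label-alive : ∀ {v} → S v ≡ false → label v ≡ just (f v)
  label-alive eq rewrite eq = refl

  label⁻ : ∀ {v C} → label v ≡ just C → S v ≡ false × f v ≡ C
  label⁻ {v} eq with S v
  label⁻ refl | false = refl , refl

  #perms : length (perms {n}) ≡ K * N
  #perms = begin
    length perms                 ≡⟨ *-identityʳ _ ⟨
    length perms * 1             ≡⟨ ∑-const perms 1 ⟨
    ∑ (perms {n}) (λ _ → 1)      ≡⟨ ∑-arc≡K*∑ (λ _ → 1) 0 ⟩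
    K * ∑ (verts {n} {4}) (λ _ → 1) ≡⟨ cong (K *_) (trans (∑-const verts 1) (*-identityʳ N)) ⟩
    K * N                        ∎
    where open ≡-Reasoning

  ∑-cycle : (F : Vertex n 4 → ℕ) → ∑ perms (λ σ → ∑ (range n) (λ i → F (arc σ i))) ≡ n * (K * ∑ verts F)
  ∑-cycle F = begin
    ∑ perms (λ σ → ∑ (range n) (λ i → F (arc σ i))) ≡⟨ ∑-swap perms (range n) (λ σ i → F (arc σ i)) ⟩
    ∑ (range n) (λ i → ∑ perms (λ σ → F (arc σ i))) ≡⟨ ∑-cong (range n) (λ {i} _ → ∑-arc≡K*∑ F i) ⟩
    ∑ (range n) (λ _ → K * ∑ verts F)               ≡⟨ ∑-const (range n) (K * ∑ verts F) ⟩
    length (range n) * (K * ∑ verts F)              ≡⟨ cong (_* (K * ∑ verts F)) (length-range n) ⟩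
    n * (K * ∑ verts F)                            ∎
    where open ≡-Reasoning

  module Averaging (sep : ∀ u v → S u ≡ false → S v ≡ false → Adj u v → f u ≡ f v)
                   (onto : ∀ C → ∃ λ v → S v ≡ false × f v ≡ C) where

    s≥1 : ∀ C → 1 ≤ class-size C
    s≥1 C with onto C
    ... | v , alive-v , refl = begin
      1                     ≡⟨ trans (cong (is C) (label-alive alive-v)) (is-self C) ⟨
      is C (label v)        ≤⟨ f≤∑ (is C ∘ label) (verts-complete v) ⟩
      class-size C          ∎
      where open ≤-Reasoning

    s≤N : ∀ C → class-size C ≤ N
    s≤N C = begin
      class-size C                     ≤⟨ ∑-mono verts (λ {v} _ → is≤1 C (label v)) ⟩
      ∑ (verts {n} {4}) (λ _ → 1)      ≡⟨ ∑-const verts 1 ⟩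
      N * 1                            ≡⟨ *-identityʳ N ⟩
      N                                ∎
      where open ≤-Reasoning

    s∣N! : ∀ C → class-size C ∣ N !
    s∣N! C = ∣-trans (m∣m! (class-size C) (s≥1 C)) (m≤n⇒m!∣n! (s≤N C))
      where
      m∣m! : ∀ m → 1 ≤ m → m ∣ m !
      m∣m! (suc m) _ = m∣m*n (m !)

    -- N! is divisible by every component size, so all shares become integers; the extra factor n is
    -- what makes `h C` at least n.
    L : ℕ
    L = n * N !

    h : Fin c → ℕ
    h C = n * _∣_.quotient (s∣N! C)

    hs≡L : ∀ C → h C * class-size C ≡ L
    hs≡L C = trans (*-assoc n (_∣_.quotient (s∣N! C)) (class-size C)) (cong (n *_) (sym (_∣_.equality (s∣N! C))))

    N!>0 : ∀ m → 0 < m !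
    N!>0 zero    = s≤s z≤n
    N!>0 (suc m) = ≤-trans (N!>0 m) (m≤m+n (m !) (m * m !))

    n≤h : ∀ C → n ≤ h C
    n≤h C = go (_∣_.quotient (s∣N! C)) (_∣_.equality (s∣N! C))
      where
      go : ∀ q → N ! ≡ q * class-size C → n ≤ n * q
      go zero    eq = contradiction (subst (0 <_) eq (N!>0 N)) λ ()
      go (suc q) eq = m≤m*n n (suc q)

    open Cycle k c L class-size h hs≡L n≤h s≥1 using
      (weight; special; nontrivial; Config; pointwise; LHS; RHS)

    st : Perm n → ℕ → Maybe (Fin c)
    st σ i = label (arc σ i)

    config : Good → ∀ σ → Config (st σ)
    config good σ = record
      { period = λ i → cong label (arc-period σ i)
      ; sep    = sep′
      ; small  = λ C → ∑-inject (range-unique n) (arc σ) (λ p q → arc-injective σ (∈-range⁻ p) (∈-range⁻ q))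
                          (λ {i} _ → verts-complete (arc σ i)) {g = is C ∘ label} (λ _ → ≤-refl)
      ; good   = good σ
      }
      where
      sep′ : ∀ {C D} i d → 4 ≤ d → d + 4 ≤ n → st σ i ≡ just C → st σ (i + d) ≡ just D → C ≡ D
      sep′ i d p q e₁ e₂ with label⁻ {arc σ i} e₁ | label⁻ {arc σ (i + d)} e₂
      ... | a₁ , refl | a₂ , refl = sep (arc σ i) (arc σ (i + d)) a₁ a₂ (arc-adjacent σ i d p q)

    Sp : ℕ → ℕ
    Sp d = ∑ perms (λ σ → ∑ (range n) (λ i → special (st σ i) (st σ (i + d))))

    Sp4≡Sp5 : Sp 4 ≡ Sp 5
    Sp4≡Sp5 = begin
      Sp 4 ≡⟨ ∑-swap perms (range n) (λ σ i → special (st σ i) (st σ (i + 4))) ⟩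
      ∑ (range n) (λ i → ∑ perms (λ σ → special (st σ i) (st σ (i + 4))))
        ≡⟨ ∑-cong (range n) (λ {i} _ → ∑-arcs-4≡5 (λ u v → special (label u) (label v)) i) ⟩
      ∑ (range n) (λ i → ∑ perms (λ σ → special (st σ i) (st σ (i + 5))))
        ≡⟨ ∑-swap perms (range n) (λ σ i → special (st σ i) (st σ (i + 5))) ⟨
      Sp 5 ∎
      where open ≡-Reasoning

    total : ℕ
    total = ∑ verts (weight ∘ label)

    total≤ : Good → total ≤ 8 * L * N
    -- Each vertex occurs n K times as an arc, and `Sp4≡Sp5` makes the correction the same on both
    -- sides, so both can be cancelled.
    total≤ good = *-cancelˡ-≤ (n * K) {{n*K≢0}} (+-cancelʳ-≤ (9 * L * Sp 5) _ _ (begin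
      n * K * total + 9 * L * Sp 5
        ≡⟨ cong₂ _+_ (trans (*-assoc n K total) (sym (∑-cycle (weight ∘ label)))) (sym (factor 5)) ⟩
      ∑ perms (λ σ → ∑ (range n) (λ i → weight (st σ i))) + ∑ perms (λ σ → ∑ (range n) (λ i → 9 * L * special (st σ i) (st σ (i + 5))))
        ≡⟨ ∑-+ perms _ _ ⟨
      ∑ perms (λ σ → ∑ (range n) (λ i → weight (st σ i)) + ∑ (range n) (λ i → 9 * L * special (st σ i) (st σ (i + 5))))
        ≡⟨ ∑-cong perms (λ {σ} _ → ∑-+ (range n) (λ i → weight (st σ i)) (λ i → 9 * L * special (st σ i) (st σ (i + 5)))) ⟨
      ∑ perms (λ σ → LHS (st σ))
        ≤⟨ ∑-mono perms (λ {σ} _ → pointwise (st σ) (config good σ)) ⟩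
      ∑ perms (λ σ → RHS (st σ))
        ≡⟨ ∑-+ perms (λ _ → 8 * n * L) (λ σ → 9 * L * ∑ (range n) (λ i → special (st σ i) (st σ (i + 4)))) ⟩
      ∑ (perms {n}) (λ _ → 8 * n * L) + ∑ perms (λ σ → 9 * L * ∑ (range n) (λ i → special (st σ i) (st σ (i + 4))))
        ≡⟨ cong₂ _+_ (trans (∑-const perms (8 * n * L)) (cong (_* (8 * n * L)) #perms)) (∑-*ˡ (9 * L) perms _) ⟩
      K * N * (8 * n * L) + 9 * L * Sp 4
        ≡⟨ cong₂ _+_ (regroup K N n L) (cong (9 * L *_) Sp4≡Sp5) ⟩
      n * K * (8 * L * N) + 9 * L * Sp 5 ∎))
      where
      open ≤-Reasoning
      n*K≢0 : NonZero (n * K)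
      n*K≢0 = >-nonZero (*-mono-≤ {1} {n} (s≤s z≤n) K>0)
      regroup : ∀ K N n L → K * N * (8 * n * L) ≡ n * K * (8 * L * N)
      regroup = solve-∀
      factor : ∀ d → ∑ perms (λ σ → ∑ (range n) (λ i → 9 * L * special (st σ i) (st σ (i + d)))) ≡ 9 * L * Sp d
      factor d = trans (∑-cong perms (λ {σ} _ → ∑-*ˡ (9 * L) (range n) (λ i → special (st σ i) (st σ (i + d)))))
                       (∑-*ˡ (9 * L) perms _)

    hm nt : Maybe (Fin c) → ℕ
    hm nothing  = 0
    hm (just C) = h C
    nt nothing  = 0
    nt (just C) = nontrivial C

    -- A component of size s contributes s times L/s, independently of s; this is how a sum over
    -- vertices detects the number of components.
    ∑-hm : ∑ verts (hm ∘ label) ≡ c * L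
    ∑-hm = begin
      ∑ verts (hm ∘ label)                                          ≡⟨ ∑-cong verts (λ {v} _ → split (label v)) ⟨
      ∑ verts (λ v → ∑ (allFin c) (λ C → is C (label v) * h C))     ≡⟨ ∑-swap verts (allFin c) (λ v C → is C (label v) * h C) ⟩
      ∑ (allFin c) (λ C → ∑ verts (λ v → is C (label v) * h C))     ≡⟨ ∑-cong (allFin c) (λ {C} _ → trans (∑-cong verts (λ _ → *-comm _ (h C))) (trans (∑-*ˡ (h C) verts (is C ∘ label)) (hs≡L C))) ⟩
      ∑ (allFin c) (λ _ → L)                                        ≡⟨ ∑-const (allFin c) L ⟩
      length (allFin c) * L                                         ≡⟨ cong (_* L) (List.length-tabulate {n = c} id) ⟩
      c * L                                                         ∎
      where
      open ≡-Reasoning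
      split : ∀ x → ∑ (allFin c) (λ C → is C x * h C) ≡ hm x
      split nothing  = ∑-zero (allFin c) (λ _ → refl)
      split (just D) = ∑-δ Fin._≟_ (Unique.allFin⁺ c) (∈-allFin D) h

    NT : ℕ
    NT = ∑ verts (nt ∘ label)

    total≡ : total ≡ 8 * L * #alive + 2 * (9 + k) * (c * L) + NT
    total≡ = begin
      total ≡⟨ ∑-cong verts (λ {v} _ → split (label v)) ⟩
      ∑ verts (λ v → 8 * L * alive (label v) + 2 * (9 + k) * hm (label v) + nt (label v))
        ≡⟨ ∑-+ verts (λ v → 8 * L * alive (label v) + 2 * (9 + k) * hm (label v)) (nt ∘ label) ⟩
      ∑ verts (λ v → 8 * L * alive (label v) + 2 * (9 + k) * hm (label v)) + NT
        ≡⟨ cong (_+ NT) (∑-+ verts (λ v → 8 * L * alive (label v)) (λ v → 2 * (9 + k) * hm (label v))) ⟩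
      ∑ verts (λ v → 8 * L * alive (label v)) + ∑ verts (λ v → 2 * (9 + k) * hm (label v)) + NT
        ≡⟨ cong₂ (λ a b → a + b + NT) (∑-*ˡ (8 * L) verts (alive ∘ label)) (trans (∑-*ˡ (2 * (9 + k)) verts (hm ∘ label)) (cong (2 * (9 + k) *_) ∑-hm)) ⟩
      8 * L * #alive + 2 * (9 + k) * (c * L) + NT ∎
      where
      open ≡-Reasoning
      split : ∀ x → weight x ≡ 8 * L * alive x + 2 * (9 + k) * hm x + nt x
      split nothing  = lemma (8 * L) (2 * (9 + k))
        where
        lemma : ∀ a b → 0 ≡ a * 0 + b * 0 + 0
        lemma = solve-∀
      split (just C) = cong (λ z → z + 2 * (9 + k) * h C + nontrivial C) (sym (*-identityʳ (8 * L)))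

    bound : Good → 2 * L * ((9 + k) * c) + NT ≤ 2 * L * (4 * size S)
    bound good = +-cancelˡ-≤ (8 * L * #alive) _ _ (begin
      8 * L * #alive + (2 * L * ((9 + k) * c) + NT)   ≡⟨ regroup (8 * L * #alive) L k c NT ⟩
      8 * L * #alive + 2 * (9 + k) * (c * L) + NT     ≡⟨ total≡ ⟨
      total                                           ≤⟨ total≤ good ⟩
      8 * L * N                                       ≡⟨ cong (8 * L *_) #alive+size ⟨
      8 * L * (#alive + size S)                       ≡⟨ regroup′ L #alive (size S) ⟩
      8 * L * #alive + 2 * L * (4 * size S)           ∎)
      where
      open ≤-Reasoning
      regroup : ∀ a L k c t → a + (2 * L * ((9 + k) * c) + t) ≡ a + 2 * (9 + k) * (c * L) + t
      regroup = solve-∀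
      regroup′ : ∀ L a b → 8 * L * (a + b) ≡ 8 * L * a + 2 * L * (4 * b)
      regroup′ = solve-∀

    L>0 : 0 < L
    L>0 = *-mono-≤ {1} {n} (s≤s z≤n) (N!>0 N)

    good⇒bound : Good → (9 + k) * c ≤ 4 * size S
    good⇒bound good = *-cancelˡ-≤ (2 * L) {{>-nonZero (*-mono-≤ {1} {2} (s≤s z≤n) L>0)}} (≤-trans (m≤m+n _ NT) (bound good))

    -- `NT` counts the vertices lying in components of at least two vertices, and equality in
    -- `bound` leaves no room for it.
    good⇒rigid : Good → 4 * size S ≡ (9 + k) * c → ∀ v C → label v ≡ just C → class-size C ≡ 1
    good⇒rigid good eq v C e = ≤-antisym (≮⇒≥ trivial) (s≥1 C)
      where
      NT≡0 : NT ≤ 0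
      NT≡0 = +-cancelˡ-≤ (2 * L * ((9 + k) * c)) NT 0 (≤-trans (bound good) (≤-reflexive (trans (cong (2 * L *_) eq) (sym (+-identityʳ _)))))
      trivial : ¬ 1 < class-size C
      trivial 1<s = contradiction (≤-trans (≤-reflexive one) (≤-trans (f≤∑ (nt ∘ label) (verts-complete v)) NT≡0)) λ ()
        where
        one : 1 ≡ nt (label v)
        one = sym (trans (cong nt e) (cong χ (T⇒≡ (<⇒<ᵇ 1<s))))

-- Cycles dominated by one component

filterᵇ-∈⁺ : ∀ (p : X → Bool) {xs x} → x ∈ xs → p x ≡ true → x ∈ filterᵇ p xs
filterᵇ-∈⁺ p {y ∷ xs} (here refl) eq rewrite eq = here refl
filterᵇ-∈⁺ p {y ∷ xs} (there x∈)  eq with p y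
... | true  = there (filterᵇ-∈⁺ p x∈ eq)
... | false = filterᵇ-∈⁺ p x∈ eq

filterᵇ-∈⁻ : ∀ (p : X → Bool) xs {x} → x ∈ filterᵇ p xs → x ∈ xs × p x ≡ true
filterᵇ-∈⁻ p (y ∷ xs) x∈ with p y in eq
filterᵇ-∈⁻ p (y ∷ xs) (here refl) | true = here refl , eq
filterᵇ-∈⁻ p (y ∷ xs) (there x∈)  | true = let a , b = filterᵇ-∈⁻ p xs x∈ in there a , b
filterᵇ-∈⁻ p (y ∷ xs) x∈          | false = let a , b = filterᵇ-∈⁻ p xs x∈ in there a , b

filterᵇ-unique : ∀ (p : X → Bool) {xs} → Unique xs → Unique (filterᵇ p xs)
filterᵇ-unique p {[]} u = u
filterᵇ-unique p {x ∷ xs} (x∉ ∷ u) with p x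
... | true  = All.tabulate (λ y∈ → All.lookup x∉ (proj₁ (filterᵇ-∈⁻ p xs y∈))) ∷ filterᵇ-unique p u
... | false = filterᵇ-unique p u

∑-filterᵇ : ∀ (p : X → Bool) xs → ∑ xs (χ ∘ p) ≡ length (filterᵇ p xs)
∑-filterᵇ p [] = refl
∑-filterᵇ p (x ∷ xs) with p x
... | true  = cong suc (∑-filterᵇ p xs)
... | false = ∑-filterᵇ p xs

length≡∑ : (xs : List X) → length xs ≡ ∑ xs (λ _ → 1)
length≡∑ xs = sym (trans (∑-const xs 1) (*-identityʳ _))

length-inject : {xs : List X} {ys : List Y} → Unique xs → (φ : X → Y) →
  (∀ {x y} → x ∈ xs → y ∈ xs → φ x ≡ φ y → x ≡ y) → (∀ {x} → x ∈ xs → φ x ∈ ys) → length xs ≤ length ys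
length-inject {xs = xs} {ys} u φ inj sub = begin
  length xs         ≡⟨ length≡∑ xs ⟩
  ∑ xs (λ _ → 1)    ≤⟨ ∑-inject u φ inj sub {g = λ _ → 1} (λ _ → ≤-refl) ⟩
  ∑ ys (λ _ → 1)    ≡⟨ length≡∑ ys ⟨
  length ys         ∎
  where open ≤-Reasoning

all-∈ : ∀ (p : X → Bool) xs → all p xs ≡ true → ∀ {x} → x ∈ xs → p x ≡ true
all-∈ p (y ∷ xs) eq x∈ with p y in py
all-∈ p (y ∷ xs) eq (here refl) | true = py
all-∈ p (y ∷ xs) eq (there x∈)  | true = all-∈ p xs eq x∈

all-∈⁺ : ∀ (p : X → Bool) xs → (∀ {x} → x ∈ xs → p x ≡ true) → all p xs ≡ true
all-∈⁺ p []       h = refl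
all-∈⁺ p (x ∷ xs) h rewrite h (here refl) = all-∈⁺ p xs (h ∘ there)

-- Opaque outside the checks below, which evaluate it.
abstract

  subsets : (n k : ℕ) → List (Subset n)
  subsets zero    zero    = [] ∷ []
  subsets zero    (suc k) = []
  subsets (suc n) zero    = map (false ∷_) (subsets n zero)
  subsets (suc n) (suc k) = map (true ∷_) (subsets n k) ++ map (false ∷_) (subsets n (suc k))

  subsets-size : ∀ n k {s} → s ∈ subsets n k → ∣ s ∣ ≡ k
  subsets-size zero    zero    (here refl) = refl
  subsets-size (suc n) zero    s∈ with ∈-map⁻ (false ∷_) s∈
  ... | s , s∈′ , refl = subsets-size n zero s∈′
  subsets-size (suc n) (suc k) s∈ with ∈-++⁻ (map (true ∷_) (subsets n k)) s∈
  ... | inj₁ p with ∈-map⁻ (true ∷_) p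
  ...   | s , s∈′ , refl = cong suc (subsets-size n k s∈′)
  subsets-size (suc n) (suc k) s∈ | inj₂ p with ∈-map⁻ (false ∷_) p
  ...   | s , s∈′ , refl = subsets-size n (suc k) s∈′

  subsets-complete : ∀ n k s → ∣ s ∣ ≡ k → s ∈ subsets n k
  subsets-complete zero    zero    []          eq = here refl
  subsets-complete (suc n) zero    (false ∷ s) eq = ∈-map⁺ (false ∷_) (subsets-complete n zero s eq)
  subsets-complete (suc n) (suc k) (true ∷ s)  eq = ∈-++⁺ˡ (∈-map⁺ (true ∷_) (subsets-complete n k s (suc-injective eq)))
  subsets-complete (suc n) (suc k) (false ∷ s) eq = ∈-++⁺ʳ (map (true ∷_) (subsets n k)) (∈-map⁺ (false ∷_) (subsets-complete n (suc k) s eq))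

  subsets-unique : ∀ n k → Unique (subsets n k)
  subsets-unique zero    zero    = [] ∷ []
  subsets-unique zero    (suc k) = []
  subsets-unique (suc n) zero    = Unique.map⁺ (λ { refl → refl }) (subsets-unique n zero)
  subsets-unique (suc n) (suc k) = Unique.++⁺ (Unique.map⁺ (λ { refl → refl }) (subsets-unique n k))
                                              (Unique.map⁺ (λ { refl → refl }) (subsets-unique n (suc k))) disj
    where
    disj : ∀ {s} → ¬ (s ∈ map (true ∷_) (subsets n k) × s ∈ map (false ∷_) (subsets n (suc k)))
    disj (p , q) with ∈-map⁻ (true ∷_) p | ∈-map⁻ (false ∷_) q
    ... | _ , _ , refl | _ , _ , ()

disjoint : ∀ {n} → Subset n → Subset n → Bool
disjoint []          []          = true
disjoint (true ∷ u)  (true ∷ v)  = false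
disjoint (true ∷ u)  (false ∷ v) = disjoint u v
disjoint (false ∷ u) (_ ∷ v)     = disjoint u v

disjoint⇒∩≡⊥ : ∀ {n} (u v : Subset n) → disjoint u v ≡ true → u ∩ v ≡ ⊥
disjoint⇒∩≡⊥ []          []          eq = refl
disjoint⇒∩≡⊥ (true ∷ u)  (false ∷ v) eq = cong (false ∷_) (disjoint⇒∩≡⊥ u v eq)
disjoint⇒∩≡⊥ (false ∷ u) (_ ∷ v)     eq = cong (false ∷_) (disjoint⇒∩≡⊥ u v eq)

-- Greedy partition of a list of sets into classes of pairwise disjoint sets: an intersecting
-- family has at most one member in each class.
insertClass : ∀ {n} → Subset n → List (List (Subset n)) → List (List (Subset n))
insertClass v []       = (v ∷ []) ∷ []
insertClass v (c ∷ cs) = if all (disjoint v) c then (v ∷ c) ∷ cs else c ∷ insertClass v cs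

Disjoint : ∀ {n} → Subset n → Subset n → Set
Disjoint u v = u ∩ v ≡ ⊥

insertClass-disjoint : ∀ {n} (v : Subset n) cs → All (AllPairs Disjoint) cs → All (AllPairs Disjoint) (insertClass v cs)
insertClass-disjoint v []       [] = ([] ∷ []) ∷ []
insertClass-disjoint v (c ∷ cs) (d ∷ ds) with all (disjoint v) c in eq
... | true  = (All.tabulate (λ u∈ → disjoint⇒∩≡⊥ v _ (all-∈ (disjoint v) c eq u∈)) ∷ d) ∷ ds
... | false = d ∷ insertClass-disjoint v cs ds

∈-insertClass-new : ∀ {n} (v : Subset n) cs → Any (v ∈_) (insertClass v cs)
∈-insertClass-new v []       = here (here refl)
∈-insertClass-new v (c ∷ cs) with all (disjoint v) c
... | true  = here (here refl)
... | false = there (∈-insertClass-new v cs)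

∈-insertClass-old : ∀ {n} {u : Subset n} (v : Subset n) cs → Any (u ∈_) cs → Any (u ∈_) (insertClass v cs)
∈-insertClass-old v (c ∷ cs) u∈ with all (disjoint v) c
∈-insertClass-old v (c ∷ cs) (here u∈)  | true  = here (there u∈)
∈-insertClass-old v (c ∷ cs) (there u∈) | true  = there u∈
∈-insertClass-old v (c ∷ cs) (here u∈)  | false = here u∈
∈-insertClass-old v (c ∷ cs) (there u∈) | false = there (∈-insertClass-old v cs u∈)

abstract

  classes : ∀ {n} → List (Subset n) → List (List (Subset n))
  classes []       = []
  classes (v ∷ vs) = insertClass v (classes vs)

  classes-disjoint : ∀ {n} (vs : List (Subset n)) → All (AllPairs Disjoint) (classes vs)
  classes-disjoint []       = []
  classes-disjoint (v ∷ vs) = insertClass-disjoint v (classes vs) (classes-disjoint vs)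

  ∈-classes : ∀ {n} {u : Subset n} vs → u ∈ vs → Any (u ∈_) (classes vs)
  ∈-classes (v ∷ vs) (here refl) = ∈-insertClass-new v (classes vs)
  ∈-classes (v ∷ vs) (there u∈)  = ∈-insertClass-old v (classes vs) (∈-classes vs u∈)

AllPairs-∈ : ∀ {n} {c : List (Subset n)} {u v} → AllPairs Disjoint c → u ∈ c → v ∈ c → u ≡ v ⊎ Disjoint u v ⊎ Disjoint v u
AllPairs-∈ (d ∷ ds) (here refl) (here refl) = inj₁ refl
AllPairs-∈ (d ∷ ds) (here refl) (there v∈)  = inj₂ (inj₁ (All.lookup d v∈))
AllPairs-∈ (d ∷ ds) (there u∈)  (here refl) = inj₂ (inj₂ (All.lookup d u∈))
AllPairs-∈ (d ∷ ds) (there u∈)  (there v∈)  = AllPairs-∈ ds u∈ v∈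

same-class : ∀ {n} {u v : Subset n} (cs : List (List (Subset n))) → All (AllPairs Disjoint) cs →
  (p : Any (u ∈_) cs) (q : Any (v ∈_) cs) → Any.index p ≡ Any.index q → u ≡ v ⊎ Disjoint u v ⊎ Disjoint v u
same-class (c ∷ cs) (d ∷ ds) (here p)  (here q)  eq = AllPairs-∈ d p q
same-class (c ∷ cs) (d ∷ ds) (there p) (there q) eq = same-class cs ds p q (Fin.suc-injective eq)

abstract

  -- The arcs `A` once more, in a form that the checks can evaluate; `A≡arcᶜ` identifies the two.
  arcᶜ : ∀ k → ℕ → Subset (13 + k)
  arcᶜ k t = tabulate λ x → (toℕ x + t * (12 + k)) % (13 + k) <ᵇ 4

  arcᶜ≡ : ∀ k t → arcᶜ k t ≡ tabulate (λ x → (toℕ x + t * (12 + k)) % (13 + k) <ᵇ 4)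
  arcᶜ≡ k t = refl

hits : ∀ {n} → List (Subset n) → Subset n → Bool
hits As P = all (λ A → not (disjoint P A)) As

arcs : ∀ k → List ℕ → List (Subset (13 + k))
arcs k = map (arcᶜ k)

-- If the arcs at `ts` all lie in C, these are the only places that a vertex of another component
-- can occupy.
hitters : ∀ k → List ℕ → List (Subset (13 + k))
hitters k ts = filterᵇ (hits (arcs k ts)) (subsets (13 + k) 4)

-- For a cycle all of whose arcs lie in a single component.
outside : ∀ k → List ℕ → Subset (13 + k) → List (Subset (13 + k))
outside k ts w = filterᵇ (λ P → disjoint P w ∧ not (hits (arcs k ts) P)) (subsets (13 + k) 4)

-- Compares (n - 4) times an upper bound for c with 4 times a lower bound for |S|, where w runs over
-- the possible places of a vertex outside the dominating component.
full-check : ℕ → Bool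
full-check k = all (λ w → (9 + k) * suc (length (classes hs)) <ᵇ 4 * length (outside k (upTo (13 + k)) w)) hs
  where hs = hitters k (upTo (13 + k))

-- For a cycle most of whose arcs lie in a single component of size at most (n - 1)(n - 4)/4.
sparse-check : ℕ → List ℕ → Bool
sparse-check k ts = (13 + k) * length (hitters k ts) + (13 + k) * (9 + k) <ᵇ 4 * length (subsets (13 + k) 4)

full-check⇒ : ∀ k → full-check k ≡ true → ∀ {w} → w ∈ hitters k (upTo (13 + k)) →
  (9 + k) * suc (length (classes (hitters k (upTo (13 + k))))) < 4 * length (outside k (upTo (13 + k)) w)
full-check⇒ k check {w} w∈ = <ᵇ⇒< ((9 + k) * suc (length (classes hs))) (4 * length (outside k (upTo (13 + k)) w))
  (subst T (sym (all-∈ (λ w → (9 + k) * suc (length (classes hs)) <ᵇ 4 * length (outside k (upTo (13 + k)) w)) hs check w∈)) _)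
  where hs = hitters k (upTo (13 + k))

sparse-check⇒ : ∀ k ts → sparse-check k ts ≡ true →
  (13 + k) * length (hitters k ts) + (13 + k) * (9 + k) < 4 * length (subsets (13 + k) 4)
sparse-check⇒ k ts check = <ᵇ⇒< ((13 + k) * length (hitters k ts) + (13 + k) * (9 + k)) (4 * length (subsets (13 + k) 4))
  (subst T (sym check) _)

-- Few enough arcs that some rotation puts all of them into the dominating component.
offsets : ℕ → List ℕ
offsets 0 = 0 ∷ 2 ∷ 4 ∷ 6 ∷ 8 ∷ 10 ∷ []
offsets 1 = 0 ∷ 2 ∷ 4 ∷ 6 ∷ 8 ∷ 11 ∷ []
offsets _ = 0 ∷ 4 ∷ 8 ∷ 12 ∷ []

abstract

  full-check≤3 : ∀ k → k ≤ 3 → full-check k ≡ true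
  full-check≤3 0 _ = refl
  full-check≤3 1 _ = refl
  full-check≤3 2 _ = refl
  full-check≤3 3 _ = refl
  full-check≤3 (suc (suc (suc (suc k)))) (s≤s (s≤s (s≤s ())))

  sparse-check≤7 : ∀ k → k ≤ 7 → sparse-check k (offsets k) ≡ true
  sparse-check≤7 0 _ = refl
  sparse-check≤7 1 _ = refl
  sparse-check≤7 2 _ = refl
  sparse-check≤7 3 _ = refl
  sparse-check≤7 4 _ = refl
  sparse-check≤7 5 _ = refl
  sparse-check≤7 6 _ = refl
  sparse-check≤7 7 _ = refl
  sparse-check≤7 (suc (suc (suc (suc (suc (suc (suc (suc k)))))))) (s≤s (s≤s (s≤s (s≤s (s≤s (s≤s (s≤s ())))))))

meet : ∀ {m} (u v : Subset m) → u ∩ v ≢ ⊥ → 1 ≤ ∑ (allFin m) (λ x → χ (lookup u x) * χ (lookup v x))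
meet {m} u v meets = n≢0⇒n>0 λ eq → meets (∩≡⊥⁺ u v (apart eq))
  where
  both : Fin m → ℕ
  both x = χ (lookup u x) * χ (lookup v x)
  apart : ∑ (allFin m) both ≡ 0 → ∀ x → lookup u x ≡ true → lookup v x ≡ true → Empty.⊥
  apart eq x p q = contradiction (≤-trans (≤-trans (≤-reflexive (sym (cong₂ (λ a b → χ a * χ b) p q))) (f≤∑ both (∈-allFin x))) (≤-reflexive eq)) λ ()

-- Cuts with a dominated cycle satisfy the strict bound

module Large (k : ℕ) (S : VSet (13 + k) 4) (c : ℕ) (f : Vertex (13 + k) 4 → Fin c)
  (sep : ∀ u v → S u ≡ false → S v ≡ false → Adj u v → f u ≡ f v)
  (onto : ∀ C → ∃ λ v → S v ≡ false × f v ≡ C) (2≤c : 2 ≤ c) where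

  open Labelled k S c f

  label-sep : ∀ {u v C D} → label u ≡ just C → label v ≡ just D → Adj u v → C ≡ D
  label-sep {u} {v} e₁ e₂ adj with label⁻ {u} e₁ | label⁻ {v} e₂
  ... | a₁ , refl | a₂ , refl = sep u v a₁ a₂ adj

  another : ∀ C → ∃ λ D → C ≢ D
  another C = go c 2≤c C
    where
    go : ∀ c → 2 ≤ c → (C : Fin c) → ∃ λ D → C ≢ D
    go _ (s≤s (s≤s _)) zero    = suc zero , λ ()
    go _ (s≤s (s≤s _)) (suc C) = zero , λ ()

  rep : Fin c → Vertex n 4
  rep D = proj₁ (onto D)

  label-rep : ∀ D → label (rep D) ≡ just D
  label-rep D with onto D
  ... | v , alive-v , refl = label-alive {v} alive-v

  module At (σ : Perm n) where

    abstract

      inv : Fin n → Fin n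
      inv y = proj₁ (surjective σ y)

      -- The places occupied by a vertex, found through the inverse of `σ`; this carries every
      -- arrangement back to the one fixed circle on which the checks are evaluated.
      positions : Vertex n 4 → Subset n
      positions v = tabulate (λ y → lookup (proj₁ v) (inv y))

      image-positions : ∀ v → image σ (positions v) ≡ proj₁ v
      image-positions v = begin
        image σ (positions v)                   ≡⟨ Vec.tabulate∘lookup _ ⟨
        tabulate (lookup (image σ (positions v))) ≡⟨ Vec.tabulate-cong same ⟩
        tabulate (lookup (proj₁ v))             ≡⟨ Vec.tabulate∘lookup (proj₁ v) ⟩
        proj₁ v                                 ∎
        where
        open ≡-Reasoning
        same : ∀ i → lookup (image σ (positions v)) i ≡ lookup (proj₁ v) i
        same i = begin
          lookup (image σ (positions v)) i            ≡⟨ lookup-image σ (positions v) i ⟩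
          lookup (positions v) (lookup (proj₁ σ) i)   ≡⟨ Vec.lookup∘tabulate (λ y → lookup (proj₁ v) (inv y)) (lookup (proj₁ σ) i) ⟩
          lookup (proj₁ v) (inv (lookup (proj₁ σ) i)) ≡⟨ cong (lookup (proj₁ v)) (injective σ (proj₂ (surjective σ (lookup (proj₁ σ) i)))) ⟩
          lookup (proj₁ v) i                          ∎

    positions-injective : ∀ {u v} → positions u ≡ positions v → u ≡ v
    positions-injective {u} {v} eq = Vertex-≡ (trans (sym (image-positions u)) (trans (cong (image σ) eq) (image-positions v)))

    positions∈ : ∀ v → positions v ∈ subsets n 4
    positions∈ v = subsets-complete n 4 (positions v) (trans (sym (∣image∣ σ (positions v))) (trans (cong ∣_∣ (image-positions v)) (proj₂ v)))

    -- Made total for use as the map in `∑-inject`; `arc σ 0` is an arbitrary default for sets of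
    -- the wrong size.
    place : Subset n → Vertex n 4
    place P with ∣ P ∣ ≟ 4
    ... | yes eq = image σ P , trans (∣image∣ σ P) eq
    ... | no _   = arc σ 0

    place≡ : ∀ P → ∣ P ∣ ≡ 4 → proj₁ (place P) ≡ image σ P
    place≡ P eq with ∣ P ∣ ≟ 4
    ... | yes _ = refl
    ... | no ≢4 = contradiction eq ≢4

    place-injective : ∀ P Q → P ∈ subsets n 4 → Q ∈ subsets n 4 → place P ≡ place Q → P ≡ Q
    place-injective P Q P∈ Q∈ eq = image-injective σ (trans (sym (place≡ P (subsets-size n 4 P∈))) (trans (cong proj₁ eq) (place≡ Q (subsets-size n 4 Q∈))))

    disjoint⇒adj : ∀ u v → positions u ∩ positions v ≡ ⊥ → Adj u v
    disjoint⇒adj u v eq = trans (cong₂ _∩_ (sym (image-positions u)) (sym (image-positions v))) (image-disjoint σ eq)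

    A≡arcᶜ : ∀ t → A t ≡ arcᶜ k t
    A≡arcᶜ t = trans (A≡ t) (sym (arcᶜ≡ k t))

    module _ (C : Fin c) (ts : List ℕ) (on : ∀ {t} → t ∈ ts → label (arc σ t) ≡ just C) where

      H : List (Subset n)
      H = hitters k ts

      disjoint-arc : ∀ {D} v P → label v ≡ just D → C ≢ D → image σ P ≡ proj₁ v → hits (arcs k ts) P ≡ true
      disjoint-arc v P lv C≢D eq = all-∈⁺ _ (arcs k ts) λ A∈ → meets (∈-map⁻ (arcᶜ k) A∈)
        where
        meets : ∀ {Q} → ∃ (λ t → t ∈ ts × Q ≡ arcᶜ k t) → not (disjoint P Q) ≡ true
        meets (t , t∈ , refl) with disjoint P (arcᶜ k t) in d
        ... | false = refl
        ... | true  = contradiction (sym (label-sep {v} {arc σ t} lv (on t∈) adj)) C≢D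
          where
          adj : Adj v (arc σ t)
          adj = trans (cong₂ _∩_ (sym eq) (cong (image σ) (A≡arcᶜ t))) (image-disjoint σ (disjoint⇒∩≡⊥ P (arcᶜ k t) d))

      positions∈H : ∀ {D} v → label v ≡ just D → C ≢ D → positions v ∈ H
      positions∈H v lv C≢D = filterᵇ-∈⁺ (hits (arcs k ts)) (positions∈ v) (disjoint-arc v (positions v) lv C≢D (image-positions v))

      -- The extra 1 is for C itself, which is sent to `nothing` while the other components are
      -- injected into `ys`.
      c≤suc : {Y : Set} (ys : List Y) (g : ∀ {D} → C ≢ D → Y) → (∀ {D E} (p : C ≢ D) (q : C ≢ E) → g p ≡ g q → D ≡ E) →
              (∀ {D} (p : C ≢ D) → g p ∈ ys) → c ≤ suc (length ys)
      c≤suc {Y} ys g inj sub = begin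
        c                                 ≡⟨ List.length-tabulate {n = c} id ⟨
        length (allFin c)                 ≤⟨ length-inject (Unique.allFin⁺ c) g′ (λ {D} {E} _ _ → inj′ (C Fin.≟ D) (C Fin.≟ E)) (λ {D} _ → sub′ (C Fin.≟ D)) ⟩
        length (nothing ∷ map just ys)    ≡⟨ cong suc (List.length-map just ys) ⟩
        suc (length ys)                   ∎
        where
        open ≤-Reasoning
        g″ : ∀ {D} → Dec (C ≡ D) → Maybe Y
        g″ (yes _) = nothing
        g″ (no p)  = just (g p)
        g′ : Fin c → Maybe Y
        g′ D = g″ (C Fin.≟ D)
        inj′ : ∀ {D E} (p : Dec (C ≡ D)) (q : Dec (C ≡ E)) → g″ p ≡ g″ q → D ≡ E
        inj′ (yes refl) (yes refl) _  = refl
        inj′ (no p)     (no q)     eq = inj p q (just-injective eq)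
        sub′ : ∀ {D} (p : Dec (C ≡ D)) → g″ p ∈ nothing ∷ map just ys
        sub′ (yes _) = here refl
        sub′ (no p)  = there (∈-map⁺ just (sub p))

      same-label : ∀ {D E} → positions (rep D) ≡ positions (rep E) → D ≡ E
      same-label {D} {E} eq = just-injective (trans (sym (label-rep D)) (trans (cong label (positions-injective eq)) (label-rep E)))

      c≤suc-H : c ≤ suc (length H)
      c≤suc-H = c≤suc H (λ {D} _ → positions (rep D)) (λ _ _ → same-label) (λ {D} C≢D → positions∈H (rep D) (label-rep D) C≢D)

      class : ∀ {D} → C ≢ D → Any (positions (rep D) ∈_) (classes H)
      class {D} C≢D = ∈-classes H (positions∈H (rep D) (label-rep D) C≢D)

      -- Representatives of different components are never disjoint, so no class of pairwise
      -- disjoint sets contains two of them.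
      c≤suc-classes : c ≤ suc (length (classes H))
      c≤suc-classes = subst (λ z → c ≤ suc z) (List.length-tabulate {n = length (classes H)} id)
        (c≤suc (allFin (length (classes H))) (λ p → Any.index (class p)) separate (λ p → ∈-allFin _))
        where
        separate : ∀ {D E} (p : C ≢ D) (q : C ≢ E) → Any.index (class p) ≡ Any.index (class q) → D ≡ E
        separate {D} {E} p q eq = cases (same-class (classes H) (classes-disjoint H) (class p) (class q) eq)
          where
          cases : _ → D ≡ E
          cases (inj₁ same)     = same-label same
          cases (inj₂ (inj₁ d)) = label-sep {rep D} {rep E} (label-rep D) (label-rep E) (disjoint⇒adj (rep D) (rep E) d)
          cases (inj₂ (inj₂ d)) = sym (label-sep {rep E} {rep D} (label-rep E) (label-rep D) (disjoint⇒adj (rep E) (rep D) d))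

      -- A set disjoint from v and from some arc of C is adjacent to both. If it were not in the
      -- cut, it would join the components D and C.
      outside≤size : ∀ {D} v → label v ≡ just D → C ≢ D → length (outside k ts (positions v)) ≤ size S
      outside≤size {D} v lv C≢D = begin
        length out            ≡⟨ length≡∑ out ⟩
        ∑ out (λ _ → 1)       ≤⟨ ∑-inject (filterᵇ-unique test (subsets-unique n 4)) place
                                   (λ {P} {Q} P∈ Q∈ → place-injective P Q (proj₁ (unfilter P∈)) (proj₁ (unfilter Q∈)))
                                   (λ _ → verts-complete _) {g = χ ∘ S} (λ {P} P∈ → let a , b = unfilter P∈ in ≤-reflexive (cong χ (sym (in-S P a b)))) ⟩
        ∑ verts (χ ∘ S)       ≡⟨ size≡∑verts S ⟨
        size S                ∎
        where
        open ≤-Reasoning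
        test : Subset n → Bool
        test P = disjoint P (positions v) ∧ not (hits (arcs k ts) P)
        out = outside k ts (positions v)
        unfilter : ∀ {P} → P ∈ out → P ∈ subsets n 4 × test P ≡ true
        unfilter = filterᵇ-∈⁻ test (subsets n 4)
        in-S : ∀ P → P ∈ subsets n 4 → test P ≡ true → S (place P) ≡ true
        in-S P P∈ tP = cases (S (place P)) (disjoint P (positions v)) (hits (arcs k ts) P) refl refl refl tP
          where
          place-P : proj₁ (place P) ≡ image σ P
          place-P = place≡ P (subsets-size n 4 P∈)
          f≡D : S (place P) ≡ false → disjoint P (positions v) ≡ true → f (place P) ≡ D
          f≡D sP d = label-sep {place P} {v} (label-alive {place P} sP) lv
            (trans (cong₂ _∩_ place-P (sym (image-positions v))) (image-disjoint σ (disjoint⇒∩≡⊥ P (positions v) d)))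
          cases : ∀ a b h → S (place P) ≡ a → disjoint P (positions v) ≡ b → hits (arcs k ts) P ≡ h → b ∧ not h ≡ true → S (place P) ≡ true
          cases true  _    _     sP d hP _ = sP
          cases false true false sP d hP _ = contradiction
            (trans (sym (disjoint-arc (place P) P (label-alive {place P} sP) (λ eq → C≢D (trans eq (f≡D sP d))) (sym place-P))) hP) λ ()

      full⇒large : ts ≡ upTo n → full-check k ≡ true → (9 + k) * c < 4 * size S
      full⇒large refl check = begin-strict
        (9 + k) * c                                   ≤⟨ *-monoʳ-≤ (9 + k) c≤suc-classes ⟩
        (9 + k) * suc (length (classes H))            <⟨ full-check⇒ k check (positions∈H (rep D) (label-rep D) C≢D) ⟩
        4 * length (outside k ts (positions (rep D))) ≤⟨ *-monoʳ-≤ 4 (outside≤size (rep D) (label-rep D) C≢D) ⟩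
        4 * size S                                    ∎
        where
        open ≤-Reasoning
        D = proj₁ (another C)
        C≢D = proj₂ (another C)

      other : Maybe (Fin c) → Bool
      other nothing  = false
      other (just D) = not (does (D Fin.≟ C))

      other⁻ : ∀ x → other x ≡ true → ∃ λ D → x ≡ just D × C ≢ D
      other⁻ (just D) eq with D Fin.≟ C
      ... | no D≢C = D , refl , D≢C ∘ sym

      #alive≤ : #alive ≤ class-size C + length H
      #alive≤ = begin
        #alive                                                    ≤⟨ ∑-mono verts (λ {v} _ → split (label v)) ⟩
        ∑ verts (λ v → is C (label v) + χ (other (label v)))      ≡⟨ ∑-+ verts (is C ∘ label) (χ ∘ other ∘ label) ⟩
        class-size C + ∑ verts (χ ∘ other ∘ label)                ≡⟨ cong (class-size C +_) (∑-filterᵇ (other ∘ label) verts) ⟩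
        class-size C + length (filterᵇ (other ∘ label) verts)     ≤⟨ +-monoʳ-≤ (class-size C) (length-inject (filterᵇ-unique (other ∘ label) verts-unique) positions
                                                                       (λ _ _ → positions-injective) into-H) ⟩
        class-size C + length H                                   ∎
        where
        open ≤-Reasoning
        split : ∀ x → alive x ≤ is C x + χ (other x)
        split nothing = z≤n
        split (just D) with does (D Fin.≟ C)
        ... | true  = s≤s z≤n
        ... | false = s≤s z≤n
        into-H : ∀ {v} → v ∈ filterᵇ (other ∘ label) verts → positions v ∈ H
        into-H {v} v∈ with other⁻ (label v) (proj₂ (filterᵇ-∈⁻ (other ∘ label) verts v∈))
        ... | D , e , C≢D = positions∈H v e C≢D

      #subsets≤N : length (subsets n 4) ≤ N
      #subsets≤N = length-inject (subsets-unique n 4) place (λ {P} {Q} → place-injective P Q) (λ _ → verts-complete _)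

      -- Adding 4 `#alive` on both sides turns the right side into 4N. Outside C there are at most
      -- |H| remaining vertices and at most |H| components, so the left side is at most n |H| + (n -
      -- 4) + 4s, and the assumption on s makes this n |H| + n (n - 4).
      sparse⇒large : sparse-check k ts ≡ true → 4 * class-size C ≤ (12 + k) * (9 + k) → (9 + k) * c < 4 * size S
      sparse⇒large check 4s≤ = +-cancelʳ-< (4 * #alive) ((9 + k) * c) (4 * size S) (begin-strict
        (9 + k) * c + 4 * #alive                                   ≤⟨ +-mono-≤ (*-monoʳ-≤ (9 + k) c≤suc-H) (*-monoʳ-≤ 4 #alive≤) ⟩
        (9 + k) * suc (length H) + 4 * (class-size C + length H)   ≡⟨ regroup k (length H) (class-size C) ⟩
        (13 + k) * length H + (9 + k + 4 * class-size C)           ≤⟨ +-monoʳ-≤ ((13 + k) * length H) (+-monoʳ-≤ (9 + k) 4s≤) ⟩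
        (13 + k) * length H + (9 + k + (12 + k) * (9 + k))         ≡⟨⟩
        (13 + k) * length H + (13 + k) * (9 + k)                   <⟨ sparse-check⇒ k ts check ⟩
        4 * length (subsets n 4)                                   ≤⟨ *-monoʳ-≤ 4 #subsets≤N ⟩
        4 * N                                                      ≡⟨ cong (4 *_) #alive+size ⟨
        4 * (#alive + size S)                                      ≡⟨ *-distribˡ-+ 4 #alive (size S) ⟩
        4 * #alive + 4 * size S                                    ≡⟨ +-comm (4 * #alive) _ ⟩
        4 * size S + 4 * #alive                                    ∎)
        where
        open ≤-Reasoning
        regroup : ∀ k H s → (9 + k) * suc H + 4 * (s + H) ≡ (13 + k) * H + (9 + k + 4 * s)
        regroup = solve-∀

  -- A vertex outside C meets every arc in C, and each of its four points lies on four arcs.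
  count≤16 : ∀ σ C → count-on σ C ≤ 16
  count≤16 σ C = begin
    count-on σ C
      ≤⟨ ∑-mono (range n) (λ {i} _ → bound (label (arc σ i)) refl) ⟩
    ∑ (range n) (λ i → ∑ (allFin n) (λ x → χ (lookup w x) * χ (lookup (proj₁ (arc σ i)) x)))
      ≡⟨ ∑-swap (range n) (allFin n) (λ i x → χ (lookup w x) * χ (lookup (proj₁ (arc σ i)) x)) ⟩
    ∑ (allFin n) (λ x → ∑ (range n) (λ i → χ (lookup w x) * χ (lookup (proj₁ (arc σ i)) x)))
      ≡⟨ ∑-cong (allFin n) (λ {x} _ → trans (∑-*ˡ (χ (lookup w x)) (range n) _)
           (cong (χ (lookup w x) *_) (trans (∑-cong (range n) (λ {i} _ → cong χ (lookup-image σ (A i) x))) (∑-arcs-through (lookup (proj₁ σ) x))))) ⟩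
    ∑ (allFin n) (λ x → χ (lookup w x) * 4)     ≡⟨ ∑-cong (allFin n) (λ {x} _ → *-comm (χ (lookup w x)) 4) ⟩
    ∑ (allFin n) (λ x → 4 * χ (lookup w x))     ≡⟨ ∑-*ˡ 4 (allFin n) (λ x → χ (lookup w x)) ⟩
    4 * ∑ (allFin n) (λ x → χ (lookup w x))     ≡⟨ cong (4 *_) (trans (∑-allFin-lookup w) (proj₂ (rep D))) ⟩
    16                                          ∎
    where
    open ≤-Reasoning
    D = proj₁ (another C)
    C≢D = proj₂ (another C)
    w : Subset n
    w = proj₁ (rep D)
    bound : ∀ {i} y → label (arc σ i) ≡ y → is C y ≤ ∑ (allFin n) (λ x → χ (lookup w x) * χ (lookup (proj₁ (arc σ i)) x))
    bound nothing  e = z≤n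
    bound {i} (just E) e with E Fin.≟ C
    ... | no _ = z≤n
    ... | yes refl = meet w (proj₁ (arc σ i)) (λ eq → C≢D (sym (label-sep {rep D} {arc σ i} (label-rep D) e eq)))

  module _ (σ : Perm n) (C : Fin c) where

    miss : ℕ → ℕ
    miss i = 1 ∸ is C (label (arc σ i))

    misses : ℕ
    misses = ∑ (range n) miss

    misses+count : misses + count-on σ C ≡ n
    misses+count = begin
      misses + count-on σ C                                       ≡⟨ ∑-+ (range n) miss (λ i → is C (label (arc σ i))) ⟨
      ∑ (range n) (λ i → miss i + is C (label (arc σ i)))         ≡⟨ ∑-cong (range n) (λ {i} _ → m∸n+n≡m (is≤1 C (label (arc σ i)))) ⟩
      ∑ (range n) (λ _ → 1)                                       ≡⟨ ∑-const (range n) 1 ⟩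
      length (range n) * 1                                        ≡⟨ trans (*-identityʳ _) (length-range n) ⟩
      n                                                           ∎
      where open ≡-Reasoning

    is-1 : ∀ x → 1 ∸ is C x ≡ 0 → x ≡ just C
    is-1 nothing ()
    is-1 (just D) eq with D Fin.≟ C
    is-1 (just D) eq | yes refl = refl

    -- Averaging over the n rotations: if each one had a miss at some place of `ts`, the misses
    -- would total at least n, but each place of `ts` meets every arc once and so contributes
    -- exactly `misses`.
    locate : ∀ ts → length ts * misses < n → ∃ λ j → ∀ {t} → t ∈ ts → label (arc (rotᴾ j σ) t) ≡ just C
    locate ts lt = go (anyUpTo? (λ j → ∑ ts (λ t → miss (t + j)) ≟ 0) n)
     where
     go : Dec (∃ λ j → j < n × ∑ ts (λ t → miss (t + j)) ≡ 0) → ∃ λ j → ∀ {t} → t ∈ ts → label (arc (rotᴾ j σ) t) ≡ just C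
     go (yes (j , _ , eq)) = j , λ {t} t∈ → trans (cong label (trans (arc-rotᴾ j σ t) (cong (arc σ) (+-comm j t))))
            (is-1 (label (arc σ (t + j))) (n≤0⇒n≡0 (≤-trans (f≤∑ (λ t → miss (t + j)) t∈) (≤-reflexive eq))))
     go (no none) = contradiction lt (≤⇒≯ (begin
      n                                                   ≡⟨ trans (*-identityʳ _) (length-range n) ⟨
      length (range n) * 1                                ≡⟨ ∑-const (range n) 1 ⟨
      ∑ (range n) (λ _ → 1)                               ≤⟨ ∑-mono (range n) (λ {j} j∈ → n≢0⇒n>0 (λ eq → none (j , ∈-range⁻ j∈ , eq))) ⟩
      ∑ (range n) (λ j → ∑ ts (λ t → miss (t + j)))       ≡⟨ ∑-swap (range n) ts (λ j t → miss (t + j)) ⟩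
      ∑ ts (λ t → ∑ (range n) (λ j → miss (t + j)))       ≡⟨ ∑-cong ts (λ {t} _ → ∑-shift n miss (λ i → cong (λ v → 1 ∸ is C (label v)) (arc-period σ i)) t) ⟩
      ∑ ts (λ _ → misses)                                 ≡⟨ ∑-const ts misses ⟩
      length ts * misses                                  ∎))
       where open ≤-Reasoning

    full-case : n ≤ count-on σ C → (9 + k) * c < 4 * size S
    full-case n≤count = go (locate (upTo n) few)
      where
      misses≡0 : misses ≡ 0
      misses≡0 = n≤0⇒n≡0 (+-cancelʳ-≤ n misses 0 (≤-trans (+-monoʳ-≤ misses n≤count) (≤-reflexive misses+count)))
      few : length (upTo n) * misses < n
      few = ≤-trans (≤-reflexive (cong suc (trans (cong (length (upTo n) *_) misses≡0) (*-zeroʳ (length (upTo n)))))) (s≤s z≤n)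
      check : full-check k ≡ true
      check = full-check≤3 k (+-cancelˡ-≤ 13 k 3 (≤-trans n≤count (count≤16 σ C)))
      go : ∃ (λ j → ∀ {t} → t ∈ upTo n → label (arc (rotᴾ j σ) t) ≡ just C) → (9 + k) * c < 4 * size S
      go (j , on) = At.full⇒large (rotᴾ j σ) C (upTo n) on refl check

    sparse-case : 43 + 3 * k ≤ 4 * count-on σ C → 4 * class-size C ≤ (12 + k) * (9 + k) → (9 + k) * c < 4 * size S
    sparse-case many 4s≤ = go (locate (offsets k) (few k misses 4misses≤))
      where
      4misses≤ : 4 * misses ≤ 9 + k
      4misses≤ = +-cancelʳ-≤ (43 + 3 * k) (4 * misses) (9 + k) (begin
        4 * misses + (43 + 3 * k)          ≤⟨ +-monoʳ-≤ (4 * misses) many ⟩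
        4 * misses + 4 * count-on σ C      ≡⟨ *-distribˡ-+ 4 misses _ ⟨
        4 * (misses + count-on σ C)        ≡⟨ cong (4 *_) misses+count ⟩
        4 * n                              ≡⟨ lemma k ⟩
        9 + k + (43 + 3 * k)               ∎)
        where
        open ≤-Reasoning
        lemma : ∀ k → 4 * (13 + k) ≡ 9 + k + (43 + 3 * k)
        lemma = solve-∀
      -- For n = 13 and n = 14 the hypothesis gives b ≤ 2, so six offsets are affordable. From n =
      -- 15 on there are four, and 4b ≤ n - 4 is enough.
      few : ∀ k b → 4 * b ≤ 9 + k → length (offsets k) * b < 13 + k
      few 0 b le = ≤-trans (s≤s (*-monoʳ-≤ 6 (≤-pred (*-cancelˡ-< 4 b 3 (≤-<-trans le (m≤m+n 10 2)))))) ≤-refl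
      few 1 b le = ≤-trans (s≤s (*-monoʳ-≤ 6 (≤-pred (*-cancelˡ-< 4 b 3 (≤-<-trans le (m≤m+n 11 1)))))) (n≤1+n 13)
      few (suc (suc k)) b le = ≤-<-trans le (s≤s (+-monoˡ-≤ (2 + k) (m≤m+n 9 3)))
      k≤7 : k ≤ 7
      k≤7 = *-cancelˡ-≤ 3 (+-cancelˡ-≤ 43 (3 * k) 21 (≤-trans many (*-monoʳ-≤ 4 (count≤16 σ C))))
      go : ∃ (λ j → ∀ {t} → t ∈ offsets k → label (arc (rotᴾ j σ) t) ≡ just C) → (9 + k) * c < 4 * size S
      go (j , on) = At.sparse⇒large (rotᴾ j σ) C (offsets k) on (sparse-check≤7 k k≤7) 4s≤

  -- A cycle that violates `Good` proves the strict inequality for the whole cut, so `Good` follows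
  -- as soon as that inequality fails.
  large-or-good : (9 + k) * c < 4 * size S ⊎ Good
  large-or-good = go ((9 + k) * c <? 4 * size S)
    where
    good : ¬ (9 + k) * c < 4 * size S → Good
    good ¬large σ C = cases (count-on σ C <? n) (4 * count-on σ C <? 43 + 3 * k) ((12 + k) * (9 + k) <? 4 * class-size C)
      where
      cases : Dec (count-on σ C < n) → Dec (4 * count-on σ C < 43 + 3 * k) → Dec ((12 + k) * (9 + k) < 4 * class-size C) →
              count-on σ C < n × (4 * count-on σ C < 43 + 3 * k ⊎ (12 + k) * (9 + k) < 4 * class-size C)
      cases (no ≮n)  _         _         = contradiction (full-case σ C (≮⇒≥ ≮n)) ¬large
      cases (yes <n) (yes few) _         = <n , inj₁ few
      cases (yes <n) (no ≮few) (yes big) = <n , inj₂ big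
      cases (yes <n) (no ≮few) (no ≮big) = contradiction (sparse-case σ C (≮⇒≥ ≮few) (≮⇒≥ ≮big)) ¬large
    go : Dec ((9 + k) * c < 4 * size S) → (9 + k) * c < 4 * size S ⊎ Good
    go (yes large) = inj₁ large
    go (no ¬large) = inj₂ (good ¬large)

-- The theorem

lookup-unique : ∀ {X : Set} {xs : List X} → Unique xs → ∀ i j → List.lookup xs i ≡ List.lookup xs j → i ≡ j
lookup-unique {xs = x ∷ xs} (x∉ ∷ u) zero    zero    eq = refl
lookup-unique {xs = x ∷ xs} (x∉ ∷ u) zero    (suc j) eq = contradiction eq (All.lookup x∉ (∈-lookup j))
lookup-unique {xs = x ∷ xs} (x∉ ∷ u) (suc i) zero    eq = contradiction (sym eq) (All.lookup x∉ (∈-lookup i))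
lookup-unique {xs = x ∷ xs} (x∉ ∷ u) (suc i) (suc j) eq = cong suc (lookup-unique u i j eq)

not≡false⇒true : ∀ {b} → not b ≡ false → b ≡ true
not≡false⇒true {true} _ = refl

not≡true⇒false : ∀ {b} → not b ≡ true → b ≡ false
not≡true⇒false {false} _ = refl

-- Complements of independent sets as cuts

module _ {n k : ℕ} where

  size+size-not : (J : VSet n k) → size J + size (not ∘ J) ≡ #vertices
  size+size-not J = begin
    size J + size (not ∘ J)                         ≡⟨ cong₂ _+_ (size≡∑verts J) (size≡∑verts (not ∘ J)) ⟩
    ∑ verts (χ ∘ J) + ∑ verts (χ ∘ not ∘ J)         ≡⟨ ∑-+ verts (χ ∘ J) (χ ∘ not ∘ J) ⟨
    ∑ verts (λ v → χ (J v) + χ (not (J v)))         ≡⟨ ∑-cong verts (λ {v} _ → one (J v)) ⟩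
    ∑ (verts {n} {k}) (λ _ → 1)                     ≡⟨ length≡∑ verts ⟨
    #vertices                                       ∎
    where
    open ≡-Reasoning
    one : ∀ b → χ b + χ (not b) ≡ 1
    one true  = refl
    one false = refl

  -- Only members of J remain and no two are adjacent, so each is a component by itself and its
  -- index in the list of members can serve as its label.
  module Singletons (J : VSet n k) (ind : Independent J) (1≤size : 1 ≤ size J) where

    members : List (Vertex n k)
    members = filterᵇ J verts

    length-members : length members ≡ size J
    length-members = trans (sym (∑-filterᵇ J verts)) (sym (size≡∑verts J))

    member : ∀ {v} → J v ≡ true → v ∈ members
    member {v} = filterᵇ-∈⁺ J (verts-complete v)

    index : ∀ v b → J v ≡ b → Fin (length members)
    index v true  eq = Any.index (member eq)
    -- A deleted vertex needs some label as well; index 0 exists because J is not empty.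
    index v false eq = fromℕ< (subst (1 ≤_) (sym length-members) 1≤size)

    f : Vertex n k → Fin (length members)
    f v = index v (J v) refl

    lookup-index : ∀ v b (eq : J v ≡ b) → b ≡ true → List.lookup members (index v b eq) ≡ v
    lookup-index v true eq _ = sym (Any.lookup-index (member eq))

    lookup-f : ∀ {v} → J v ≡ true → List.lookup members (f v) ≡ v
    lookup-f {v} eq = lookup-index v (J v) refl eq

    onto : ∀ i → ∃ λ v → not (J v) ≡ false × f v ≡ i
    onto i = v , cong not Jv , lookup-unique (filterᵇ-unique J verts-unique) (f v) i (lookup-f Jv)
      where
      v = List.lookup members i
      Jv : J v ≡ true
      Jv = proj₂ (filterᵇ-∈⁻ J verts (∈-lookup i))

    reach⇒≡ : ∀ {u v} → Reach (not ∘ J) u v → u ≡ v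
    reach⇒≡ (here _) = refl
    reach⇒≡ (step {v} {w} r adj w∈) = contradiction adj (ind v w (not≡false⇒true (alive r)) (not≡false⇒true w∈))
      where
      alive : ∀ {u v} → Reach (not ∘ J) u v → not (J v) ≡ false
      alive (here a)     = a
      alive (step _ _ a) = a

    components : Components (not ∘ J) (length members)
    components = f , onto , λ u v u∈ v∈ → mk⇔
      (λ eq → subst (Reach (not ∘ J) u) (trans (sym (lookup-f (not≡false⇒true u∈))) (trans (cong (List.lookup members) eq) (lookup-f (not≡false⇒true v∈)))) (here u∈))
      (λ r → cong f (reach⇒≡ r))

    cut : 2 ≤ size J → CutWith (not ∘ J) (size J)
    cut 2≤ = 2≤ , subst (Components (not ∘ J)) length-members components

module Main (k : ℕ) where

  n : ℕ
  n = 13 + k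

  V# : ℕ
  V# = #vertices {n} {4}

  adjacent-labels : ∀ (S : VSet n 4) {c} ((f , _) : Components S c) → ∀ u v → S u ≡ false → S v ≡ false → Adj u v → f u ≡ f v
  adjacent-labels S (f , _ , iff) u v su sv adj = Equivalence.from (iff u v su sv) (step (here su) adj sv)

  module Cut (S : VSet n 4) (c : ℕ) (2≤c : 2 ≤ c) (comps : Components S c) where

    f = proj₁ comps
    onto = proj₁ (proj₂ comps)

    open Labelled k S c f using (label; label-alive; class-size; Good) public
    open Labelled.Averaging k S c f (adjacent-labels S comps) onto using (good⇒bound; good⇒rigid) public
    open Large k S c f (adjacent-labels S comps) onto 2≤c using (large-or-good) public

  toughness-bound : ∀ (S : VSet n 4) c → CutWith S c → (9 + k) * c ≤ 4 * size S
  toughness-bound S c (2≤c , comps) = go large-or-good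
    where
    open Cut S c 2≤c comps
    go : _ → (9 + k) * c ≤ 4 * size S
    go (inj₁ large) = <⇒≤ large
    go (inj₂ good)  = good⇒bound good

  -- A rearrangement of (n - 4) |J| ≤ 4 (N - |J|), the toughness bound for the complement of J; two
  -- members are required for it to be a cut.
  erdős-ko-rado : ∀ (J : VSet n 4) → Independent J → 2 ≤ size J → n * size J ≤ 4 * V#
  erdős-ko-rado J ind 2≤ = begin
    n * size J                          ≡⟨ split k (size J) ⟩
    4 * size J + (9 + k) * size J       ≤⟨ +-monoʳ-≤ (4 * size J) (toughness-bound (not ∘ J) (size J) (Singletons.cut J ind (<⇒≤ 2≤) 2≤)) ⟩
    4 * size J + 4 * size (not ∘ J)     ≡⟨ *-distribˡ-+ 4 (size J) _ ⟨
    4 * (size J + size (not ∘ J))       ≡⟨ cong (4 *_) (size+size-not J) ⟩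
    4 * V#                              ∎
    where
    open ≤-Reasoning
    split : ∀ k s → (13 + k) * s ≡ 4 * s + (9 + k) * s
    split = solve-∀

  star : VSet n 4
  star v = lookup (proj₁ v) zero

  star-independent : Independent star
  star-independent u v pu pv adj = ∩≡⊥⁻ (proj₁ u) (proj₁ v) adj zero pu pv

  module _ where

    -- The counting identities hold for every labelling; the constant one supplies them here.
    open Labelled k star 1 (λ _ → zero) using (arc; arc-injective; A; K; K>0; #perms; ∑-cycle; ∑-arcs-through)

    star-arcs : ∀ σ → ∑ (range n) (λ i → χ (star (arc σ i))) ≡ 4
    star-arcs σ = trans (∑-cong (range n) (λ {i} _ → cong χ (lookup-image σ (A i) zero))) (∑-arcs-through (lookup (proj₁ σ) zero))

    -- Each cycle has exactly four arcs through a given point, so averaging yields the size of the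
    -- star without binomial coefficients.
    n*star : n * size star ≡ 4 * V#
    n*star = *-cancelˡ-≡ (n * size star) (4 * V#) K {{>-nonZero K>0}} (begin
      K * (n * size star)                                            ≡⟨ regroup K n (size star) ⟩
      n * (K * size star)                                            ≡⟨ cong (λ s → n * (K * s)) (size≡∑verts star) ⟩
      n * (K * ∑ verts (χ ∘ star))                                   ≡⟨ ∑-cycle (χ ∘ star) ⟨
      ∑ perms (λ σ → ∑ (range n) (λ i → χ (star (arc σ i))))         ≡⟨ ∑-cong perms (λ {σ} _ → star-arcs σ) ⟩
      ∑ (perms {n}) (λ _ → 4)                                        ≡⟨ ∑-const perms 4 ⟩
      length (perms {n}) * 4                                         ≡⟨ cong (_* 4) #perms ⟩
      K * V# * 4                                                     ≡⟨ regroup′ K V# ⟩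
      K * (4 * V#)                                                   ∎)
      where
      open ≡-Reasoning
      regroup : ∀ K n s → K * (n * s) ≡ n * (K * s)
      regroup = solve-∀
      regroup′ : ∀ K v → K * v * 4 ≡ K * (4 * v)
      regroup′ = solve-∀

    2≤star : 2 ≤ size star
    2≤star = begin
      2                                             ≤⟨ s≤s (s≤s z≤n) ⟩
      4                                             ≡⟨ star-arcs idᴾ ⟨
      ∑ (range n) (λ i → χ (star (arc idᴾ i)))      ≤⟨ ∑-inject (range-unique n) (arc idᴾ) (λ p q → arc-injective idᴾ (∈-range⁻ p) (∈-range⁻ q))
                                                         (λ {i} _ → verts-complete (arc idᴾ i)) {g = χ ∘ star} (λ _ → ≤-refl) ⟩
      ∑ verts (χ ∘ star)                            ≡⟨ size≡∑verts star ⟨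
      size star                                     ∎
      where open ≤-Reasoning

  star-tight : 4 * size (not ∘ star) ≡ (9 + k) * size star
  star-tight = +-cancelˡ-≡ (4 * size star) _ _ (begin
    4 * size star + 4 * size (not ∘ star)     ≡⟨ *-distribˡ-+ 4 (size star) _ ⟨
    4 * (size star + size (not ∘ star))       ≡⟨ cong (4 *_) (size+size-not star) ⟩
    4 * V#                                    ≡⟨ n*star ⟨
    n * size star                             ≡⟨ split k (size star) ⟩
    4 * size star + (9 + k) * size star       ∎)
    where
    open ≡-Reasoning
    split : ∀ k s → (13 + k) * s ≡ 4 * s + (9 + k) * s
    split = solve-∀

  not-self-adjacent : (v : Vertex n 4) → ¬ Adj v v
  not-self-adjacent (s , ∣s∣≡4) adj = contradiction (begin
    4             ≡⟨ ∣s∣≡4 ⟨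
    ∣ s ∣         ≡⟨ cong ∣_∣ (Subset.∩-idem s) ⟨
    ∣ s ∩ s ∣     ≡⟨ cong ∣_∣ adj ⟩
    ∣ ⊥ {n} ∣     ≡⟨ Subset.∣⊥∣≡0 n ⟩
    0             ∎) λ ()
    where open ≡-Reasoning

  -- By rigidity all components are single vertices. Adjacent vertices outside S share a component,
  -- so they would coincide, and no vertex is adjacent to itself.
  extremal : ∀ (S : VSet n 4) c → CutWith S c → 4 * size S ≡ (9 + k) * c →
             ∃ λ (I : VSet n 4) → MaxIndependent I × (∀ v → S v ≡ not (I v))
  extremal S c (2≤c , comps) eq = I , (independent , maximal) , λ v → sym (Bool.not-involutive (S v))
    where
    open Cut S c 2≤c comps
    I : VSet n 4
    I = not ∘ S
    rigid : ∀ v C → label v ≡ just C → class-size C ≡ 1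
    rigid = go large-or-good
      where
      go : _ → ∀ v C → label v ≡ just C → class-size C ≡ 1
      go (inj₁ large) = contradiction (sym eq) (<⇒≢ large)
      go (inj₂ good)  = good⇒rigid good eq
    same : ∀ {u v C} → label u ≡ just C → label v ≡ just C → Dec (u ≡ v) → u ≡ v
    same _ _ (yes p) = p
    same {u} {v} {C} lu lv (no u≢v) = contradiction (begin
      2                                              ≡⟨ cong₂ (λ x y → x + (y + 0)) (one lu) (one lv) ⟨
      ∑ (u ∷ v ∷ []) (is C ∘ label)                  ≤⟨ ∑-inject ((u≢v ∷ []) ∷ ([] ∷ [])) id (λ _ _ → id) (λ _ → verts-complete _) {g = is C ∘ label} (λ _ → ≤-refl) ⟩
      class-size C                                   ≡⟨ rigid u C lu ⟩
      1                                              ∎) λ { (s≤s ()) }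
      where
      open ≤-Reasoning
      one : ∀ {v} → label v ≡ just C → is C (label v) ≡ 1
      one e = trans (cong (is C) e) (is-self C)
    independent : Independent I
    independent u v u∈ v∈ adj = not-self-adjacent v (subst (λ w → Adj w v) u≡v adj)
      where
      su = not≡true⇒false u∈
      sv = not≡true⇒false v∈
      u≡v : u ≡ v
      u≡v = same {u} {v} (label-alive {u} su) (trans (label-alive {v} sv) (cong just (sym (adjacent-labels S comps u v su sv adj)))) (u ≟ⱽ v)
    c≤I : c ≤ size I
    c≤I = begin
      c                             ≡⟨ List.length-tabulate {n = c} id ⟨
      length (allFin c)             ≤⟨ length-inject (Unique.allFin⁺ c) (proj₁ ∘ onto)
                                         (λ {C} {D} _ _ e → trans (sym (proj₂ (proj₂ (onto C)))) (trans (cong f e) (proj₂ (proj₂ (onto D)))))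
                                         (λ {C} _ → filterᵇ-∈⁺ I (verts-complete _) (cong not (proj₁ (proj₂ (onto C))))) ⟩
      length (filterᵇ I verts)      ≡⟨ ∑-filterᵇ I verts ⟨
      ∑ verts (χ ∘ I)               ≡⟨ size≡∑verts I ⟨
      size I                        ∎
      where open ≤-Reasoning
    maximal : ∀ J → Independent J → size J ≤ size I
    maximal J ind = go (2 ≤? size J)
      where
      open ≤-Reasoning
      split : ∀ k s → 4 * s + (9 + k) * s ≡ (13 + k) * s
      split = solve-∀
      go : Dec (2 ≤ size J) → size J ≤ size I
      -- A set J with at most one member does not define a cut; here 2 ≤ c ≤ |I| settles the
      -- comparison.
      go (no ≱2) = ≤-trans (≤-pred (≰⇒> ≱2)) (≤-trans (≤-trans (n≤1+n 1) 2≤c) c≤I)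
      go (yes ≥2) = *-cancelˡ-≤ n (begin
        n * size J                      ≤⟨ erdős-ko-rado J ind ≥2 ⟩
        4 * V#                          ≡⟨ cong (4 *_) (size+size-not S) ⟨
        4 * (size S + size I)           ≡⟨ trans (*-distribˡ-+ 4 (size S) (size I)) (+-comm (4 * size S) _) ⟩
        4 * size I + 4 * size S         ≡⟨ cong (4 * size I +_) eq ⟩
        4 * size I + (9 + k) * c        ≤⟨ +-monoʳ-≤ (4 * size I) (*-monoʳ-≤ (9 + k) c≤I) ⟩
        4 * size I + (9 + k) * size I   ≡⟨ split k (size I) ⟩
        n * size I                      ∎)

-- A family in n, to be transported from 13 + (n ∸ 13) to n; at 13 + k the factor `n ∸ 4` computes
-- to 9 + k. The value n/4 - 1 appears with denominators cleared, as a lower bound together with a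
-- cut attaining it.
Toughness : ℕ → Set
Toughness n = ((∀ (S : VSet n 4) (c : ℕ) → CutWith S c → (n ∸ 4) * c ≤ 4 * size S)
    × (∃ λ (S : VSet n 4) → ∃ λ c → CutWith S c × 4 * size S ≡ (n ∸ 4) * c))
    × (∀ (S : VSet n 4) (c : ℕ) → CutWith S c → 4 * size S ≡ (n ∸ 4) * c →
    ∃ λ (I : VSet n 4) → MaxIndependent I × (∀ v → S v ≡ not (I v)))

toughness : ∀ k → Toughness (13 + k)
toughness k =
  ( toughness-bound
  , not ∘ star , size star , Singletons.cut star star-independent (<⇒≤ 2≤star) 2≤star , star-tight)
  , extremal
  where open Main k

theorem23 : (n : ℕ) → 13 ≤ n →
    ((∀ (S : VSet n 4) (c : ℕ) → CutWith S c → (n ∸ 4) * c ≤ 4 * size S)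
    × (∃ λ (S : VSet n 4) → ∃ λ c → CutWith S c × 4 * size S ≡ (n ∸ 4) * c))
    × (∀ (S : VSet n 4) (c : ℕ) → CutWith S c → 4 * size S ≡ (n ∸ 4) * c →
    ∃ λ (I : VSet n 4) → MaxIndependent I × (∀ v → S v ≡ not (I v)))
theorem23 n 13≤n = subst Toughness (m+[n∸m]≡n 13≤n) (toughness (n ∸ 13))
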